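{- There is an absolute constant $c>0$ such that for every non-negative integer $k$, every excluded pivot-minor for the class of graphs of linear rank-width at most $k$ has at most $2^{2^{c(k+1)^2}}$ vertices. (That is, $2^{2^{O(k^2)}}$ vertices.)
   Context: All graphs are finite and simple. For a graph $G$ and $X\subseteq V(G)$, the cut-rank $\rho_G(X)$ is the rank over the binary field of the $X\times(V(G)-X)$ matrix whose $(a,b)$-entry is $1$ iff $a$ and $b$ are adjacent. The linear rank-width of $G$ is the minimum, over all orderings $v_1,\dots,v_n$ of $V(G)$, of $\max_{1\le i<n}\rho_G(\{v_1,\dots,v_i\})$ (taken to be $0$ if $n\le1$). For an edge $uv$ of $G$, the pivot $G\wedge uv$ is obtained by flipping (adding if absent, deleting if present) the adjacency of every pair $x,y$ with $x,y$ lying in two different sets among $N(u)\cap N(v)$, $N(u)-N(v)$, $N(v)-N(u)$, and then swapping the labels of $u$ and $v$. A pivot-minor of $G$ is an induced subgraph of a graph obtained from $G$ by a sequence of pivots; it is proper if it has fewer vertices than $G$. An excluded pivot-minor for a class $\mathcal C$ is a graph not in $\mathcal C$ all of whose proper pivot-minors are in $\mathcal C$. -}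

module Defs where

open import Data.Nat using (ℕ; zero; suc; _≤_; _<_; _<ᵇ_; _+_; _*_; _^_)
open import Data.Bool using (Bool; true; false; _∧_; _∨_; _xor_; not; if_then_else_)
open import Data.Fin using (Fin; zero; suc; toℕ; _≟_)
open import Data.Fin.Subset using (Subset; _∈_; _∉_; _⊆_; ∣_∣; Nonempty)
open import Data.Fin.Permutation using (Permutation′; _⟨$⟩ˡ_)
open import Data.Vec using (tabulate; lookup)
open import Data.Product using (Σ; _×_; ∃)
open import Function using (_∘_; Injective)
open import Relation.Binary.PropositionalEquality using (_≡_)
open import Relation.Nullary using (¬_)
open import Relation.Nullary.Decidable using (⌊_⌋)

Adj : ℕ → Set
Adj n = Fin n → Fin n → Bool

IsSimple : ∀ {n} → Adj n → Set
IsSimple {n} G = (∀ (x y : Fin n) → G x y ≡ G y x) × (∀ (x : Fin n) → G x x ≡ false)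

⊕-sum : ∀ {n} → (Fin n → Bool) → Bool
⊕-sum {zero} f = false
⊕-sum {suc n} f = f zero xor ⊕-sum (f ∘ suc)

rowComb : ∀ {n} → Adj n → Subset n → Fin n → Bool
rowComb G T b = ⊕-sum (λ a → lookup T a ∧ G a b)

-- S is a set of rows of the X × (V - X) matrix that is linearly independent
-- over GF(2): no nonempty subset of these rows sums to the zero vector
-- (restricted to the columns V - X).
IndepRows : ∀ {n} → Adj n → Subset n → Subset n → Set
IndepRows {n} G X S =
  S ⊆ X × (∀ (T : Subset n) → T ⊆ S → Nonempty T →
            ∃ λ (b : Fin n) → b ∉ X × rowComb G T b ≡ true)

-- ρ_G(X) ≤ k : rank over GF(2) (maximum size of a linearly independent
-- set of rows) of the X × (V - X) adjacency matrix is at most k.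
CutRank≤ : ∀ {n} → Adj n → Subset n → ℕ → Set
CutRank≤ {n} G X k = ∀ (S : Subset n) → IndepRows G X S → ∣ S ∣ ≤ k

-- the first i vertices of the ordering v_j = π ⟨$⟩ʳ j
prefix : ∀ {n} → Permutation′ n → ℕ → Subset n
prefix π i = tabulate (λ x → toℕ (π ⟨$⟩ˡ x) <ᵇ i)

LRW≤ : ∀ {n} → Adj n → ℕ → Set
LRW≤ {n} G k =
  ∃ λ (π : Permutation′ n) → ∀ (i : ℕ) → 1 ≤ i → i < n → CutRank≤ G (prefix π i) k

-- pivot G ∧ uv (u,v themselves belong to none of the three sets)
pivot : ∀ {n} → Adj n → Fin n → Fin n → Adj n
pivot {n} G u v x y = G (sw x) (sw y) xor flipP (sw x) (sw y)
  where
  sw : Fin n → Fin n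
  sw z = if ⌊ z ≟ u ⌋ then v else (if ⌊ z ≟ v ⌋ then u else z)
  inCls : Fin n → Bool
  inCls a = (G u a ∨ G v a) ∧ not ⌊ a ≟ u ⌋ ∧ not ⌊ a ≟ v ⌋
  same : Bool → Bool → Bool
  same p q = if p then q else not q
  sameCls : Fin n → Fin n → Bool
  sameCls a b = same (G u a) (G u b) ∧ same (G v a) (G v b)
  flipP : Fin n → Fin n → Bool
  flipP a b = inCls a ∧ inCls b ∧ not (sameCls a b)

data Pivots {n : ℕ} : Adj n → Adj n → Set where
  done : ∀ {G} → Pivots G G
  step : ∀ {G G'} (u v : Fin n) → G u v ≡ true → Pivots (pivot G u v) G' → Pivots G G'

PivotMinor : ∀ {m n} → Adj m → Adj n → Set
PivotMinor {m} {n} H G =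
  Σ (Adj n) λ G' → Pivots G G' ×
    Σ (Fin m → Fin n) λ e → Injective _≡_ _≡_ e ×
      (∀ (x y : Fin m) → H x y ≡ G' (e x) (e y))

ExcludedPivotMinorLRW : ℕ → ∀ {n} → Adj n → Set
ExcludedPivotMinorLRW k {n} G =
  ¬ LRW≤ G k ×
  (∀ (m : ℕ) (H : Adj m) → PivotMinor H G → m < n → LRW≤ H k)

{-# OPTIONS --safe #-}

module Submission where

-- Let M be the adjacency matrix of G over the binary field.  The cut-rank of X is
-- |X| - dim K(X), where K(X) consists of the x such that x and Mx are supported in X.
-- Pivoting on uv exchanges the coordinates x_v and (Mx)_v at u and at v, so that a
-- pivot-minor on the complement of D amounts to imposing x_v = 0 or (Mx)_v = 0 at
-- every v in D.
--
-- A large excluded minor G has a long layout of width at most k + 1, and hence a long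
-- chain A_0 ⊂ … ⊂ A_l of sets of the same cut-rank w without a set of smaller cut-rank
-- between A_0 and A_l.  Submodularity gives constraints on A_l ∖ A_0 that keep the
-- cut-rank of A_0 equal to w (Tutte's linking theorem), and with them a common space of
-- signals of dimension 2w through which every A_i is glued to the complement C_j of every
-- A_j with i ≤ j.  The cut-rank of S ∪ T with S ⊆ A_i and T ⊆ C_j is then determined by
-- the cut-ranks of S and T and by two subspaces of the signal space.
--
-- For i < l, gluing A_i to C_(i+1) gives a proper pivot-minor, which has a layout of width
-- at most k.  Recording along it, on the side of A_i, the subspace and the cut-rank, and
-- compressing the resulting sequence in the manner of Bodlaender and Kloks, we obtain one
-- of boundedly many types.  If i < j have equal types, then A_j glued to C_(i+1) has width
-- at most k; restricting A_j to A_(i+1) only decreases the width and leaves a layout of G.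

open import Defs
open import Data.Nat using (ℕ; zero; suc; _≤_; _<_; _<ᵇ_; _≤?_; _<?_; _+_; _*_; _∸_; _^_; z≤n; s≤s; s≤s⁻¹)
open import Data.Nat.Properties hiding (_≟_; suc-injective)
open import Data.Nat.Tactic.RingSolver using (solve-∀)
open import Data.Bool using (Bool; true; false; _∧_; _∨_; _xor_; not; if_then_else_)
open import Data.Bool.Properties using (xor-same; xor-assoc; xor-comm; xor-identityʳ; ∧-comm; ∧-distribˡ-xor; ∧-zeroʳ; ∨-zeroʳ; ∨-identityʳ; ∧-idem; not-involutive; ¬-not)
open import Data.Empty using (⊥)
open import Data.Fin using (Fin; zero; suc; toℕ; fromℕ<; combine; remQuot; _≟_)
open import Data.Fin.Properties using (all?; any?; pigeonhole; toℕ-injective; toℕ-fromℕ<; toℕ<n; fromℕ<-injective; combine-injective; remQuot-combine; suc-injective)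
open import Data.Fin.Permutation using (Permutation′; permutation; _⟨$⟩ˡ_; _⟨$⟩ʳ_; inverseˡ; inverseʳ)
open import Data.Fin.Subset using (Subset; _∈_; _∉_; _⊆_; _⊂_; ∣_∣; Nonempty)
open import Data.Fin.Subset.Properties using (anySubset?; _∈?_; ⊆-antisym; ∣p∣≤n; p⊂q⇒∣p∣<∣q∣)
open import Data.List using (List; []; _∷_; _++_; length; map; allFin)
open import Data.List.Properties using (length-++; length-map; ++-assoc)
open import Data.List.Membership.Propositional using () renaming (_∈_ to _∈ˡ_)
open import Data.List.Membership.Propositional.Properties using (∈-allFin)
open import Data.List.Relation.Unary.All using (All; []; _∷_)
import Data.List.Relation.Unary.All as All
import Data.List.Relation.Unary.All.Properties as All
open import Data.List.Relation.Unary.AllPairs using (AllPairs; []; _∷_)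
import Data.List.Relation.Unary.AllPairs.Properties as AllPairs
open import Data.List.Relation.Unary.Any using (here; there)
open import Data.Product using (Σ; _×_; _,_; ∃; ∃₂; proj₁; proj₂)
open import Data.Sum using (_⊎_; inj₁; inj₂; [_,_]′)
open import Data.Vec using (Vec; []; _∷_; lookup; tabulate; replicate; zipWith)
open import Data.Vec.Properties using (lookup-zipWith; lookup-replicate; lookup∘tabulate; tabulate∘lookup; tabulate-cong; lookup⇒[]=; []=⇒lookup; ≡-dec)
open import Function using (_∘_; Injective; case_of_)
open import Relation.Binary.PropositionalEquality using (_≡_; _≢_; refl; sym; trans; cong; cong₂; subst; module ≡-Reasoning)
open import Relation.Nullary using (¬_; Dec; yes; no; contradiction)
open import Relation.Nullary.Decidable using (_×-dec_; _→-dec_; ¬?; does; decidable-stable; dec-true; ⌊_⌋)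
import Relation.Nullary.Decidable as Dec

-- The width k + 1 comes from deleting one vertex: what remains is a proper pivot-minor, and putting
-- the vertex back raises every cut-rank by at most one. The obstacle is that the types of different
-- A_i must be comparable although the A_i are different vertex sets. Hence the constraints `a` and
-- the basis `q` of the signals are fixed once, for the outermost pair A_0, A_l, and then shown to
-- serve every pair in between; each half thereby leaves its trace in one coordinate space over the
-- binary field. Its dimension is 2w because the two halves of a gluing have cut-rank w each. Only
-- inequalities travel between the minors and G. One and the same expression in the two halves
-- bounds a dimension from above in the minor (i < j) and from below in G (i = j), so that the
-- inequality `Fits` is inherited from the minors, can be exchanged between them, and is finally
-- paid out in G. Spaces K(I, J) with I different from J are unavoidable: a constraint at a vertex
-- restricts only one of x and Mx there.

-- Linear algebra over the binary field

V : ℕ → Set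
V = Vec Bool

infixl 6 _⊕_
_⊕_ : ∀ {n} → V n → V n → V n
_⊕_ = zipWith _xor_

0v : ∀ {n} → V n
0v {n} = replicate n false

infix 9 _!_
_!_ : ∀ {n} → V n → Fin n → Bool
_!_ = lookup

!-⊕ : ∀ {n} (x y : V n) v → (x ⊕ y) ! v ≡ (x ! v) xor (y ! v)
!-⊕ x y v = lookup-zipWith _xor_ v x y

!-0v : ∀ {n} (v : Fin n) → 0v ! v ≡ false
!-0v v = lookup-replicate v false

ext : ∀ {n} {x y : V n} → (∀ v → x ! v ≡ y ! v) → x ≡ y
ext {x = x} {y} h = trans (sym (tabulate∘lookup x)) (trans (tabulate-cong h) (tabulate∘lookup y))

⊕-self : ∀ {n} (x : V n) → x ⊕ x ≡ 0v
⊕-self []      = refl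
⊕-self (b ∷ x) = cong₂ _∷_ (xor-same b) (⊕-self x)

⊕-assoc : ∀ {n} (x y z : V n) → (x ⊕ y) ⊕ z ≡ x ⊕ (y ⊕ z)
⊕-assoc []      []      []      = refl
⊕-assoc (a ∷ x) (b ∷ y) (c ∷ z) = cong₂ _∷_ (xor-assoc a b c) (⊕-assoc x y z)

⊕-comm : ∀ {n} (x y : V n) → x ⊕ y ≡ y ⊕ x
⊕-comm []      []      = refl
⊕-comm (a ∷ x) (b ∷ y) = cong₂ _∷_ (xor-comm a b) (⊕-comm x y)

⊕-0ʳ : ∀ {n} (x : V n) → x ⊕ 0v ≡ x
⊕-0ʳ []      = refl
⊕-0ʳ (b ∷ x) = cong₂ _∷_ (xor-identityʳ b) (⊕-0ʳ x)

⊕-0ˡ : ∀ {n} (x : V n) → 0v ⊕ x ≡ x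
⊕-0ˡ x = trans (⊕-comm 0v x) (⊕-0ʳ x)

⊕-cancel : ∀ {n} (x y : V n) → (x ⊕ y) ⊕ y ≡ x
⊕-cancel x y = trans (⊕-assoc x y y) (trans (cong (x ⊕_) (⊕-self y)) (⊕-0ʳ x))

⊕-interchange : ∀ {n} (a b c d : V n) → (a ⊕ b) ⊕ (c ⊕ d) ≡ (a ⊕ c) ⊕ (b ⊕ d)
⊕-interchange []      []      []      []      = refl
⊕-interchange (a ∷ x) (b ∷ y) (c ∷ z) (d ∷ w) = cong₂ _∷_ (lem a b c d) (⊕-interchange x y z w)
  where
  lem : ∀ a b c d → (a xor b) xor (c xor d) ≡ (a xor c) xor (b xor d)
  lem a b c d = trans (xor-assoc a b _)
    (trans (cong (a xor_) (trans (sym (xor-assoc b c d)) (trans (cong (_xor d) (xor-comm b c)) (xor-assoc c b d))))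
    (sym (xor-assoc a c _)))

-- Decidable membership makes `dim` computable by recursion on the coordinates, and turns questions
-- about the existence of vectors into finite searches.
record Sub (n : ℕ) : Set₁ where
  field
    Mem : V n → Set
    dec : ∀ x → Dec (Mem x)
    0∈  : Mem 0v
    ⊕∈  : ∀ {x y} → Mem x → Mem y → Mem (x ⊕ y)
open Sub

infix 4 _⊑_
_⊑_ : ∀ {n} → Sub n → Sub n → Set
U ⊑ W = ∀ x → Mem U x → Mem W x

bit : ∀ {P : Set} → Dec P → ℕ
bit (yes _) = 1
bit (no  _) = 0

bit-mono : ∀ {P Q : Set} (p : Dec P) (q : Dec Q) → (P → Q) → bit p ≤ bit q
bit-mono (yes p) (yes q) f = ≤-refl
bit-mono (yes p) (no ¬q) f = contradiction (f p) ¬q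
bit-mono (no ¬p) q       f = z≤n

bit-yes : ∀ {P : Set} (d : Dec P) → P → bit d ≡ 1
bit-yes (yes _) p = refl
bit-yes (no ¬p) p = contradiction p ¬p

bit-no : ∀ {P : Set} (d : Dec P) → ¬ P → bit d ≡ 0
bit-no (yes p) ¬p = contradiction p ¬p
bit-no (no _)  ¬p = refl

tail₀ : ∀ {n} → Sub (suc n) → Sub n
tail₀ U .Mem x = Mem U (false ∷ x)
tail₀ U .dec x = dec U (false ∷ x)
tail₀ U .0∈    = 0∈ U
tail₀ U .⊕∈    = ⊕∈ U

lead? : ∀ {n} (U : Sub (suc n)) → Dec (∃ λ x → Mem U (true ∷ x))
lead? U = anySubset? (λ x → dec U (true ∷ x))

-- The number of pivot positions of a reduced basis.
dim : ∀ {n} → Sub n → ℕ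
dim {zero}  U = 0
dim {suc n} U = bit (lead? U) + dim (tail₀ U)

dim-mono : ∀ {n} (U W : Sub n) → U ⊑ W → dim U ≤ dim W
dim-mono {zero}  U W h = z≤n
dim-mono {suc n} U W h =
  +-mono-≤ (bit-mono (lead? U) (lead? W) (λ (x , p) → x , h _ p)) (dim-mono (tail₀ U) (tail₀ W) (λ x → h _))

dim-cong : ∀ {n} (U W : Sub n) → U ⊑ W → W ⊑ U → dim U ≡ dim W
dim-cong U W f g = ≤-antisym (dim-mono U W f) (dim-mono W U g)

dim-zero : ∀ {n} (U : Sub n) → (∀ x → Mem U x → x ≡ 0v) → dim U ≡ 0
dim-zero {zero}  U h = refl
dim-zero {suc n} U h =
  cong₂ _+_ (bit-no (lead? U) (λ (x , p) → case h _ p of λ ())) (dim-zero (tail₀ U) (λ x p → tail≡ (h _ p)))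
  where
  tail≡ : ∀ {b c} {x y : V n} → _≡_ {A = V (suc n)} (b ∷ x) (c ∷ y) → x ≡ y
  tail≡ refl = refl

⊕-cancelʳ-∈ : ∀ {n} (U : Sub n) {x y} → Mem U (x ⊕ y) → Mem U y → Mem U x
⊕-cancelʳ-∈ U {x} {y} p q = subst (Mem U) (⊕-cancel x y) (⊕∈ U p q)

-- By `split`, W' is the union of W and its translate by v. If v has a leading one, either W has a
-- vector w with a leading one and v + w takes the place of v in the tail, or v brings a new pivot
-- and the tails agree.
dim-extend : ∀ {n} (W W' : Sub n) → W ⊑ W' → (v : V n) → Mem W' v → ¬ Mem W v →
             (∀ x → Mem W' x → Mem W x ⊎ Mem W (x ⊕ v)) → dim W' ≡ suc (dim W)
dim-extend {zero}  W W' W⊑ [] v∈ v∉ split = contradiction (0∈ W) v∉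
dim-extend {suc n} W W' W⊑ (false ∷ v) v∈ v∉ split =
  trans (cong₂ _+_ lead≡ (dim-extend (tail₀ W) (tail₀ W') (λ x → W⊑ _) v v∈ v∉ (λ x → split _)))
        (+-suc (bit (lead? W)) _)
  where
  lead≡ : bit (lead? W') ≡ bit (lead? W)
  lead≡ = ≤-antisym
    (bit-mono (lead? W') (lead? W) (λ (x , p) → [ x ,_ , x ⊕ v ,_ ]′ (split _ p)))
    (bit-mono (lead? W) (lead? W') (λ (x , p) → x , W⊑ _ p))
dim-extend {suc n} W W' W⊑ (true ∷ v) v∈ v∉ split with lead? W
... | yes (w , w∈) = trans (cong₂ _+_ lead≡ rec) refl
  where
  v+w∉ : ¬ Mem W (false ∷ (v ⊕ w))
  v+w∉ p = v∉ (⊕-cancelʳ-∈ W {true ∷ v} {true ∷ w} p w∈)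
  split' : ∀ x → Mem W' (false ∷ x) → Mem W (false ∷ x) ⊎ Mem W (false ∷ (x ⊕ (v ⊕ w)))
  split' x p with split _ p
  ... | inj₁ q = inj₁ q
  ... | inj₂ q = inj₂ (subst (λ y → Mem W (false ∷ y)) (⊕-assoc x v w) (⊕∈ W q w∈))
  rec : dim (tail₀ W') ≡ suc (dim (tail₀ W))
  rec = dim-extend (tail₀ W) (tail₀ W') (λ x → W⊑ _) (v ⊕ w) (⊕∈ W' v∈ (W⊑ _ w∈)) v+w∉ split'
  lead≡ : bit (lead? W') ≡ 1
  lead≡ = bit-yes (lead? W') (v , v∈)
... | no ¬w = cong₂ _+_ (bit-yes (lead? W') (v , v∈)) (dim-cong (tail₀ W') (tail₀ W) down (λ x → W⊑ _))
  where
  down : ∀ x → Mem W' (false ∷ x) → Mem W (false ∷ x)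
  down x p with split _ p
  ... | inj₁ q = q
  ... | inj₂ q = contradiction (x ⊕ v , q) ¬w

-- Relations rather than maps: the single count `dim-rel` then gives rank and nullity, the modular
-- law for sums and intersections, and the dimensions of spaces described modulo a subspace.
record LinRel (a b : ℕ) : Set₁ where
  field
    Rel  : V a → V b → Set
    rdec : ∀ x y → Dec (Rel x y)
    0R   : Rel 0v 0v
    ⊕R   : ∀ {x y x' y'} → Rel x y → Rel x' y' → Rel (x ⊕ x') (y ⊕ y')
open LinRel

dom ker : ∀ {a b} → LinRel a b → Sub a
dom R .Mem x = ∃ λ y → Rel R x y
dom R .dec x = anySubset? (rdec R x)
dom R .0∈ = 0v , 0R R
dom R .⊕∈ (y , p) (y' , p') = y ⊕ y' , ⊕R R p p'
ker R .Mem x = Rel R x 0v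
ker R .dec x = rdec R x 0v
ker R .0∈ = 0R R
ker R .⊕∈ p p' = subst (Rel R _) (⊕-self 0v) (⊕R R p p')

ran indet : ∀ {a b} → LinRel a b → Sub b
ran R .Mem y = ∃ λ x → Rel R x y
ran R .dec y = anySubset? (λ x → rdec R x y)
ran R .0∈ = 0v , 0R R
ran R .⊕∈ (x , p) (x' , p') = x ⊕ x' , ⊕R R p p'
indet R .Mem y = Rel R 0v y
indet R .dec y = rdec R 0v y
indet R .0∈ = 0R R
indet R .⊕∈ p p' = subst (λ x → Rel R x _) (⊕-self 0v) (⊕R R p p')

restrict₀ : ∀ {a b} → LinRel (suc a) b → LinRel a b
restrict₀ R .Rel x y  = Rel R (false ∷ x) y
restrict₀ R .rdec x y = rdec R (false ∷ x) y
restrict₀ R .0R = 0R R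
restrict₀ R .⊕R = ⊕R R

-- Both sides compute the dimension of the graph of the relation.
dim-rel : ∀ {a b} (R : LinRel a b) → dim (indet R) + dim (dom R) ≡ dim (ker R) + dim (ran R)
dim-rel {zero} R = trans (+-identityʳ _) (dim-cong (indet R) (ran R) (λ y p → [] , p) λ { y ([] , p) → p })
dim-rel {suc a} {b} R = begin
  dim (indet R) + (l + dim (tail₀ (dom R)))  ≡⟨ cong (λ z → dim (indet R) + (l + z)) (dim-cong (tail₀ (dom R)) (dom R₀) (λ _ p → p) (λ _ p → p)) ⟩
  dim (indet R) + (l + dim (dom R₀))         ≡⟨ lem₁ (dim (indet R)) l _ ⟩
  l + (dim (indet R) + dim (dom R₀))         ≡⟨ cong (l +_) (trans (cong (_+ dim (dom R₀)) (dim-cong (indet R) (indet R₀) (λ _ p → p) (λ _ p → p))) (dim-rel R₀)) ⟩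
  l + (dim (ker R₀) + dim (ran R₀))          ≡⟨ lem₁ l (dim (ker R₀)) _ ⟩
  dim (ker R₀) + (l + dim (ran R₀))          ≡⟨ cong₂ _+_ (dim-cong (ker R₀) (tail₀ (ker R)) (λ _ p → p) (λ _ p → p)) key ⟩
  dim (tail₀ (ker R)) + (k + dim (ran R))    ≡⟨ lem₂ _ k _ ⟩
  (k + dim (tail₀ (ker R))) + dim (ran R)    ∎
  where
  open ≡-Reasoning
  R₀ = restrict₀ R
  l = bit (lead? (dom R))
  k = bit (lead? (ker R))
  lem₁ : ∀ i j m → i + (j + m) ≡ j + (i + m)
  lem₁ = solve-∀
  lem₂ : ∀ i j m → i + (j + m) ≡ (j + i) + m
  lem₂ = solve-∀
  up : ran R₀ ⊑ ran R
  up y (x , p) = false ∷ x , p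
  -- A vector of the domain with a leading one either may be chosen in the kernel, and then adds
  -- nothing to the range, or it enlarges the range by one dimension.
  key : l + dim (ran R₀) ≡ k + dim (ran R)
  key with lead? (dom R) | lead? (ker R)
  ... | no ¬l | yes (x , p) = contradiction (x , 0v , p) ¬l
  ... | no ¬l | no ¬k = dim-cong (ran R₀) (ran R) up λ where
    y (false ∷ x , p) → x , p
    y (true  ∷ x , p) → contradiction (x , y , p) ¬l
  ... | yes _ | yes (z , q) = cong suc (dim-cong (ran R₀) (ran R) up λ where
    y (false ∷ x , p) → x , p
    y (true  ∷ x , p) → x ⊕ z , subst (Rel R _) (⊕-0ʳ y) (⊕R R p q))
  ... | yes (x , y , p) | no ¬k = sym (dim-extend (ran R₀) (ran R) up y (true ∷ x , p) y∉ λ where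
      y' (false ∷ x' , p') → inj₁ (x' , p')
      y' (true  ∷ x' , p') → inj₂ (x' ⊕ x , ⊕R R p' p))
    where
    y∉ : ¬ Mem (ran R₀) y
    y∉ (x' , p') = ¬k (x ⊕ x' , subst (Rel R _) (⊕-self y) (⊕R R p p'))

dim-rel-≤ : ∀ {a b} (R : LinRel a b) → (∀ x → Rel R x 0v → x ≡ 0v) → (W : Sub b) → ran R ⊑ W → dim (dom R) ≤ dim W
dim-rel-≤ R h W r = begin
  dim (dom R)                  ≤⟨ m≤n+m _ _ ⟩
  dim (indet R) + dim (dom R)  ≡⟨ dim-rel R ⟩
  dim (ker R) + dim (ran R)    ≡⟨ cong (_+ dim (ran R)) (dim-zero (ker R) h) ⟩
  dim (ran R)                  ≤⟨ dim-mono (ran R) W r ⟩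
  dim W                        ∎
  where open ≤-Reasoning

infixr 7 _⊓_
infixr 6 _⊔_
_⊓_ _⊔_ : ∀ {n} → Sub n → Sub n → Sub n
(U ⊓ W) .Mem x = Mem U x × Mem W x
(U ⊓ W) .dec x = dec U x ×-dec dec W x
(U ⊓ W) .0∈ = 0∈ U , 0∈ W
(U ⊓ W) .⊕∈ (p , q) (p' , q') = ⊕∈ U p p' , ⊕∈ W q q'
(U ⊔ W) .Mem x = ∃ λ y → Mem U y × Mem W (x ⊕ y)
(U ⊔ W) .dec x = anySubset? (λ y → dec U y ×-dec dec W (x ⊕ y))
(U ⊔ W) .0∈ = 0v , 0∈ U , subst (Mem W) (sym (⊕-self 0v)) (0∈ W)
(U ⊔ W) .⊕∈ {x} {x'} (y , p , q) (y' , p' , q') =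
  y ⊕ y' , ⊕∈ U p p' , subst (Mem W) (⊕-interchange x y x' y') (⊕∈ W q q')

-- This is `dim-rel` for the relation y ∈ U, x + y ∈ W: its indeterminacy is the intersection, its
-- domain the sum, its kernel W and its range U.
dim-⊔⊓ : ∀ {n} (U W : Sub n) → dim (U ⊓ W) + dim (U ⊔ W) ≡ dim W + dim U
dim-⊔⊓ {n} U W = begin
  dim (U ⊓ W) + dim (U ⊔ W)    ≡⟨ cong (_+ dim (U ⊔ W)) (dim-cong (U ⊓ W) (indet R) (λ x (p , q) → p , subst (Mem W) (sym (⊕-0ˡ x)) q) (λ x (p , q) → p , subst (Mem W) (⊕-0ˡ x) q)) ⟩
  dim (indet R) + dim (dom R)  ≡⟨ dim-rel R ⟩
  dim (ker R) + dim (ran R)    ≡⟨ cong₂ _+_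
      (dim-cong (ker R) W (λ x (p , q) → subst (Mem W) (⊕-0ʳ x) q) (λ x q → 0∈ U , subst (Mem W) (sym (⊕-0ʳ x)) q))
      (dim-cong (ran R) U (λ y (x , p , q) → p) (λ y p → y , p , subst (Mem W) (sym (⊕-self y)) (0∈ W))) ⟩
  dim W + dim U                ∎
  where
  open ≡-Reasoning
  R : LinRel n n
  R .Rel x y = Mem U y × Mem W (x ⊕ y)
  R .rdec x y = dec U y ×-dec dec W (x ⊕ y)
  R .0R = 0∈ U , subst (Mem W) (sym (⊕-self 0v)) (0∈ W)
  R .⊕R {x} {y} {x'} {y'} (p , q) (p' , q') = ⊕∈ U p p' , subst (Mem W) (⊕-interchange x y x' y') (⊕∈ W q q')

-- Turns the dimension counts below into inclusions of spaces. A vector w of W outside U would give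
-- the space spanned by U and w, one dimension larger and still inside W.
dim-⊑-≡ : ∀ {n} (U W : Sub n) → U ⊑ W → dim W ≤ dim U → W ⊑ U
dim-⊑-≡ {n} U W h le w w∈ with dec U w
... | yes p = p
... | no ¬p = contradiction (≤-trans (≤-reflexive (sym (dim-extend U U' up w w∈U' ¬p λ x → [ inj₁ , inj₂ ]′))) (≤-trans (dim-mono U' W down) le)) (<-irrefl refl)
  where
  U' : Sub n
  U' .Mem x = Mem U x ⊎ Mem U (x ⊕ w)
  U' .dec x = dec U x Dec.⊎-dec dec U (x ⊕ w)
  U' .0∈ = inj₁ (0∈ U)
  U' .⊕∈ (inj₁ p) (inj₁ q) = inj₁ (⊕∈ U p q)
  U' .⊕∈ {x} {y} (inj₁ p) (inj₂ q) = inj₂ (subst (Mem U) (sym (⊕-assoc x y w)) (⊕∈ U p q))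
  U' .⊕∈ {x} {y} (inj₂ p) (inj₁ q) = inj₂ (subst (Mem U)
    (trans (⊕-assoc x w y) (trans (cong (x ⊕_) (⊕-comm w y)) (sym (⊕-assoc x y w)))) (⊕∈ U p q))
  U' .⊕∈ {x} {y} (inj₂ p) (inj₂ q) = inj₁ (subst (Mem U)
    (trans (⊕-interchange x w y w) (trans (cong ((x ⊕ y) ⊕_) (⊕-self w)) (⊕-0ʳ _))) (⊕∈ U p q))
  up : U ⊑ U'
  up x = inj₁
  w∈U' : Mem U' w
  w∈U' = inj₂ (subst (Mem U) (sym (⊕-self w)) (0∈ U))
  down : U' ⊑ W
  down x (inj₁ p) = h _ p
  down x (inj₂ p) = subst (Mem W) (⊕-cancel x w) (⊕∈ W (h _ p) w∈)

record Lin (a b : ℕ) : Set where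
  field
    app : V a → V b
    lin : ∀ x y → app (x ⊕ y) ≡ app x ⊕ app y
open Lin

lin-0 : ∀ {a b} (f : Lin a b) → app f 0v ≡ 0v
lin-0 f = trans (cong (app f) (sym (⊕-self 0v))) (trans (lin f 0v 0v) (⊕-self _))

whole : ∀ n → Sub n
whole n .Mem _ = 0 ≡ 0
whole n .dec _ = yes refl
whole n .0∈ = refl
whole n .⊕∈ _ _ = refl

dim-whole : ∀ n → dim (whole n) ≡ n
dim-whole zero    = refl
dim-whole (suc n) = cong₂ _+_ (bit-yes (lead? (whole (suc n))) (0v , refl))
  (trans (dim-cong (tail₀ (whole (suc n))) (whole n) (λ _ p → p) (λ _ p → p)) (dim-whole n))

dim≤n : ∀ {n} (U : Sub n) → dim U ≤ n
dim≤n {n} U = ≤-trans (dim-mono U (whole n) (λ _ _ → refl)) (≤-reflexive (dim-whole n))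

_⁻¹[_] : ∀ {a b} → Lin a b → Sub b → Sub a
(f ⁻¹[ U ]) .Mem x = Mem U (app f x)
(f ⁻¹[ U ]) .dec x = dec U (app f x)
(f ⁻¹[ U ]) .0∈ = subst (Mem U) (sym (lin-0 f)) (0∈ U)
(f ⁻¹[ U ]) .⊕∈ {x} {y} p q = subst (Mem U) (sym (lin f x y)) (⊕∈ U p q)

zeroSub : ∀ n → Sub n
zeroSub n .Mem x = x ≡ 0v
zeroSub n .dec x = ≡-dec Data.Bool._≟_ x 0v
zeroSub n .0∈ = refl
zeroSub n .⊕∈ refl refl = ⊕-self 0v

graph : ∀ {a b} → Lin a b → Sub a → LinRel a b
graph f U .Rel x y = Mem U x × app f x ≡ y
graph f U .rdec x y = dec U x ×-dec ≡-dec Data.Bool._≟_ _ _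
graph f U .0R = 0∈ U , lin-0 f
graph f U .⊕R {x} {_} {x'} (p , refl) (p' , refl) = ⊕∈ U p p' , lin f x x'

dim-map-≤ : ∀ {a b} (U : Sub a) (f : Lin a b) (W : Sub b) → (∀ x → Mem U x → Mem W (app f x)) →
            (∀ x → Mem U x → app f x ≡ 0v → x ≡ 0v) → dim U ≤ dim W
dim-map-≤ {a} {b} U f W fW inj = ≤-trans
  (dim-mono U (dom R) (λ x p → app f x , p , refl))
  (dim-rel-≤ R (λ x (p , q) → inj x p q) W λ { y (x , p , refl) → fW x p })
  where
  R = graph f U

dim-codim : ∀ {a b} (U : Sub a) (f : Lin a b) (W : Sub b) → (∀ x → Mem W (app f x)) →
            dim U ≤ dim (U ⊓ (f ⁻¹[ zeroSub b ])) + dim W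
dim-codim {a} {b} U f W fW = begin
  dim U                        ≤⟨ dim-mono U (dom R) (λ x p → app f x , p , refl) ⟩
  dim (dom R)                  ≤⟨ m≤n+m _ _ ⟩
  dim (indet R) + dim (dom R)  ≡⟨ dim-rel R ⟩
  dim (ker R) + dim (ran R)    ≤⟨ +-mono-≤ (dim-mono (ker R) _ (λ x p → p)) (dim-mono (ran R) W λ { y (x , p , refl) → fW x }) ⟩
  dim (U ⊓ (f ⁻¹[ zeroSub b ])) + dim W ∎
  where
  open ≤-Reasoning
  R = graph f U

scale : ∀ {n} → Bool → V n → V n
scale false v = 0v
scale true  v = v

scale-xor : ∀ {n} b c (v : V n) → scale (b xor c) v ≡ scale b v ⊕ scale c v
scale-xor false c     v = sym (⊕-0ˡ _)
scale-xor true  false v = sym (⊕-0ʳ _)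
scale-xor true  true  v = sym (⊕-self v)

-- The map encodes d vectors of W that are independent modulo U. Some v in W lies outside U by
-- dimension; the remaining d - 1 vectors are found modulo the span of U and v, which is the range
-- of R.
complement : ∀ {n} d (U W : Sub n) → U ⊑ W → dim U + d ≤ dim W →
             Σ (Lin d n) λ q → (∀ c → Mem W (app q c)) × (∀ c → Mem U (app q c) → c ≡ 0v)
complement zero U W U⊑W le = record { app = λ _ → 0v ; lin = λ _ _ → sym (⊕-self 0v) } , (λ _ → 0∈ W) , λ { [] _ → refl }
complement {n} (suc d) U W U⊑W le with anySubset? (λ v → dec W v ×-dec ¬? (dec U v))
... | no ¬v = contradiction (≤-trans le (dim-mono W U λ x p → decidable-stable (dec U x) (λ q → ¬v (x , p , q))))
                (m+1+n≰m (dim U))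
... | yes (v , v∈W , v∉U) with complement d U' W U'⊑W le'
  where
  R : LinRel 1 n
  R .Rel b x = Mem U (x ⊕ scale (b ! zero) v)
  R .rdec b x = dec U _
  R .0R = subst (Mem U) (sym (⊕-self 0v)) (0∈ U)
  R .⊕R {b ∷ []} {x} {b' ∷ []} {x'} p p' = subst (Mem U)
    (trans (⊕-interchange x _ x' _) (cong ((x ⊕ x') ⊕_) (sym (scale-xor b b' v)))) (⊕∈ U p p')
  U' = ran R
  U'⊑W : U' ⊑ W
  U'⊑W x ((false ∷ []) , p) = U⊑W x (subst (Mem U) (⊕-0ʳ x) p)
  U'⊑W x ((true ∷ []) , p) = ⊕-cancelʳ-∈ W (U⊑W _ p) v∈W
  le' : dim U' + d ≤ dim W
  le' = begin
    dim U' + d                          ≤⟨ +-monoˡ-≤ d (m≤n+m _ (dim (ker R))) ⟩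
    (dim (ker R) + dim (ran R)) + d     ≡⟨ cong (_+ d) (sym (dim-rel R)) ⟩
    (dim (indet R) + dim (dom R)) + d   ≤⟨ +-monoˡ-≤ d (+-mono-≤ (dim-mono (indet R) U (λ x p → subst (Mem U) (⊕-0ʳ x) p)) (dim≤n (dom R))) ⟩
    (dim U + 1) + d                     ≡⟨ +-assoc (dim U) 1 d ⟩
    dim U + suc d                       ≤⟨ le ⟩
    dim W                               ∎
    where open ≤-Reasoning
... | q , q∈W , q-indep = q' , q'∈W , q'-indep
  where
  q' : Lin (suc d) n
  q' .app (b ∷ c) = app q c ⊕ scale b v
  q' .lin (b ∷ c) (b' ∷ c') = trans (cong₂ _⊕_ (lin q c c') (scale-xor b b' v)) (⊕-interchange _ _ _ _)
  q'∈W : ∀ c → Mem W (app q' c)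
  q'∈W (false ∷ c) = ⊕∈ W (q∈W c) (0∈ W)
  q'∈W (true  ∷ c) = ⊕∈ W (q∈W c) v∈W
  q'-indep : ∀ c → Mem U (app q' c) → c ≡ 0v
  q'-indep (b ∷ c) p with q-indep c ((b ∷ []) , p)
  q'-indep (false ∷ c) p | refl = refl
  q'-indep (true  ∷ c) p | refl = contradiction (subst (Mem U) (trans (cong (_⊕ v) (lin-0 q)) (⊕-0ˡ v)) p) v∉U

-- Boolean vertex sets: truth tables, counting, sums modulo two

infixr 3 _⇒_
_⇒_ : Bool → Bool → Bool
a ⇒ b = not a ∨ b

mp : ∀ {a b} → (a ⇒ b) ≡ true → a ≡ true → b ≡ true
mp {true} h refl = h

mt : ∀ {a b} → (a ⇒ b) ≡ true → b ≡ false → a ≡ false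
mt {true}  h e = trans (sym h) e
mt {false} h e = refl

imp : ∀ {a b} → (a ≡ true → b ≡ true) → (a ⇒ b) ≡ true
imp {true}  f = f refl
imp {false} f = refl

-- Truth tables by reflection: the pointwise set algebra below is checked by evaluating
-- `everywhere`, so that `refl` is its proof.
Boolean : ℕ → Set → Set
Boolean zero    A = A
Boolean (suc n) A = Bool → Boolean n A

everywhere : ∀ n → Boolean n Bool → Bool
everywhere zero    b = b
everywhere (suc n) f = everywhere n (f true) ∧ everywhere n (f false)

Valid : ∀ n → Boolean n Bool → Set
Valid zero    b = b ≡ true
Valid (suc n) f = ∀ b → Valid n (f b)

∧-true : ∀ {a b} → a ∧ b ≡ true → a ≡ true × b ≡ true
∧-true {true} h = refl , h

taut : ∀ n (f : Boolean n Bool) → everywhere n f ≡ true → Valid n f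
taut zero    b h       = h
taut (suc n) f h true  = taut n (f true) (proj₁ (∧-true h))
taut (suc n) f h false = taut n (f false) (proj₂ (∧-true {everywhere n (f true)} h))

infix 4 _≼_ _≗ᵇ_
_≼_ _≗ᵇ_ : ∀ {n} → (Fin n → Bool) → (Fin n → Bool) → Set
f ≼ g = ∀ v → (f v ⇒ g v) ≡ true
f ≗ᵇ g = ∀ v → f v ≡ g v

≼-trans : ∀ {n} {f g h : Fin n → Bool} → f ≼ g → g ≼ h → f ≼ h
≼-trans {f = f} {g} {h} p q v = imp {f v} {h v} (λ e → mp {g v} (q v) (mp {f v} (p v) e))

≼-refl : ∀ {n} {f : Fin n → Bool} → f ≼ f
≼-refl {f = f} v = imp {f v} (λ e → e)

≗⇒≼ : ∀ {n} {f g : Fin n → Bool} → f ≗ᵇ g → f ≼ g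
≗⇒≼ p v = imp (trans (sym (p v)))

b2n : Bool → ℕ
b2n true  = 1
b2n false = 0

# : ∀ {n} → (Fin n → Bool) → ℕ
# {zero}  f = 0
# {suc n} f = b2n (f zero) + # (f ∘ suc)

#-mono : ∀ {n} {f g : Fin n → Bool} → f ≼ g → # f ≤ # g
#-mono {zero}  h = z≤n
#-mono {suc n} {f} {g} h = +-mono-≤ (lem (f zero) (g zero) (h zero)) (#-mono (λ v → h (suc v)))
  where
  lem : ∀ a b → (a ⇒ b) ≡ true → b2n a ≤ b2n b
  lem true  true  _ = ≤-refl
  lem false b     _ = z≤n

#-cong : ∀ {n} {f g : Fin n → Bool} → f ≗ᵇ g → # f ≡ # g
#-cong h = ≤-antisym (#-mono (≗⇒≼ h)) (#-mono (≗⇒≼ (λ v → sym (h v))))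

#-balance : ∀ {n} {f g h k : Fin n → Bool} → (∀ v → b2n (f v) + b2n (g v) ≡ b2n (h v) + b2n (k v)) → # f + # g ≡ # h + # k
#-balance {zero}  e = refl
#-balance {suc n} {f} {g} {h} {k} e = begin
  (b2n (f zero) + # (f ∘ suc)) + (b2n (g zero) + # (g ∘ suc))  ≡⟨ lem (b2n (f zero)) _ _ _ ⟩
  (b2n (f zero) + b2n (g zero)) + (# (f ∘ suc) + # (g ∘ suc))  ≡⟨ cong₂ _+_ (e zero) (#-balance (e ∘ suc)) ⟩
  (b2n (h zero) + b2n (k zero)) + (# (h ∘ suc) + # (k ∘ suc))  ≡⟨ lem (b2n (h zero)) _ _ _ ⟩
  (b2n (h zero) + # (h ∘ suc)) + (b2n (k zero) + # (k ∘ suc))  ∎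
  where
  open ≡-Reasoning
  lem : ∀ a b c d → (a + b) + (c + d) ≡ (a + c) + (b + d)
  lem = solve-∀

#-none : ∀ {n} → # {n} (λ _ → false) ≡ 0
#-none {zero}  = refl
#-none {suc n} = #-none {n}

#-all : ∀ {n} → # {n} (λ _ → true) ≡ n
#-all {zero}  = refl
#-all {suc n} = cong suc #-all

#-⊎ : ∀ {n} {f g h : Fin n → Bool} → (∀ v → b2n (f v) + b2n (g v) ≡ b2n (h v)) → # f + # g ≡ # h
#-⊎ {n} {f} {g} {h} e = trans
  (#-balance {h = h} {k = λ _ → false} (λ v → trans (e v) (sym (+-identityʳ _))))
  (trans (cong (# h +_) (#-none {n})) (+-identityʳ _))

is : ∀ {n} → Fin n → Fin n → Bool
is u v = ⌊ v ≟ u ⌋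

is-refl : ∀ {n} (u : Fin n) → is u u ≡ true
is-refl u with u ≟ u
... | yes _ = refl
... | no ¬e = contradiction refl ¬e

is-≢ : ∀ {n} {u v : Fin n} → v ≢ u → is u v ≡ false
is-≢ {u = u} {v} ne with v ≟ u
... | yes e = contradiction e ne
... | no _  = refl

is-suc : ∀ {n} (u v : Fin n) → is (suc u) (suc v) ≡ is u v
is-suc u v with v ≟ u
... | yes _ = refl
... | no _  = refl

#-is : ∀ {n} (u : Fin n) → # (is u) ≡ 1
#-is {suc n} zero    = cong suc (#-none {n})
#-is {suc n} (suc u) = trans (#-cong {n} (is-suc u)) (#-is u)

∣∣≡# : ∀ {n} (S : Subset n) → ∣ S ∣ ≡ # (S !_)
∣∣≡# []          = refl
∣∣≡# (true  ∷ S) = cong suc (∣∣≡# S)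
∣∣≡# (false ∷ S) = ∣∣≡# S

⊕-sum-cong : ∀ {n} {f g : Fin n → Bool} → f ≗ᵇ g → ⊕-sum f ≡ ⊕-sum g
⊕-sum-cong {zero}  h = refl
⊕-sum-cong {suc n} h = cong₂ _xor_ (h zero) (⊕-sum-cong (h ∘ suc))

⊕-sum-0 : ∀ {n} → ⊕-sum {n} (λ _ → false) ≡ false
⊕-sum-0 {zero}  = refl
⊕-sum-0 {suc n} = ⊕-sum-0 {n}

⊕-sum-xor : ∀ {n} (f g : Fin n → Bool) → ⊕-sum (λ v → f v xor g v) ≡ ⊕-sum f xor ⊕-sum g
⊕-sum-xor {zero}  f g = refl
⊕-sum-xor {suc n} f g = trans (cong ((f zero xor g zero) xor_) (⊕-sum-xor (f ∘ suc) (g ∘ suc)))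
  (lem (f zero) (g zero) _ _)
  where
  lem : ∀ a b c d → (a xor b) xor (c xor d) ≡ (a xor c) xor (b xor d)
  lem a b c d = cong (lookup′) (⊕-interchange (a ∷ []) (b ∷ []) (c ∷ []) (d ∷ []))
    where
    lookup′ : V 1 → Bool
    lookup′ x = x ! zero

⊕-sum-∧ : ∀ {n} c (f : Fin n → Bool) → ⊕-sum (λ v → c ∧ f v) ≡ c ∧ ⊕-sum f
⊕-sum-∧ true  f = refl
⊕-sum-∧ {n} false f = ⊕-sum-0 {n}

⊕-sum-swap : ∀ {m n} (f : Fin m → Fin n → Bool) → ⊕-sum (λ u → ⊕-sum (f u)) ≡ ⊕-sum (λ v → ⊕-sum (λ u → f u v))
⊕-sum-swap {zero}  {n} f = sym (⊕-sum-0 {n})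
⊕-sum-swap {suc m} f = trans (cong (⊕-sum (f zero) xor_) (⊕-sum-swap (f ∘ suc)))
  (sym (⊕-sum-xor (f zero) (λ v → ⊕-sum (λ u → f (suc u) v))))

⊕-sum-is : ∀ {n} (u : Fin n) (f : Fin n → Bool) → ⊕-sum (λ v → is u v ∧ f v) ≡ f u
⊕-sum-is {suc n} zero    f = trans (cong (f zero xor_) (⊕-sum-0 {n})) (xor-identityʳ _)
⊕-sum-is {suc n} (suc u) f = trans (⊕-sum-cong {n} (λ v → cong (_∧ f (suc v)) (is-suc u v))) (⊕-sum-is u (f ∘ suc))

rowComb-⊕ : ∀ {n} (G : Adj n) (x y : V n) v → rowComb G (x ⊕ y) v ≡ rowComb G x v xor rowComb G y v
rowComb-⊕ G x y v = trans
  (⊕-sum-cong (λ a → trans (cong (_∧ G a v) (!-⊕ x y a)) (trans (∧-comm _ (G a v))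
    (trans (∧-distribˡ-xor (G a v) (x ! a) (y ! a)) (cong₂ _xor_ (∧-comm (G a v) _) (∧-comm (G a v) _))))))
  (⊕-sum-xor (λ a → x ! a ∧ G a v) (λ a → y ! a ∧ G a v))

rowComb-0 : ∀ {n} (G : Adj n) v → rowComb G 0v v ≡ false
rowComb-0 {n} G v = trans (⊕-sum-cong (λ a → cong (_∧ G a v) (!-0v a))) (⊕-sum-0 {n})

-- Coordinate subspaces, duality and cut-rank

pow : ∀ {n} → (Fin n → Bool) → Sub n
pow f .Mem x = ∀ v → f v ≡ false → x ! v ≡ false
pow f .dec x = all? (λ v → (f v Data.Bool.≟ false) →-dec (x ! v Data.Bool.≟ false))
pow f .0∈ v _ = !-0v v
pow f .⊕∈ {x} {y} p q v e = trans (!-⊕ x y v) (cong₂ _xor_ (p v e) (q v e))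

dim-pow : ∀ {n} (f : Fin n → Bool) → dim (pow f) ≡ # f
dim-pow {zero}  f = refl
dim-pow {suc n} f = cong₂ _+_ (lead≡ (f zero) refl) (trans (dim-cong (tail₀ (pow f)) (pow (f ∘ suc)) (λ x p v → p (suc v))
    (λ { x p zero _ → refl ; x p (suc v) → p v })) (dim-pow (f ∘ suc)))
  where
  lead≡ : ∀ b → f zero ≡ b → bit (lead? (pow f)) ≡ b2n b
  lead≡ true  e = bit-yes (lead? (pow f)) (0v , λ { zero q → contradiction (trans (sym e) q) λ () ; (suc v) _ → !-0v v })
  lead≡ false e = bit-no (lead? (pow f)) (λ (x , p) → contradiction (p zero e) λ ())

-- K G I J consists of the vectors x with supp x ⊆ I and supp (Mx) ⊆ J for the
-- adjacency matrix M, so that the cut-rank of X is |X| - dim (K G X X).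
K : ∀ {n} → Adj n → (I J : Fin n → Bool) → Sub n
K G I J .Mem x = ∀ v → (I v ≡ false → x ! v ≡ false) × (J v ≡ false → rowComb G x v ≡ false)
K G I J .dec x = all? (λ v → ((I v Data.Bool.≟ false) →-dec (x ! v Data.Bool.≟ false))
                       ×-dec ((J v Data.Bool.≟ false) →-dec (rowComb G x v Data.Bool.≟ false)))
K G I J .0∈ v = (λ _ → !-0v v) , (λ _ → rowComb-0 G v)
K G I J .⊕∈ {x} {y} p q v =
  (λ e → trans (!-⊕ x y v) (cong₂ _xor_ (proj₁ (p v) e) (proj₁ (q v) e))) ,
  (λ e → trans (rowComb-⊕ G x y v) (cong₂ _xor_ (proj₂ (p v) e) (proj₂ (q v) e)))

K-mono : ∀ {n} (G : Adj n) {I J I' J'} → I ≼ I' → J ≼ J' → K G I J ⊑ K G I' J'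
K-mono G p q x m v = (λ e → proj₁ (m v) (mt (p v) e)) , (λ e → proj₂ (m v) (mt (q v) e))

K-∩ : ∀ {n} (G : Adj n) {I J I' J'} {x} → Mem (K G I J) x → Mem (K G I' J') x →
      Mem (K G (λ v → I v ∧ I' v) (λ v → J v ∧ J' v)) x
K-∩ G {I} {J} {I'} {J'} p q v =
  (λ e → both (I v) (proj₁ (p v)) (proj₁ (q v)) e) , (λ e → both (J v) (proj₂ (p v)) (proj₂ (q v)) e)
  where
  both : ∀ a {b} {P : Set} → (a ≡ false → P) → (b ≡ false → P) → a ∧ b ≡ false → P
  both true  f g e = g e
  both false f g e = f refl

⟨_,_⟩ : ∀ {n} → V n → V n → Bool
⟨ x , y ⟩ = ⊕-sum (λ v → x ! v ∧ y ! v)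

-- Induction on the coordinates: U is projected along the first one, while W is cut down to the
-- vectors vanishing there. The first coordinate is charged only once, for if the first unit vector
-- lies in U, then no vector of W has a leading one.
dim-orth : ∀ {n} (J : Fin n → Bool) (U W : Sub n) → U ⊑ pow J → W ⊑ pow J →
           (∀ x y → Mem U x → Mem W y → ⟨ x , y ⟩ ≡ false) → dim U + dim W ≤ # J
dim-orth {zero}  J U W UJ WJ orth = z≤n
dim-orth {suc n} J U W UJ WJ orth = finish
  where
  open ≤-Reasoning
  R : LinRel 1 n
  R .Rel b x = Mem U (b ! zero ∷ x)
  R .rdec b x = dec U _
  R .0R = 0∈ U
  R .⊕R {_ ∷ _} {_} {_ ∷ _} = ⊕∈ U
  IH : dim (ran R) + dim (tail₀ W) ≤ # (J ∘ suc)
  IH = dim-orth (J ∘ suc) (ran R) (tail₀ W)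
    (λ y (b , p) v e → UJ _ p (suc v) e) (λ y p v e → WJ _ p (suc v) e)
    (λ { x y ((b ∷ []) , p) q → trans (sym (cong (_xor ⟨ x , y ⟩) (∧-zeroʳ b))) (orth _ _ p q) })
  dimU : dim U ≤ dim (ker R) + dim (ran R)
  dimU = begin
    bit (lead? U) + dim (tail₀ U)  ≡⟨ +-comm (bit (lead? U)) _ ⟩
    dim (tail₀ U) + bit (lead? U)  ≤⟨ +-mono-≤ (dim-mono (tail₀ U) (indet R) (λ _ p → p))
        (≤-trans (bit-mono (lead? U) (lead? (dom R)) (λ (x , p) → [] , x , p)) (m≤m+n _ _)) ⟩
    dim (indet R) + dim (dom R)    ≡⟨ dim-rel R ⟩
    dim (ker R) + dim (ran R)      ∎
  regroup : ∀ a b c d → (a + b) + (c + d) ≡ (a + c) + (b + d)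
  regroup = solve-∀
  count : dim (ker R) + bit (lead? W) ≤ b2n (J zero) → dim U + dim W ≤ # J
  count h = begin
    dim U + dim W                                                  ≤⟨ +-monoˡ-≤ (dim W) dimU ⟩
    (dim (ker R) + dim (ran R)) + (bit (lead? W) + dim (tail₀ W))  ≡⟨ regroup (dim (ker R)) _ _ _ ⟩
    (dim (ker R) + bit (lead? W)) + (dim (ran R) + dim (tail₀ W))  ≤⟨ +-mono-≤ h IH ⟩
    # J                                                            ∎
  ⟨e₀⟩ : ∀ (y : V n) → ⟨ true ∷ 0v , true ∷ y ⟩ ≡ true
  ⟨e₀⟩ y = cong (true xor_) (trans (⊕-sum-cong (λ v → cong (_∧ y ! v) (!-0v v))) (⊕-sum-0 {n}))
  lead⇒J : ∀ (T : Sub (suc n)) → T ⊑ pow J → ∀ x → Mem T (true ∷ x) → J zero ≡ true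
  lead⇒J T TJ x p with J zero in e
  ... | true  = refl
  ... | false = contradiction (TJ _ p zero e) λ ()
  finish : dim U + dim W ≤ # J
  finish with dec U (true ∷ 0v)
  ... | yes p = count (≤-trans (+-mono-≤ (dim≤n (ker R)) (≤-reflexive (bit-no (lead? W) λ (y , q) →
                  contradiction (trans (sym (⟨e₀⟩ y)) (orth _ _ p q)) λ ())))
                  (≤-reflexive (cong b2n (sym (lead⇒J U UJ _ p)))))
  ... | no ¬p = count (≤-trans (+-monoˡ-≤ _ (≤-reflexive (dim-zero (ker R) λ
                  { (false ∷ []) _ → refl ; (true ∷ []) q → contradiction q ¬p }))) leadW)
    where
    leadW : bit (lead? W) ≤ b2n (J zero)
    leadW with lead? W
    ... | no _ = z≤n
    ... | yes (y , q) = ≤-reflexive (cong b2n (sym (lead⇒J W WJ y q)))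

⟨⟩-rowComb : ∀ {n} (G : Adj n) → (∀ u v → G u v ≡ G v u) → (x y : V n) →
             ⊕-sum (λ v → rowComb G x v ∧ y ! v) ≡ ⊕-sum (λ v → x ! v ∧ rowComb G y v)
⟨⟩-rowComb G G-sym x y = begin
  ⊕-sum (λ v → rowComb G x v ∧ y ! v)               ≡⟨ ⊕-sum-cong (λ v → trans (∧-comm (rowComb G x v) (y ! v)) (sym (⊕-sum-∧ (y ! v) (λ u → x ! u ∧ G u v)))) ⟩
  ⊕-sum (λ v → ⊕-sum (λ u → y ! v ∧ x ! u ∧ G u v))  ≡⟨ ⊕-sum-swap (λ v u → y ! v ∧ x ! u ∧ G u v) ⟩
  ⊕-sum (λ u → ⊕-sum (λ v → y ! v ∧ x ! u ∧ G u v))  ≡⟨ ⊕-sum-cong (λ u → trans (⊕-sum-cong (λ v → trans (lem (y ! v) (x ! u) _) (cong (λ z → x ! u ∧ y ! v ∧ z) (G-sym u v)))) (⊕-sum-∧ (x ! u) (λ v → y ! v ∧ G v u))) ⟩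
  ⊕-sum (λ u → x ! u ∧ rowComb G y u)               ∎
  where
  open ≡-Reasoning
  lem : ∀ a b c → a ∧ b ∧ c ≡ b ∧ a ∧ c
  lem true  b     c = refl
  lem false true  c = refl
  lem false false c = refl

∁ : ∀ {n} → (Fin n → Bool) → Fin n → Bool
∁ f v = not (f v)

-- Send x supported in I to the part of Mx outside J. The kernel is K(I, J), and by the symmetry of
-- M the image is orthogonal to K(∁ J, ∁ I); now `dim-orth` applies in the coordinates outside J.
duality-≤ : ∀ {n} (G : Adj n) → (∀ u v → G u v ≡ G v u) → (I J : Fin n → Bool) →
            # I + dim (K G (∁ J) (∁ I)) ≤ dim (K G I J) + # (∁ J)
duality-≤ {n} G G-sym I J = begin
  # I + dim W                          ≡⟨ cong (_+ dim W) (sym (dim-pow I)) ⟩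
  dim (pow I) + dim W                  ≤⟨ +-monoˡ-≤ (dim W) (dim-mono (pow I) (dom R) (λ x p → image x , p , refl)) ⟩
  dim (dom R) + dim W                  ≤⟨ +-monoˡ-≤ (dim W) (m≤n+m _ (dim (indet R))) ⟩
  dim (indet R) + dim (dom R) + dim W  ≡⟨ cong (_+ dim W) (dim-rel R) ⟩
  dim (ker R) + dim (ran R) + dim W    ≡⟨ +-assoc (dim (ker R)) _ _ ⟩
  dim (ker R) + (dim (ran R) + dim W)  ≤⟨ +-mono-≤ (dim-mono (ker R) (K G I J) ker⊑) (dim-orth (∁ J) (ran R) W ran⊑ W⊑ orth) ⟩
  dim (K G I J) + # (∁ J)              ∎
  where
  open ≤-Reasoning
  W = K G (∁ J) (∁ I)
  image : V n → V n
  image x = tabulate (λ v → not (J v) ∧ rowComb G x v)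
  image! : ∀ x v → image x ! v ≡ not (J v) ∧ rowComb G x v
  image! x v = lookup∘tabulate _ v
  image-⊕ : ∀ x y → image (x ⊕ y) ≡ image x ⊕ image y
  image-⊕ x y = ext λ v → trans (image! (x ⊕ y) v) (trans (cong (not (J v) ∧_) (rowComb-⊕ G x y v))
    (trans (∧-distribˡ-xor (not (J v)) _ _) (sym (trans (!-⊕ (image x) (image y) v) (cong₂ _xor_ (image! x v) (image! y v))))))
  R = graph (record { app = image ; lin = image-⊕ }) (pow I)
  ker⊑ : ker R ⊑ K G I J
  ker⊑ x (p , q) v = p v , λ e → trans (cong (_∧ rowComb G x v) (cong not (sym e)))
    (trans (sym (image! x v)) (trans (cong (_! v) q) (!-0v v)))
  ran⊑ : ran R ⊑ pow (∁ J)
  ran⊑ y (x , p , refl) v e = trans (image! x v) (cong (_∧ rowComb G x v) e)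
  W⊑ : W ⊑ pow (∁ J)
  W⊑ x m v = proj₁ (m v)
  orth : ∀ u y → Mem (ran R) u → Mem W y → ⟨ u , y ⟩ ≡ false
  orth u y (x , p , refl) m =
    trans (⊕-sum-cong (λ v → trans (cong (_∧ y ! v) (image! x v)) (drop (J v) _ (proj₁ (m v)))))
    (trans (⟨⟩-rowComb G G-sym x y)
    (trans (⊕-sum-cong (λ v → vanish (I v) (p v) (proj₂ (m v)))) (⊕-sum-0 {n})))
    where
    drop : ∀ j r {y} → (not j ≡ false → y ≡ false) → (not j ∧ r) ∧ y ≡ r ∧ y
    drop true  r h = sym (trans (cong (r ∧_) (h refl)) (∧-zeroʳ r))
    drop false r h = refl
    vanish : ∀ i {x r} → (i ≡ false → x ≡ false) → (not i ≡ false → r ≡ false) → x ∧ r ≡ false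
    vanish true  {x} h h' = trans (cong (x ∧_) (h' refl)) (∧-zeroʳ x)
    vanish false {r = r} h h' = cong (_∧ r) (h refl)

-- Row rank equals column rank for the submatrix of M with rows I and columns ∁ J. The second
-- inequality is the first one for ∁ J and ∁ I. For I = J it says that a set and its complement have
-- the same cut-rank.
duality : ∀ {n} (G : Adj n) → (∀ u v → G u v ≡ G v u) → (I J : Fin n → Bool) →
          # I + dim (K G (∁ J) (∁ I)) ≡ dim (K G I J) + # (∁ J)
duality G G-sym I J = ≤-antisym (duality-≤ G G-sym I J) (begin
  dim (K G I J) + # (∁ J)                    ≤⟨ +-monoˡ-≤ (# (∁ J)) (dim-mono (K G I J) (K G (∁ (∁ I)) (∁ (∁ J))) (K-mono G (inv I) (inv J))) ⟩
  dim (K G (∁ (∁ I)) (∁ (∁ J))) + # (∁ J)    ≡⟨ +-comm _ (# (∁ J)) ⟩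
  # (∁ J) + dim (K G (∁ (∁ I)) (∁ (∁ J)))    ≤⟨ duality-≤ G G-sym (∁ J) (∁ I) ⟩
  dim (K G (∁ J) (∁ I)) + # (∁ (∁ I))        ≡⟨ cong (dim (K G (∁ J) (∁ I)) +_) (#-cong (λ v → not-involutive (I v))) ⟩
  dim (K G (∁ J) (∁ I)) + # I                ≡⟨ +-comm _ (# I) ⟩
  # I + dim (K G (∁ J) (∁ I))                ∎)
  where
  open ≤-Reasoning
  inv : ∀ f → f ≼ ∁ (∁ f)
  inv f v = imp (trans (not-involutive (f v)))

-- S consists of the positions of Y that are not pivots of U; the leading one of a nonzero vector of
-- U sits at a pivot, hence outside S.
independent-set : ∀ {n} (Y : V n) (U : Sub n) → U ⊑ pow (Y !_) →
  Σ (V n) λ S → (S !_) ≼ (Y !_) × (∀ x → Mem U x → Mem (pow (S !_)) x → x ≡ 0v) × # (Y !_) ≤ # (S !_) + dim U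
independent-set [] U h = [] , (λ ()) , (λ { [] _ _ → refl }) , z≤n
independent-set {suc n} (b ∷ Y) U h with independent-set Y (tail₀ U) (λ x p v → h _ p (suc v)) | lead? U
... | S , S≼Y , triv , le | yes (z , z∈) =
  false ∷ S , (λ { zero → refl ; (suc v) → S≼Y v }) ,
  (λ { (false ∷ x) p q → cong (false ∷_) (triv x p (λ v → q (suc v))) ; (true ∷ x) p q → contradiction (q zero refl) λ () }) ,
  ≤-trans (+-mono-≤ (b2n≤1 b) le) (≤-reflexive (sym (+-suc (# (S !_)) _)))
  where
  b2n≤1 : ∀ b → b2n b ≤ 1
  b2n≤1 true  = ≤-refl
  b2n≤1 false = z≤n
... | S , S≼Y , triv , le | no ¬z =
  b ∷ S , (λ { zero → imp {b} (λ e → e) ; (suc v) → S≼Y v }) ,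
  (λ { (false ∷ x) p q → cong (false ∷_) (triv x p (λ v → q (suc v))) ; (true ∷ x) p q → contradiction (x , p) ¬z }) ,
  ≤-trans (+-monoʳ-≤ (b2n b) le) (≤-reflexive (sym (+-assoc (b2n b) _ _)))

∈⇒! : ∀ {n} {v : Fin n} {S : Subset n} → v ∈ S → S ! v ≡ true
∈⇒! = []=⇒lookup

!⇒∈ : ∀ {n} {v : Fin n} {S : Subset n} → S ! v ≡ true → v ∈ S
!⇒∈ {v = v} {S} e = lookup⇒[]= v S e

-- The rows at the non-pivots of K(Y, Y) are independent, because a vanishing combination of them is
-- a member of K(Y, Y) supported on non-pivots.
cutRank⇒ : ∀ {n} (G : Adj n) (Y : Subset n) κ → CutRank≤ G Y κ → # (Y !_) ≤ κ + dim (K G (Y !_) (Y !_))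
cutRank⇒ G Y κ cr with independent-set Y (K G (Y !_) (Y !_)) (λ x m v → proj₁ (m v))
... | S , S≼Y , triv , le = ≤-trans le (+-monoˡ-≤ _ (≤-trans (≤-reflexive (sym (∣∣≡# S))) (cr S (S⊆Y , indep))))
  where
  S⊆Y : S ⊆ Y
  S⊆Y {v} p = !⇒∈ (mp (S≼Y v) (∈⇒! p))
  indep : ∀ T → T ⊆ S → Nonempty T → ∃ λ b → b ∉ Y × rowComb G T b ≡ true
  indep T T⊆S (t , t∈T) with any? (λ b → (Y ! b Data.Bool.≟ false) ×-dec (rowComb G T b Data.Bool.≟ true))
  ... | yes (b , Yb , r) = b , (λ b∈Y → contradiction (trans (sym (∈⇒! b∈Y)) Yb) λ ()) , r
  ... | no ¬b = contradiction (trans (sym (∈⇒! t∈T)) (trans (cong (_! t) T≡0) (!-0v t))) λ ()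
    where
    supp : ∀ (P : Subset _) → T ⊆ P → ∀ v → P ! v ≡ false → T ! v ≡ false
    supp P T⊆P v e with T ! v in e'
    ... | false = refl
    ... | true  = trans (sym (∈⇒! (T⊆P (!⇒∈ e')))) e
    T≡0 : T ≡ 0v
    T≡0 = triv T (λ v → supp Y (λ p → S⊆Y (T⊆S p)) v , λ e → ¬-not (λ r → ¬b (v , e , r))) (supp S T⊆S)

-- For independent rows S, the coordinate space of S meets K(Y, Y) only in zero, and both lie in the
-- coordinate space of Y.
⇒cutRank : ∀ {n} (G : Adj n) (Y : Subset n) κ → # (Y !_) ≤ κ + dim (K G (Y !_) (Y !_)) → CutRank≤ G Y κ
⇒cutRank G Y κ le S (S⊆Y , indep) = ≤-trans (≤-reflexive (∣∣≡# S)) (+-cancelʳ-≤ (dim U) _ _ (begin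
  # (S !_) + dim U                             ≡⟨ trans (cong (_+ dim U) (sym (dim-pow (S !_)))) (sym (dim-⊔⊓ U (pow (S !_)))) ⟩
  dim (U ⊓ pow (S !_)) + dim (U ⊔ pow (S !_))  ≤⟨ +-mono-≤ (≤-reflexive (dim-zero (U ⊓ pow (S !_)) triv)) (dim-mono (U ⊔ pow (S !_)) (pow (Y !_)) sum⊑) ⟩
  dim (pow (Y !_))                             ≡⟨ dim-pow (Y !_) ⟩
  # (Y !_)                                     ≤⟨ le ⟩
  κ + dim U                                    ∎))
  where
  open ≤-Reasoning
  U = K G (Y !_) (Y !_)
  S≼Y : (S !_) ≼ (Y !_)
  S≼Y v = imp (λ e → ∈⇒! (S⊆Y (!⇒∈ e)))
  triv : ∀ x → Mem (U ⊓ pow (S !_)) x → x ≡ 0v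
  triv x (m , p) = ext λ v → trans (zero-at v) (sym (!-0v v))
    where
    zero-at : ∀ v → x ! v ≡ false
    zero-at v with x ! v in e
    ... | false = refl
    ... | true with indep x (λ {w} w∈ → !⇒∈ (¬-not′ (p w) (∈⇒! w∈))) (v , !⇒∈ e)
      where
      ¬-not′ : ∀ {a b} → (a ≡ false → b ≡ false) → b ≡ true → a ≡ true
      ¬-not′ {true}  h refl = refl
      ¬-not′ {false} h refl = sym (h refl)
    ... | b , b∉Y , r = contradiction (trans (sym r) (proj₂ (m b) (¬-not (λ q → b∉Y (!⇒∈ q))))) λ ()
  sum⊑ : U ⊔ pow (S !_) ⊑ pow (Y !_)
  sum⊑ x (y , m , p) v e = trans (cong (_! v) (sym (⊕-cancel x y)))
    (trans (!-⊕ (x ⊕ y) y v) (cong₂ _xor_ (p v (mt (S≼Y v) e)) (proj₁ (m v) e)))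

coord : ∀ {n} → Adj n → (Fin n → Bool) → V n → Fin n → Bool
coord G a x v = if a v then rowComb G x v else x ! v

coord-⊕ : ∀ {n} (G : Adj n) a (x y : V n) v → coord G a (x ⊕ y) v ≡ coord G a x v xor coord G a y v
coord-⊕ G a x y v with a v
... | true  = rowComb-⊕ G x y v
... | false = !-⊕ x y v

-- Map a member of U to its chosen coordinates on Y: the kernel lies in W and the image has
-- dimension at most `# Y`. In this form constraints are imposed at a cost of one dimension per
-- vertex.
codim : ∀ {n} (G : Adj n) (a Y : Fin n → Bool) (U W : Sub n) →
        (∀ x → Mem U x → (∀ v → Y v ≡ true → coord G a x v ≡ false) → Mem W x) → dim U ≤ dim W + # Y
codim {n} G a Y U W h = begin
  dim U                                                 ≤⟨ dim-codim U f (pow Y) f∈ ⟩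
  dim (U ⊓ (f ⁻¹[ zeroSub n ])) + dim (pow Y)           ≤⟨ +-mono-≤ (dim-mono _ W sub) (≤-reflexive (dim-pow Y)) ⟩
  dim W + # Y                                           ∎
  where
  open ≤-Reasoning
  image : V n → V n
  image x = tabulate (λ v → Y v ∧ coord G a x v)
  image! : ∀ x v → image x ! v ≡ Y v ∧ coord G a x v
  image! x v = lookup∘tabulate _ v
  f : Lin n n
  f .app = image
  f .lin x y = ext λ v → trans (image! (x ⊕ y) v) (trans (trans (cong (Y v ∧_) (coord-⊕ G a x y v)) (∧-distribˡ-xor (Y v) _ _))
    (sym (trans (!-⊕ (image x) (image y) v) (cong₂ _xor_ (image! x v) (image! y v)))))
  f∈ : ∀ x → Mem (pow Y) (app f x)
  f∈ x v e = trans (image! x v) (cong (_∧ coord G a x v) e)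
  sub : ∀ x → Mem (U ⊓ (f ⁻¹[ zeroSub n ])) x → Mem W x
  sub x (p , q) = h x p λ v e → trans (cong (_∧ coord G a x v) (sym e))
    (trans (sym (image! x v)) (trans (cong (_! v) q) (!-0v v)))

-- Pivoting

swapV : ∀ {n} → Adj n → (Fin n → Bool) → V n → V n
swapV G S x = tabulate (λ v → coord G S x v)

swapV! : ∀ {n} (G : Adj n) S x v → swapV G S x ! v ≡ coord G S x v
swapV! G S x v = lookup∘tabulate _ v

-- The graphs {(x , Mx)} of the two adjacency matrices agree up to exchanging
-- the coordinates x ! v and (Mx) ! v at the vertices v in S.
Exchanged : ∀ {n} → Adj n → Adj n → (Fin n → Bool) → Set
Exchanged {n} G G' S = ∀ x v → rowComb G (swapV G' S x) v ≡ coord G' (∁ S) x v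

exchanged-refl : ∀ {n} (G : Adj n) → Exchanged G G (λ _ → false)
exchanged-refl G x v = cong (λ y → rowComb G y v) (ext {x = swapV G (λ _ → false) x} {x} (swapV! G (λ _ → false) x))

exchanged-trans : ∀ {n} {G G₁ G₂ : Adj n} {S₁ S₂} → Exchanged G G₁ S₁ → Exchanged G₁ G₂ S₂ →
                  Exchanged G G₂ (λ v → S₁ v xor S₂ v)
exchanged-trans {G = G} {G₁} {G₂} {S₁} {S₂} e₁ e₂ x v =
  trans (cong (λ z → rowComb G z v) (ext {x = swapV G₂ (λ v → S₁ v xor S₂ v) x} {swapV G₁ S₁ y} same)) (trans (e₁ y v) out)
  where
  y = swapV G₂ S₂ x
  same : ∀ v → swapV G₂ (λ v → S₁ v xor S₂ v) x ! v ≡ swapV G₁ S₁ y ! v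
  same v = trans (swapV! G₂ _ x v) (sym (trans (swapV! G₁ S₁ y v) inner))
    where
    inner : coord G₁ S₁ y v ≡ coord G₂ (λ v → S₁ v xor S₂ v) x v
    inner with S₁ v | S₂ v | e₂ x v | swapV! G₂ S₂ x v
    ... | true  | true  | p | _ = p
    ... | true  | false | p | _ = p
    ... | false | true  | _ | q = q
    ... | false | false | _ | q = q
  out : coord G₁ (∁ S₁) y v ≡ coord G₂ (∁ (λ v → S₁ v xor S₂ v)) x v
  out with S₁ v | S₂ v | e₂ x v | swapV! G₂ S₂ x v
  ... | true  | true  | _ | q = q
  ... | true  | false | _ | q = q
  ... | false | true  | p | _ = p
  ... | false | false | p | _ = p

module _ {n} (G : Adj n) (u v : Fin n) where
  -- This and the next three definitions repeat the local ones of `pivot`, so that `pivot G u v x y`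
  -- computes to `flipped (swapped x) (swapped y)`.
  agree : Bool → Bool → Bool
  agree p q = if p then q else not q

  swapped : Fin n → Fin n
  swapped z = if is u z then v else (if is v z then u else z)

  inClass : Fin n → Bool
  inClass a = (G u a ∨ G v a) ∧ not (is u a) ∧ not (is v a)

  flipped : Fin n → Fin n → Bool
  flipped a b = G a b xor (inClass a ∧ inClass b ∧ not (agree (G u a) (G u b) ∧ agree (G v a) (G v b)))

  pivot-simple : IsSimple G → IsSimple (pivot G u v)
  pivot-simple (G-sym , G-irr) = (λ x y → flipped-sym (swapped x) (swapped y)) , (λ x → flipped-irr (swapped x))
    where
    agree-comm : ∀ p q → agree p q ≡ agree q p
    agree-comm true  true  = refl
    agree-comm true  false = refl
    agree-comm false true  = refl
    agree-comm false false = refl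
    agree-refl : ∀ p → agree p p ≡ true
    agree-refl true  = refl
    agree-refl false = refl
    ∧-swap : ∀ a b c → a ∧ b ∧ c ≡ b ∧ a ∧ c
    ∧-swap true  b     c = refl
    ∧-swap false true  c = refl
    ∧-swap false false c = refl
    flipped-sym : ∀ a b → flipped a b ≡ flipped b a
    flipped-sym a b = cong₂ _xor_ (G-sym a b) (trans (∧-swap (inClass a) (inClass b) _)
      (cong (λ z → inClass b ∧ inClass a ∧ not z)
        (cong₂ _∧_ (agree-comm (G u a) (G u b)) (agree-comm (G v a) (G v b)))))
    flipped-irr : ∀ a → flipped a a ≡ false
    flipped-irr a = cong₂ _xor_ (G-irr a) (trans
      (cong₂ (λ p q → inClass a ∧ inClass a ∧ not (p ∧ q)) (agree-refl (G u a)) (agree-refl (G v a)))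
      (trans (cong (inClass a ∧_) (∧-zeroʳ (inClass a))) (∧-zeroʳ (inClass a))))

  module _ (simple : IsSimple G) (uv : G u v ≡ true) where
    private
      G-sym = proj₁ simple
      G-irr = proj₂ simple
      G' = pivot G u v

    u≢v : u ≢ v
    u≢v refl = contradiction (trans (sym uv) (G-irr u)) λ ()

    swapped-u : swapped u ≡ v
    swapped-u rewrite is-refl u = refl

    swapped-v : swapped v ≡ u
    swapped-v rewrite is-≢ (u≢v ∘ sym) | is-refl v = refl

    swapped-other : ∀ {t} → t ≢ u → t ≢ v → swapped t ≡ t
    swapped-other p q rewrite is-≢ p | is-≢ q = refl

    inClass-u : inClass u ≡ false
    inClass-u rewrite is-refl u = ∧-zeroʳ _

    inClass-v : inClass v ≡ false
    inClass-v rewrite is-refl v = trans (cong ((G u v ∨ G v v) ∧_) (∧-zeroʳ _)) (∧-zeroʳ _)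

    inClass-other : ∀ {t} → t ≢ u → t ≢ v → inClass t ≡ G u t ∨ G v t
    inClass-other {t} p q rewrite is-≢ p | is-≢ q = lem (G u t ∨ G v t)
      where
      lem : ∀ b → b ∧ true ≡ b
      lem true  = refl
      lem false = refl

    flipped-u : ∀ b → flipped u b ≡ G u b
    flipped-u b rewrite inClass-u = xor-identityʳ _

    flipped-v : ∀ b → flipped v b ≡ G v b
    flipped-v b rewrite inClass-v = xor-identityʳ _

    pivot-u : ∀ {t} → t ≢ u → t ≢ v → G' u t ≡ G v t
    pivot-u p q = trans (cong₂ flipped swapped-u (swapped-other p q)) (flipped-v _)

    pivot-v : ∀ {t} → t ≢ u → t ≢ v → G' v t ≡ G u t
    pivot-v p q = trans (cong₂ flipped swapped-v (swapped-other p q)) (flipped-u _)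

    pivot-uv : G' u v ≡ true
    pivot-uv = trans (cong₂ flipped swapped-u swapped-v) (trans (flipped-v u) (trans (G-sym v u) uv))

    -- The rule by neighbourhood classes is a Schur complement: s and t lie in different classes
    -- exactly if their adjacency pairs to u and v are nonzero and distinct, that is, if the
    -- determinant of these two pairs is one.
    pivot-other : ∀ {s t} → s ≢ u → s ≢ v → t ≢ u → t ≢ v →
                  G' s t ≡ G s t xor ((G v t ∧ G u s) xor (G u t ∧ G v s))
    pivot-other {s} {t} p q p' q' = trans (cong₂ flipped (swapped-other p q) (swapped-other p' q'))
      (cong (G s t xor_) (trans
        (cong₂ (λ i j → i ∧ j ∧ not (agree (G u s) (G u t) ∧ agree (G v s) (G v t))) (inClass-other p q) (inClass-other p' q'))
        (lem (G u s) (G v s) (G u t) (G v t))))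
      where
      lem : ∀ a b c d → (a ∨ b) ∧ (c ∨ d) ∧ not (agree a c ∧ agree b d) ≡ (d ∧ a) xor (c ∧ b)
      lem true  true  true  true  = refl
      lem true  true  true  false = refl
      lem true  true  false true  = refl
      lem true  true  false false = refl
      lem true  false true  true  = refl
      lem true  false true  false = refl
      lem true  false false true  = refl
      lem true  false false false = refl
      lem false true  true  true  = refl
      lem false true  true  false = refl
      lem false true  false true  = refl
      lem false true  false false = refl
      lem false false c     d     = sym (trans (cong₂ _xor_ (∧-zeroʳ d) (∧-zeroʳ c)) refl)

    away : Fin n → Bool
    away a = not (is u a) ∧ not (is v a)

    ⊕-sum-split : ∀ (f : Fin n → Bool) → ⊕-sum f ≡ (f u xor f v) xor ⊕-sum (λ a → away a ∧ f a)
    ⊕-sum-split f = trans (⊕-sum-cong pointwise) (trans (⊕-sum-xor (λ a → (is u a ∧ f a) xor (is v a ∧ f a)) _)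
      (cong (_xor ⊕-sum (λ a → away a ∧ f a)) (trans (⊕-sum-xor (λ a → is u a ∧ f a) _)
        (cong₂ _xor_ (⊕-sum-is u f) (⊕-sum-is v f)))))
      where
      pointwise : ∀ a → f a ≡ ((is u a ∧ f a) xor (is v a ∧ f a)) xor (away a ∧ f a)
      pointwise a with a ≟ u | a ≟ v
      ... | yes refl | yes e = contradiction e u≢v
      ... | yes _ | no _  = sym (trans (xor-identityʳ _) (xor-identityʳ _))
      ... | no _  | yes _ = sym (xor-identityʳ _)
      ... | no _  | no _  = refl

    away-cong : ∀ (f g : Fin n → Bool) → (∀ a → a ≢ u → a ≢ v → f a ≡ g a) →
                ⊕-sum (λ a → away a ∧ f a) ≡ ⊕-sum (λ a → away a ∧ g a)
    away-cong f g h = ⊕-sum-cong pointwise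
      where
      pointwise : ∀ a → away a ∧ f a ≡ away a ∧ g a
      pointwise a with a ≟ u | a ≟ v
      ... | yes _ | _     = refl
      ... | no _  | yes _ = refl
      ... | no p  | no q  = h a p q

    rest : V n → Fin n → Bool
    rest x t = ⊕-sum (λ a → away a ∧ (x ! a ∧ G a t))

    row-u : ∀ x → rowComb G' x u ≡ x ! v xor rest x v
    row-u x = trans (⊕-sum-split (λ a → x ! a ∧ G' a u)) (cong₂ _xor_
      (trans (cong₂ (λ p q → (x ! u ∧ p) xor (x ! v ∧ q)) (proj₂ (pivot-simple simple) u)
               (trans (proj₁ (pivot-simple simple) v u) pivot-uv))
             (lem (x ! u) (x ! v)))
      (away-cong _ _ (λ a p q → cong (x ! a ∧_) (trans (proj₁ (pivot-simple simple) a u) (trans (pivot-u p q) (G-sym v a))))))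
      where
      lem : ∀ a b → (a ∧ false) xor (b ∧ true) ≡ b
      lem true  true  = refl
      lem true  false = refl
      lem false true  = refl
      lem false false = refl

    row-v : ∀ x → rowComb G' x v ≡ x ! u xor rest x u
    row-v x = trans (⊕-sum-split (λ a → x ! a ∧ G' a v)) (cong₂ _xor_
      (trans (cong₂ (λ p q → (x ! u ∧ p) xor (x ! v ∧ q)) pivot-uv (proj₂ (pivot-simple simple) v))
             (lem (x ! u) (x ! v)))
      (away-cong _ _ (λ a p q → cong (x ! a ∧_) (trans (proj₁ (pivot-simple simple) a v) (trans (pivot-v p q) (G-sym u a))))))
      where
      lem : ∀ a b → (a ∧ true) xor (b ∧ false) ≡ a
      lem true  true  = refl
      lem true  false = refl
      lem false true  = refl
      lem false false = refl

    row-other : ∀ x {t} → t ≢ u → t ≢ v → rowComb G' x t ≡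
      ((x ! u ∧ G v t) xor (x ! v ∧ G u t)) xor (rest x t xor ((G v t ∧ rest x u) xor (G u t ∧ rest x v)))
    row-other x {t} p q = trans (⊕-sum-split (λ a → x ! a ∧ G' a t)) (cong₂ _xor_
      (cong₂ (λ y z → (x ! u ∧ y) xor (x ! v ∧ z)) (pivot-u p q) (pivot-v p q))
      (trans (away-cong _ _ (λ a p' q' → cong (x ! a ∧_) (trans (pivot-other p' q' p q)
               (cong (G a t xor_) (cong₂ (λ y z → (G v t ∧ y) xor (G u t ∧ z)) (G-sym u a) (G-sym v a))))))
      (trans (⊕-sum-cong (λ a → distrib (away a) (x ! a) (G a t) (G v t) (G a u) (G u t) (G a v)))
      (trans (⊕-sum-xor (λ a → away a ∧ (x ! a ∧ G a t)) _) (cong (rest x t xor_)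
      (trans (⊕-sum-xor (λ a → G v t ∧ (away a ∧ (x ! a ∧ G a u))) _)
             (cong₂ _xor_ (⊕-sum-∧ (G v t) (λ a → away a ∧ (x ! a ∧ G a u))) (⊕-sum-∧ (G u t) (λ a → away a ∧ (x ! a ∧ G a v))))))))))
      where
      distrib : ∀ w x g c p d q → w ∧ (x ∧ (g xor ((c ∧ p) xor (d ∧ q)))) ≡
                (w ∧ (x ∧ g)) xor ((c ∧ (w ∧ (x ∧ p))) xor (d ∧ (w ∧ (x ∧ q))))
      distrib true  true  g c p d q = refl
      distrib true  false g c p d q = sym (cong₂ _xor_ (∧-zeroʳ c) (∧-zeroʳ d))
      distrib false x     g c p d q = sym (cong₂ _xor_ (∧-zeroʳ c) (∧-zeroʳ d))

    ends : Fin n → Bool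
    ends a = is u a ∨ is v a

    ends-u : ends u ≡ true
    ends-u rewrite is-refl u = refl

    ends-v : ends v ≡ true
    ends-v rewrite is-≢ (u≢v ∘ sym) | is-refl v = refl

    ends-other : ∀ {t} → t ≢ u → t ≢ v → ends t ≡ false
    ends-other p q rewrite is-≢ p | is-≢ q = refl

    coord-ends-u : ∀ x → coord G' ends x u ≡ rowComb G' x u
    coord-ends-u x rewrite ends-u = refl

    coord-ends-v : ∀ x → coord G' ends x v ≡ rowComb G' x v
    coord-ends-v x rewrite ends-v = refl

    coord-ends-other : ∀ x {t} → t ≢ u → t ≢ v → coord G' ends x t ≡ x ! t
    coord-ends-other x p q rewrite ends-other p q = refl

    -- Pivoting is the principal pivot transform on u and v: the equations for (Mx)_u and (Mx)_v are
    -- solved for x_v and x_u. The swap of labels accounts for the inverse of the 2 by 2 block at u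
    -- and v, which is the transposition.
    pivot-exchanged : Exchanged G G' ends
    pivot-exchanged x t = trans (⊕-sum-split (λ a → y ! a ∧ G a t)) (trans
      (cong₂ _xor_
        (cong₂ (λ p q → (p ∧ G u t) xor (q ∧ G v t))
          (trans (swapV! G' ends x u) (trans (coord-ends-u x) (row-u x)))
          (trans (swapV! G' ends x v) (trans (coord-ends-v x) (row-v x))))
        (away-cong _ _ (λ a p q → cong (_∧ G a t) (trans (swapV! G' ends x a) (coord-ends-other x p q)))))
      (cases t (t ≟ u) (t ≟ v)))
      where
      y = swapV G' ends x
      cases : ∀ t → Dec (t ≡ u) → Dec (t ≡ v) →
              (((x ! v xor rest x v) ∧ G u t) xor ((x ! u xor rest x u) ∧ G v t)) xor rest x t ≡ coord G' (∁ ends) x t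
      cases t (yes refl) _ rewrite ends-u | G-irr u | G-sym v u | uv = lem (x ! v xor rest x v) (x ! u) (rest x u)
        where
        lem : ∀ a b c → ((a ∧ false) xor ((b xor c) ∧ true)) xor c ≡ b
        lem true  true  true  = refl
        lem true  true  false = refl
        lem true  false true  = refl
        lem true  false false = refl
        lem false true  true  = refl
        lem false true  false = refl
        lem false false true  = refl
        lem false false false = refl
      cases t (no _) (yes refl) rewrite ends-v | G-irr v | uv = lem (x ! v) (rest x v) (x ! u xor rest x u)
        where
        lem : ∀ b c a → (((b xor c) ∧ true) xor (a ∧ false)) xor c ≡ b
        lem true  true  true  = refl
        lem true  true  false = refl
        lem true  false true  = refl
        lem true  false false = refl
        lem false true  true  = refl
        lem false true  false = refl
        lem false false true  = refl
        lem false false false = refl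
      cases t (no p) (no q) rewrite ends-other p q =
        sym (trans (row-other x p q) (lem (x ! u) (x ! v) (G u t) (G v t) (rest x u) (rest x v) (rest x t)))
        where
        lem : ∀ a b c d e f r → ((a ∧ d) xor (b ∧ c)) xor (r xor ((d ∧ e) xor (c ∧ f))) ≡
              (((b xor f) ∧ c) xor ((a xor e) ∧ d)) xor r
        lem a b c d e f r = ⇔-sound (taut 7 (λ a b c d e f r →
          not ((((a ∧ d) xor (b ∧ c)) xor (r xor ((d ∧ e) xor (c ∧ f)))) xor ((((b xor f) ∧ c) xor ((a xor e) ∧ d)) xor r)))
          refl a b c d e f r)
          where
          ⇔-sound : ∀ {a b} → not (a xor b) ≡ true → a ≡ b
          ⇔-sound {true}  {true}  _ = refl
          ⇔-sound {false} {false} _ = refl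

-- The minors H of G on the complement of D.  At v in D the constraint imposed on
-- a vector is (Mx) ! v = 0 if a v holds and x ! v = 0 otherwise.

link∈ link∋ : ∀ {n} (a P Q : Fin n → Bool) → Fin n → Bool
link∈ a P Q v = P v ∨ (Q v ∧ a v)
link∋ a P Q v = P v ∨ (Q v ∧ not (a v))

-- Neither coordinate is constrained on P, exactly one on Q outside P, both elsewhere. For Q = D
-- disjoint from P this stands in for the space K(P, P) of the minor, written in the coordinates of
-- G.
Link : ∀ {n} → Adj n → (a P Q : Fin n → Bool) → Sub n
Link G a P Q = K G (link∈ a P Q) (link∋ a P Q)

pivots-snoc : ∀ {n} {G G' : Adj n} → Pivots G G' → ∀ u v → G' u v ≡ true → Pivots G (pivot G' u v)
pivots-snoc done u v e = step u v e done
pivots-snoc (step u' v' e' p) u v e = step u' v' e' (pivots-snoc p u v e)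

unitV : ∀ {n} → Fin n → V n
unitV u = tabulate (is u)

unitV! : ∀ {n} (u v : Fin n) → unitV u ! v ≡ is u v
unitV! u v = lookup∘tabulate _ v

rowComb-unit : ∀ {n} (G : Adj n) u v → rowComb G (unitV u) v ≡ G u v
rowComb-unit G u v = trans (⊕-sum-cong (λ a → cong (_∧ G a v) (unitV! u a))) (⊕-sum-is u (λ a → G a v))

module _ {n} (G : Adj n) (D a : Fin n → Bool)
         (free : ∀ x → Mem (Link G a (λ _ → false) D) x → x ≡ 0v) where

  record Realisation : Set where
    field
      target    : Adj n
      pivots    : Pivots G target
      S         : Fin n → Bool
      exchanged : Exchanged G target S
      S≡a       : ∀ v → D v ≡ true → S v ≡ a v

  private
    -- Suppose all neighbours of u in G' lie in the settled set E. The unit vector at u, carried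
    -- back to G by the exchange, then satisfies every constraint: on E because S agrees with a
    -- there, at u because S and a differ there, elsewhere because both coordinates vanish. This
    -- contradicts `free`.
    nonempty-row : ∀ {G' S} → IsSimple G' → Exchanged G G' S → (E : Fin n → Bool) →
      (∀ v → E v ≡ true → D v ≡ true × S v ≡ a v) → ∀ u → D u ≡ true → S u ≢ a u →
      ¬ (∀ w → E w ≡ false → G' u w ≡ false)
    nonempty-row {G'} {S} (G'-sym , G'-irr) ex E inv u Du Su empty = S-both
      where
      x = swapV G' S (unitV u)
      mem : Mem (Link G a (λ _ → false) D) x
      mem v with v ≟ u
      ... | yes refl rewrite Du | swapV! G' S (unitV u) u | ex (unitV u) u | rowComb-unit G' u u | G'-irr u | unitV! u u | is-refl u
            with S u | a u
      ...     | true  | true  = contradiction refl Su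
      ...     | true  | false = (λ _ → refl) , λ ()
      ...     | false | true  = (λ ()) , λ _ → refl
      ...     | false | false = contradiction refl Su
      mem v | no ne rewrite swapV! G' S (unitV u) v | ex (unitV u) v | rowComb-unit G' u v | unitV! u v | is-≢ ne with E v in Ev
      ... | false rewrite empty v Ev = both (S v)
        where
        both : ∀ s → (D v ∧ a v ≡ false → (if s then false else false) ≡ false) × (D v ∧ not (a v) ≡ false → (if not s then false else false) ≡ false)
        both true  = (λ _ → refl) , (λ _ → refl)
        both false = (λ _ → refl) , (λ _ → refl)
      ... | true rewrite proj₁ (inv v Ev) | proj₂ (inv v Ev) with a v
      ...   | true  = (λ ()) , λ _ → refl
      ...   | false = (λ _ → refl) , λ ()
      S-both : ⊥
      S-both with S u
                | trans (sym (swapV! G' S (unitV u) u)) (trans (cong (_! u) (free x mem)) (!-0v u))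
                | trans (sym (ex (unitV u) u)) (trans (cong (λ y → rowComb G y u) (free x mem)) (rowComb-0 G u))
      ... | true  | _ | q rewrite unitV! u u | is-refl u = contradiction q λ ()
      ... | false | p | _ rewrite unitV! u u | is-refl u = contradiction p λ ()

    advance : ∀ {E : Fin n → Bool} {u us} → (∀ v → D v ≡ true → E v ≡ true ⊎ v ∈ˡ (u ∷ us)) →
              ∀ v → D v ≡ true → is u v ∨ E v ≡ true ⊎ v ∈ˡ us
    advance {E} {u} cover v Dv with cover v Dv
    ... | inj₁ e = inj₁ (trans (cong (is u v ∨_) e) (∨-zeroʳ (is u v)))
    ... | inj₂ (here refl) = inj₁ (cong (_∨ E v) (is-refl v))
    ... | inj₂ (there i) = inj₂ i

    -- The vertices of D are settled one by one, E being those already done. If S is wrong at u, a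
    -- pivot on u and a neighbour w outside E corrects it; S also changes at w, but w is not yet
    -- settled or not in D.
    go : (us : List (Fin n)) (G' : Adj n) (S E : Fin n → Bool) → Pivots G G' → IsSimple G' → Exchanged G G' S →
         (∀ v → E v ≡ true → D v ≡ true × S v ≡ a v) → (∀ v → D v ≡ true → E v ≡ true ⊎ v ∈ˡ us) → Realisation
    go [] G' S E ps simple ex inv cover = record
      { target = G' ; pivots = ps ; S = S ; exchanged = ex ; S≡a = λ v Dv → [ (λ e → proj₂ (inv v e)) , (λ ()) ]′ (cover v Dv) }
    go (u ∷ us) G' S E ps simple ex inv cover with D u Data.Bool.≟ true | S u Data.Bool.≟ a u
    ... | no ¬Du | _ = go us G' S E ps simple ex inv λ v Dv → case cover v Dv of λ where
      (inj₁ e) → inj₁ e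
      (inj₂ (here refl)) → contradiction Dv ¬Du
      (inj₂ (there i)) → inj₂ i
    ... | yes Du | yes Su = go us G' S (λ v → is u v ∨ E v) ps simple ex inv' (advance cover)
      where
      inv' : ∀ v → is u v ∨ E v ≡ true → D v ≡ true × S v ≡ a v
      inv' v e with v ≟ u
      ... | yes refl = Du , Su
      ... | no _ = inv v e
    ... | yes Du | no Su with any? (λ w → (E w Data.Bool.≟ false) ×-dec (G' u w Data.Bool.≟ true))
    ...   | no ¬w = contradiction (λ w Ew → ¬-not (λ e → ¬w (w , Ew , e))) (nonempty-row simple ex E inv u Du Su)
    ...   | yes (w , Ew , uw) =
      go us (pivot G' u w) (λ v → S v xor ends G' u w simple uw v) (λ v → is u v ∨ E v)
         (pivots-snoc ps u w uw) (pivot-simple G' u w simple)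
         (exchanged-trans ex (pivot-exchanged G' u w simple uw)) inv' (advance cover)
      where
      toggle : ∀ s b → s ≢ b → s xor true ≡ b
      toggle true  true  h = contradiction refl h
      toggle true  false h = refl
      toggle false true  h = refl
      toggle false false h = contradiction refl h
      inv' : ∀ v → is u v ∨ E v ≡ true → D v ≡ true × S v xor ends G' u w simple uw v ≡ a v
      inv' v e with v ≟ u
      ... | yes refl = Du , toggle (S v) (a v) Su
      ... | no ne with v ≟ w
      ...   | yes refl = contradiction (trans (sym e) Ew) λ ()
      ...   | no ne' = proj₁ (inv v e) , trans (xor-identityʳ (S v)) (proj₂ (inv v e))

  realise : IsSimple G → Realisation
  realise simple = go (allFin n) G (λ _ → false) (λ _ → false) done simple (exchanged-refl G) (λ _ ())
    (λ v _ → inj₂ (∈-allFin v))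

-- Induced subgraphs and the layouts of pivot-minors

enum : ∀ {n} (p : Subset n) → Fin ∣ p ∣ → Fin n
enum (true  ∷ p) zero    = zero
enum (true  ∷ p) (suc i) = suc (enum p i)
enum (false ∷ p) i       = suc (enum p i)

spread : ∀ {n} (p : Subset n) → V ∣ p ∣ → V n
spread []          y       = []
spread (true  ∷ p) (b ∷ y) = b ∷ spread p y
spread (false ∷ p) y       = false ∷ spread p y

spread-enum : ∀ {n} (p : Subset n) y i → spread p y ! enum p i ≡ y ! i
spread-enum (true  ∷ p) (b ∷ y) zero    = refl
spread-enum (true  ∷ p) (b ∷ y) (suc i) = spread-enum p y i
spread-enum (false ∷ p) y       i       = spread-enum p y i

spread-outside : ∀ {n} (p : Subset n) y v → p ! v ≡ false → spread p y ! v ≡ false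
spread-outside (true  ∷ p) (b ∷ y) (suc v) e = spread-outside p y v e
spread-outside (false ∷ p) y       zero    e = refl
spread-outside (false ∷ p) y       (suc v) e = spread-outside p y v e

enum-onto : ∀ {n} (p : Subset n) v → p ! v ≡ true → ∃ λ i → enum p i ≡ v
enum-onto (true  ∷ p) zero    e = zero , refl
enum-onto (true  ∷ p) (suc v) e with enum-onto p v e
... | i , refl = suc i , refl
enum-onto (false ∷ p) (suc v) e with enum-onto p v e
... | i , refl = i , refl

enum-injective : ∀ {n} (p : Subset n) → Injective _≡_ _≡_ (enum p)
enum-injective (true  ∷ p) {zero}  {zero}  e = refl
enum-injective (true  ∷ p) {suc i} {suc j} e = cong suc (enum-injective p (suc-injective e))
enum-injective (false ∷ p) e = enum-injective p (suc-injective e)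

⊕-sum-spread : ∀ {n} (p : Subset n) y (g : Fin n → Bool) →
               ⊕-sum (λ v → spread p y ! v ∧ g v) ≡ ⊕-sum (λ i → y ! i ∧ g (enum p i))
⊕-sum-spread []          []      g = refl
⊕-sum-spread (true  ∷ p) (b ∷ y) g = cong ((b ∧ g zero) xor_) (⊕-sum-spread p y (g ∘ suc))
⊕-sum-spread (false ∷ p) y       g = ⊕-sum-spread p y (g ∘ suc)

#-spread : ∀ {n} (p : Subset n) y → # (spread p y !_) ≡ # (y !_)
#-spread []          []      = refl
#-spread (true  ∷ p) (b ∷ y) = cong (b2n b +_) (#-spread p y)
#-spread (false ∷ p) y       = #-spread p y

spread-lin : ∀ {n} (p : Subset n) → Lin ∣ p ∣ n
spread-lin p .app = spread p
spread-lin p .lin = go p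
  where
  go : ∀ {n} (p : Subset n) x y → spread p (x ⊕ y) ≡ spread p x ⊕ spread p y
  go []          x       y       = refl
  go (true  ∷ p) (b ∷ x) (c ∷ y) = cong (_ ∷_) (go p x y)
  go (false ∷ p) x       y       = cong (false ∷_) (go p x y)

swapV-lin : ∀ {n} (G : Adj n) S → Lin n n
swapV-lin G S .app = swapV G S
swapV-lin G S .lin x y = ext λ v → trans (swapV! G S (x ⊕ y) v) (trans (coord-⊕ G S x y v)
  (sym (trans (!-⊕ (swapV G S x) (swapV G S y) v) (cong₂ _xor_ (swapV! G S x v) (swapV! G S y v)))))

<ᵇ-step : ∀ m n → m ≢ n → (m <ᵇ suc n) ≡ (m <ᵇ n)
<ᵇ-step zero    zero    h = contradiction refl h
<ᵇ-step zero    (suc n) h = refl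
<ᵇ-step (suc m) zero    h = refl
<ᵇ-step (suc m) (suc n) h = <ᵇ-step m n (h ∘ cong suc)

<ᵇ-irrefl : ∀ n → (n <ᵇ n) ≡ false
<ᵇ-irrefl zero    = refl
<ᵇ-irrefl (suc n) = <ᵇ-irrefl n

<ᵇ-true : ∀ {m n} → m < n → (m <ᵇ n) ≡ true
<ᵇ-true {zero}  (s≤s _) = refl
<ᵇ-true {suc m} (s≤s h) = <ᵇ-true h

-- An ordering of the complement of D in which, in the minor given by D and a,
-- every initial segment has cut-rank at most k.
record Layout {n} (G : Adj n) (D a : Fin n → Bool) (k : ℕ) : Set where
  field
    len    : ℕ
    len+#D : len + # D ≡ n
    X      : ℕ → Fin n → Bool
    start  : ∀ v → X 0 v ≡ false
    finish : X len ≗ᵇ ∁ D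
    grow   : ∀ t → t < len → ∃ λ x → X t x ≡ false × X (suc t) x ≡ true × (∀ v → v ≢ x → X (suc t) v ≡ X t v)
    width  : ∀ t → t ≤ len → # (X t) ≤ k + dim (Link G a (X t) D)

-- The pivots found by `realise`, followed by deleting D, give a proper pivot-minor; the ordering it
-- has by minimality of G is read inside G, where its cut-ranks are expressed by `Link`.
minor-layout : ∀ {n} (G : Adj n) {k} → IsSimple G → ExcludedPivotMinorLRW k G → (D a : Fin n → Bool) →
               ∃ (λ v → D v ≡ true) → (∀ x → Mem (Link G a (λ _ → false) D) x → x ≡ 0v) → Layout G D a k
minor-layout {n} G {k} simple (_ , excl) D a (d , Dd) free = record
  { len = m ; len+#D = m+#D ; X = X
  ; start = λ v → trans (cong (_! v) (cong (spread p) prefix-0)) (spread-0 v)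
  ; finish = fin ; grow = grows ; width = wide }
  where
  open Realisation (realise G D a free simple)
  p : Subset n
  p = tabulate (∁ D)
  p! : ∀ v → p ! v ≡ not (D v)
  p! v = lookup∘tabulate _ v
  m = ∣ p ∣
  m+#D : m + # D ≡ n
  m+#D = trans (cong (_+ # D) (trans (∣∣≡# p) (#-cong p!)))
    (trans (#-⊎ {h = λ _ → true} (λ v → lem (D v))) (#-all {n}))
    where
    lem : ∀ b → b2n (not b) + b2n b ≡ 1
    lem true  = refl
    lem false = refl
  m<n : m < n
  m<n = ≤-trans (≤-reflexive (sym (trans (cong (m +_) (#-is d)) (+-comm m 1))))
    (≤-trans (+-monoʳ-≤ m (#-mono λ v → imp (λ e → trans (cong D (is⇒≡ v e)) Dd))) (≤-reflexive m+#D))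
    where
    is⇒≡ : ∀ v → is d v ≡ true → v ≡ d
    is⇒≡ v e with v ≟ d
    ... | yes q = q
    ... | no _  = contradiction e λ ()
  H : Adj m
  H i j = target (enum p i) (enum p j)
  lrw : LRW≤ H k
  lrw = excl m H (target , pivots , enum p , enum-injective p , λ _ _ → refl) m<n
  π = proj₁ lrw
  prefix! : ∀ t i → prefix π t ! i ≡ (toℕ (π ⟨$⟩ˡ i) <ᵇ t)
  prefix! t i = lookup∘tabulate _ i
  X : ℕ → Fin n → Bool
  X t = spread p (prefix π t) !_
  spread-0 : ∀ v → spread p 0v ! v ≡ false
  spread-0 v = trans (cong (_! v) (lin-0 (spread-lin p))) (!-0v v)
  prefix-0 : prefix π 0 ≡ 0v
  prefix-0 = ext {x = prefix π 0} λ i → trans (prefix! 0 i) (sym (!-0v i))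
  Dv⇒p : ∀ {v} → D v ≡ true → p ! v ≡ false
  Dv⇒p {v} e = trans (p! v) (cong not e)
  ¬Dv⇒p : ∀ {v} → D v ≡ false → p ! v ≡ true
  ¬Dv⇒p {v} e = trans (p! v) (cong not e)
  fin : X m ≗ᵇ ∁ D
  fin v with D v in e
  ... | true = spread-outside p _ v (Dv⇒p e)
  ... | false with enum-onto p v (¬Dv⇒p e)
  ...   | i , refl = trans (spread-enum p _ i) (trans (prefix! m i) (<ᵇ-true (toℕ<n (π ⟨$⟩ˡ i))))
  grows : ∀ t → t < m → ∃ λ x → X t x ≡ false × X (suc t) x ≡ true × (∀ v → v ≢ x → X (suc t) v ≡ X t v)
  grows t t<m = enum p i , val t false (<ᵇ-irrefl t) , val (suc t) true (<ᵇ-true {t} ≤-refl) , other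
    where
    i = π ⟨$⟩ʳ fromℕ< t<m
    pos-i : toℕ (π ⟨$⟩ˡ i) ≡ t
    pos-i = trans (cong toℕ (inverseˡ π)) (toℕ-fromℕ< t<m)
    val : ∀ s b → (t <ᵇ s) ≡ b → X s (enum p i) ≡ b
    val s b e = trans (spread-enum p _ i) (trans (prefix! s i) (trans (cong (_<ᵇ s) pos-i) e))
    other : ∀ v → v ≢ enum p i → X (suc t) v ≡ X t v
    other v ne with p ! v in e
    ... | false = trans (spread-outside p _ v e) (sym (spread-outside p _ v e))
    ... | true with enum-onto p v e
    ...   | j , refl = trans (spread-enum p _ j) (trans (prefix! (suc t) j)
        (trans (<ᵇ-step _ t (λ q → ne (cong (enum p) (j≡i q)))) (sym (trans (spread-enum p _ j) (prefix! t j)))))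
      where
      j≡i : toℕ (π ⟨$⟩ˡ j) ≡ t → j ≡ i
      j≡i q = trans (sym (inverseʳ π)) (cong (π ⟨$⟩ʳ_) (toℕ-injective (trans q (sym (toℕ-fromℕ< t<m)))))
  -- Two injections: padding by zeros on D, where Mx then is unrestricted, and the exchange of
  -- coordinates on S, which turns x_v = 0 into the constraint prescribed by a.
  dim-H : ∀ Y → dim (K H (Y !_) (Y !_)) ≤ dim (Link G a (spread p Y !_) D)
  dim-H Y = ≤-trans
    (dim-map-≤ (K H (Y !_) (Y !_)) (spread-lin p) M mem₁ inj₁′)
    (dim-map-≤ M (swapV-lin target S) (Link G a Z D) mem₂ inj₂′)
    where
    Z : Fin n → Bool
    Z = spread p Y !_
    M = K target Z (λ v → Z v ∨ D v)
    mem₁ : ∀ x → Mem (K H (Y !_) (Y !_)) x → Mem M (spread p x)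
    mem₁ x h v with D v in e
    ... | true = (λ _ → spread-outside p x v (Dv⇒p e)) , λ q → contradiction (trans (sym (∨-zeroʳ (Z v))) q) λ ()
    ... | false with enum-onto p v (¬Dv⇒p e)
    ...   | i , refl = (λ q → trans (spread-enum p x i) (proj₁ (h i) (trans (sym (spread-enum p Y i)) q))) ,
        λ q → trans (⊕-sum-spread p x (λ a → target a (enum p i))) (proj₂ (h i) (trans (sym (spread-enum p Y i)) (trans (sym (∨-identityʳ _)) q)))
    inj₁′ : ∀ x → Mem (K H (Y !_) (Y !_)) x → spread p x ≡ 0v → x ≡ 0v
    inj₁′ x _ e = ext λ i → trans (sym (spread-enum p x i)) (trans (cong (_! enum p i) e) (trans (!-0v (enum p i)) (sym (!-0v i))))
    mem₂ : ∀ x → Mem M x → Mem (Link G a Z D) (swapV target S x)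
    mem₂ x h v rewrite swapV! target S x v | exchanged x v with S v in eS | D v in eD
    ... | true | true rewrite trans (sym (S≡a v eD)) eS =
      (λ q → contradiction (trans (sym (∨-zeroʳ (Z v))) q) λ ()) , λ q → proj₁ (h v) (trans (sym (∨-identityʳ _)) q)
    ... | false | true rewrite trans (sym (S≡a v eD)) eS =
      (λ q → proj₁ (h v) (trans (sym (∨-identityʳ _)) q)) , λ q → contradiction (trans (sym (∨-zeroʳ (Z v))) q) λ ()
    ... | true | false = (λ q → proj₂ (h v) (trans (cong (Z v ∨_) eD) q)) , λ q → proj₁ (h v) (trans (sym (∨-identityʳ _)) q)
    ... | false | false = (λ q → proj₁ (h v) (trans (sym (∨-identityʳ _)) q)) , λ q → proj₂ (h v) (trans (cong (Z v ∨_) eD) q)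
    inj₂′ : ∀ x → Mem M x → swapV target S x ≡ 0v → x ≡ 0v
    inj₂′ x _ e = ext λ v → trans (vanish v) (sym (!-0v v))
      where
      vanish : ∀ v → x ! v ≡ false
      vanish v with S v | trans (sym (swapV! target S x v)) (trans (cong (_! v) e) (!-0v v))
                        | trans (sym (exchanged x v)) (trans (cong (λ y → rowComb G y v) e) (rowComb-0 G v))
      ... | true  | _ | q = q
      ... | false | q | _ = q
  wide : ∀ t → t ≤ m → # (X t) ≤ k + dim (Link G a (X t) D)
  wide zero _ = ≤-trans (≤-reflexive (trans (#-cong (λ v → trans (cong (_! v) (cong (spread p) prefix-0)) (spread-0 v))) (#-none {n}))) z≤n
  wide t@(suc _) t≤m with t <? m
  ... | yes t<m = ≤-trans (≤-reflexive (#-spread p _)) (≤-trans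
      (cutRank⇒ H (prefix π t) k (proj₂ lrw t (s≤s z≤n) t<m))
      (+-monoʳ-≤ k (dim-H (prefix π t))))
  -- `LRW≤` is silent about the full prefix. Its cut-rank is zero: the constraints on D cut the
  -- whole space down by at most `# D` dimensions.
  ... | no t≮m rewrite ≤-antisym t≤m (≮⇒≥ t≮m) = ≤-trans (+-cancelʳ-≤ (# D) _ _ (begin
      # (X m) + # D                    ≡⟨ cong (_+ # D) (trans (#-cong fin) (trans (sym (#-cong p!)) (sym (∣∣≡# p)))) ⟩
      m + # D                          ≡⟨ trans m+#D (sym (dim-whole n)) ⟩
      dim (whole n)                    ≤⟨ codim G a D (whole n) (Link G a (X m) D) mem ⟩
      dim (Link G a (X m) D) + # D     ∎)) (m≤n+m _ k)
    where
    open ≤-Reasoning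
    mem : ∀ x → Mem (whole n) x → (∀ v → D v ≡ true → coord G a x v ≡ false) → Mem (Link G a (X m) D) x
    mem x _ c v rewrite fin v with D v | c v
    ... | false | _ = (λ ()) , λ ()
    ... | true  | c' with a v | c' refl
    ...   | true  | q = (λ ()) , λ _ → q
    ...   | false | q = (λ _ → q) , λ ()

-- Linked chains of vertex sets

K′ : ∀ {n} → Adj n → (Fin n → Bool) → Sub n
K′ G X = K G X X

-- Cut-rank at most w, with the subtraction cleared.
Narrow : ∀ {n} → Adj n → ℕ → (Fin n → Bool) → Set
Narrow G w X = # X ≤ w + dim (K′ G X)

infix 4 _⋦_
_⋦_ : ∀ {n} → (Fin n → Bool) → (Fin n → Bool) → Set
P ⋦ Q = P ≼ Q × ∃ λ v → P v ≡ false × Q v ≡ true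

Chain : ∀ {n} → ℕ → (ℕ → Fin n → Bool) → Set
Chain L X = ∀ t → suc t < L → X t ⋦ X (suc t)

-- All sets from P to Q have cut-rank at least w. They are given as vectors so that a counterexample
-- can be searched for.
Linked : ∀ {n} → Adj n → ℕ → (P Q : Fin n → Bool) → Set
Linked {n} G w P Q = ∀ (Z : V n) → P ≼ (Z !_) → (Z !_) ≼ Q → w + dim (K′ G (Z !_)) ≤ # (Z !_)

chain-mono : ∀ {n L} {X : ℕ → Fin n → Bool} → Chain L X → ∀ {s t} → s ≤ t → t < L → X s ≼ X t
chain-mono {X = X} ch {s} {zero}  z≤n _ = ≼-refl {f = X 0}
chain-mono {X = X} ch {s} {suc t} s≤t t<L with s Data.Nat.≟ suc t
... | yes refl = ≼-refl {f = X s}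
... | no ne = ≼-trans {f = X s} {X t} {X (suc t)} (chain-mono ch (s≤s⁻¹ (≤∧≢⇒< s≤t ne)) (<⇒≤ t<L)) (proj₁ (ch t t<L))

⋦-≼-trans : ∀ {n} {P Q R S : Fin n → Bool} → P ≼ Q → Q ⋦ R → R ≼ S → P ⋦ S
⋦-≼-trans {P = P} {Q} {R} {S} p (q , v , Qv , Rv) r =
  ≼-trans {f = P} {Q} {S} p (≼-trans {f = Q} {R} {S} q r) , v , mt {P v} (p v) Qv , mp {R v} (r v) Rv

-- Each lowering of the level costs a factor `suc l`, as a block of that many sets is then replaced
-- by a single set.
chain-length : ℕ → ℕ → ℕ
chain-length l zero    = suc l
chain-length l (suc w) = chain-length l w * suc l

≼? : ∀ {n} (f g : Fin n → Bool) → Dec (f ≼ g)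
≼? f g = all? (λ v → (f v ⇒ g v) Data.Bool.≟ true)

-- Either some block of suc l consecutive sets is linked at the level w, or every
-- block has a set of smaller cut-rank in between; these sets form a chain again.
linked-subchain : ∀ {n} (G : Adj n) l w X → Chain (chain-length l w) X → (∀ t → t < chain-length l w → Narrow G w (X t)) →
  ∃ λ w' → w' ≤ w × Σ (ℕ → Fin n → Bool) λ A →
    Chain (suc l) A × (∀ t → t < suc l → Narrow G w' (A t)) × Linked G w' (A 0) (A l)
linked-subchain G l zero X ch nar = 0 , z≤n , X , ch , nar ,
  λ Z _ _ → ≤-trans (dim-mono (K′ G (Z !_)) (pow (Z !_)) (λ x m v → proj₁ (m v))) (≤-reflexive (dim-pow (Z !_)))
linked-subchain {n} G l (suc w) X ch nar = cases (anyUpTo? (λ b → ¬? (narrow? b)) (chain-length l w))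
  where
  M = suc l
  Between : ℕ → V n → Set
  Between b Z = X (b * M) ≼ (Z !_) × (Z !_) ≼ X (l + b * M) × Narrow G w (Z !_)
  narrow? : ∀ b → Dec (∃ (Between b))
  narrow? b = anySubset? λ Z → ≼? (X (b * M)) (Z !_) ×-dec (≼? (Z !_) (X (l + b * M)) ×-dec (# (Z !_) ≤? _))
  bound : ∀ {b t} → b < chain-length l w → t < M → t + b * M < chain-length l w * M
  bound {b} {t} b< t< = ≤-trans (+-monoˡ-≤ (b * M) t<) (*-monoˡ-≤ M b<)
  cases : Dec (∃ λ b → b < chain-length l w × ¬ ∃ (Between b)) → _
  cases (yes (b , b< , none)) = suc w , ≤-refl , (λ t → X (t + b * M)) ,
    (λ t t<M → ch (t + b * M) (bound b< t<M)) ,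
    (λ t t<M → nar (t + b * M) (bound b< t<M)) ,
    λ Z p q → ≰⇒> (λ le → none (Z , p , q , le))
  cases (no all-narrow) with linked-subchain G l w Y Y-chain Y-narrow
    where
    pick : ∀ b → Dec (∃ (Between b)) → Fin n → Bool
    pick b (yes (Z , _)) = Z !_
    -- A placeholder, never reached for b below `chain-length l w`.
    pick b (no _)        = X (b * M)
    Y : ℕ → Fin n → Bool
    Y b = pick b (narrow? b)
    Y-between : ∀ b → b < chain-length l w → X (b * M) ≼ Y b × Y b ≼ X (l + b * M) × Narrow G w (Y b)
    Y-between b b< with narrow? b in e
    ... | yes (Z , btw) = btw
    ... | no none = contradiction (b , b< , none) all-narrow
    Y-chain : Chain (chain-length l w) Y
    -- Strictness comes from the step of X between the last set of block b and the first set of the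
    -- next block.
    Y-chain b sb< = ⋦-≼-trans {P = Y b} {X (l + b * M)} {X (suc b * M)} {Y (suc b)}
      (proj₁ (proj₂ (Y-between b (<⇒≤ sb<))))
      (ch (l + b * M) (bound {suc b} {0} sb< (s≤s z≤n)))
      (proj₁ (Y-between (suc b) sb<))
    Y-narrow : ∀ b → b < chain-length l w → Narrow G w (Y b)
    Y-narrow b b< = proj₂ (proj₂ (Y-between b b<))
  ... | w' , w'≤w , rest = w' , m≤n⇒m≤1+n w'≤w , rest

-- For I = J this is cut-rank at least w. In the induction below, a vertex whose constraint has been
-- chosen belongs to just one of I and J, and so is not counted on the right.
Wide : ∀ {n} → Adj n → ℕ → (I J : Fin n → Bool) → Set
Wide G w I J = w + dim (K G I J) ≤ # (λ v → I v ∧ J v)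

wide-cong : ∀ {n} (G : Adj n) {w} {I I' J J'} → I ≗ᵇ I' → J ≗ᵇ J' → Wide G w I J → Wide G w I' J'
wide-cong G {w} {I} {I'} {J} {J'} p q h = ≤-trans
  (+-monoʳ-≤ w (dim-mono (K G I' J') (K G I J) (K-mono G (≗⇒≼ {f = I'} (sym ∘ p)) (≗⇒≼ {f = J'} (sym ∘ q)))))
  (≤-trans h (≤-reflexive (#-cong (λ v → cong₂ _∧_ (p v) (q v)))))

fill : ∀ {n} → (D z I : Fin n → Bool) → Fin n → Bool
fill D z I v = if D v then z v else I v

put : ∀ {n} → Fin n → Bool → (Fin n → Bool) → Fin n → Bool
put u b I v = if is u v then b else I v

drop : ∀ {n} → Fin n → (Fin n → Bool) → Fin n → Bool
drop u D v = D v ∧ not (is u v)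

bool-≡ : ∀ {a b} → not (a xor b) ≡ true → a ≡ b
bool-≡ {true}  {true}  _ = refl
bool-≡ {false} {false} _ = refl

≡ᵇ-sound : ∀ {m n} → (m Data.Nat.≡ᵇ n) ≡ true → m ≡ n
≡ᵇ-sound {m} {n} e = ≡ᵇ⇒≡ m n (subst Data.Bool.T (sym e) _)

at : ∀ {n} (u : Fin n) {D : Fin n → Bool} → D u ≡ true → ∀ v → (is u v ⇒ D v) ≡ true
at u Du v with v ≟ u
... | yes refl = Du
... | no _     = refl

-- If neither constraint at u preserved width w, the two offending subspaces
-- would violate dim K₁ + dim K₂ ≤ dim (K₁ + K₂) + dim (K₁ ∩ K₂).
linking : ∀ {n} (G : Adj n) w (us : List (Fin n)) (D I J : Fin n → Bool) → (∀ v → D v ≡ true → v ∈ˡ us) →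
          (∀ z → Wide G w (fill D z I) (fill D z J)) → ∃ λ a → Wide G w (fill D a I) (fill D (∁ a) J)
linking G w [] D I J cover h = (λ _ → false) , wide-cong G {I = fill D (λ _ → false) I} {J = fill D (λ _ → false) J} (λ _ → refl) (λ v → same v) (h _)
  where
  same : ∀ v → fill D (λ _ → false) J v ≡ fill D (λ _ → true) J v
  same v with D v in e
  ... | false = refl
  ... | true with cover v e
  ...   | ()
linking {n} G w (u ∷ us) D I J cover h with D u in Du
... | false = linking G w us D I J (λ v Dv → case cover v Dv of λ where
                (here refl) → contradiction (trans (sym Dv) Du) λ ()
                (there i)   → i) h
... | true = cases (wide? false) (wide? true)
  where
  open ≤-Reasoning
  D' = drop u D
  -- The choice b = true leaves x_u free and forces (Mx)_u to vanish; b = false does the opposite.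
  I' : Bool → Fin n → Bool
  I' b = put u b I
  J' : Bool → Fin n → Bool
  J' b = put u (not b) J
  D∋u : ∀ v → (is u v ⇒ D v) ≡ true
  D∋u = at u Du
  Good : Bool → V n → Set
  Good b z = Wide G w (fill D' (z !_) (I' b)) (fill D' (z !_) (J' b))
  wide? : ∀ b → Dec (∃ λ z → ¬ Good b z)
  wide? b = anySubset? (λ z → ¬? (_ ≤? _))
  cover' : ∀ v → D' v ≡ true → v ∈ˡ us
  cover' v D'v with cover v (proj₁ (∧-true D'v))
  ... | there i = i
  ... | here refl = contradiction (trans (sym (cong not (is-refl v))) (proj₂ (∧-true {D v} D'v))) λ ()
  recurse : ∀ b → ¬ (∃ λ z → ¬ Good b z) → ∃ λ a → Wide G w (fill D a I) (fill D (∁ a) J)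
  recurse b none with linking G w us D' (I' b) (J' b) cover' (λ z →
      wide-cong G (λ v → cong (λ s → if D' v then s else I' b v) (lookup∘tabulate z v))
                  (λ v → cong (λ s → if D' v then s else J' b v) (lookup∘tabulate z v))
                  (decidable-stable (_ ≤? _) (λ bad → none (tabulate z , bad))))
  ... | a , wide = put u b a ,
    wide-cong G {I = fill D' a (I' b)} {J = fill D' (∁ a) (J' b)}
      (λ v → bool-≡ (mp (taut 5 (λ s d a b i → (s ⇒ d) ⇒ not ((if d ∧ not s then a else (if s then b else i)) xor (if d then (if s then b else a) else i)))
                           refl (is u v) (D v) (a v) b (I v)) (D∋u v)))
      (λ v → bool-≡ (mp (taut 5 (λ s d a b j → (s ⇒ d) ⇒ not ((if d ∧ not s then not a else (if s then not b else j)) xor (if d then not (if s then b else a) else j)))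
                           refl (is u v) (D v) (a v) b (J v)) (D∋u v)))
      wide
  cases : Dec (∃ λ z → ¬ Good false z) → Dec (∃ λ z → ¬ Good true z) → ∃ λ a → Wide G w (fill D a I) (fill D (∁ a) J)
  cases (no none) _ = recurse false none
  cases (yes _) (no none) = recurse true none
  -- The two failures together lose two, whereas uncrossing gains only one: u is counted in `inn∪`,
  -- but not in `inn₁`, `inn₂` or `inn∩`.
  cases (yes (z₁ , bad₁)) (yes (z₂ , bad₂)) = contradiction (begin
    suc (suc (c₁ + c₂))                                    ≡⟨ lem₁ c₁ c₂ ⟩
    suc c₁ + suc c₂                                        ≤⟨ +-mono-≤ (≰⇒> bad₁) (≰⇒> bad₂) ⟩
    (w + dim K₁) + (w + dim K₂)                            ≡⟨ lem₂ w (dim K₁) (dim K₂) ⟩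
    (w + w) + (dim K₂ + dim K₁)                            ≡⟨ cong ((w + w) +_) (sym (dim-⊔⊓ K₁ K₂)) ⟩
    (w + w) + (dim (K₁ ⊓ K₂) + dim (K₁ ⊔ K₂))              ≤⟨ +-monoʳ-≤ (w + w) (+-mono-≤ (dim-mono (K₁ ⊓ K₂) K∩ meet) (dim-mono (K₁ ⊔ K₂) K∪ join)) ⟩
    (w + w) + (dim K∩ + dim K∪)                            ≡⟨ lem₃ w (dim K∩) (dim K∪) ⟩
    (w + dim K∩) + (w + dim K∪)                            ≤⟨ +-mono-≤ (h z∩) (h z∪) ⟩
    # inn∩ + # inn∪                                        ≡⟨ cong (# inn∩ +_) (sym (#-⊎ {f = k} {g = is u} count-u)) ⟩
    # inn∩ + (# k + # (is u))                              ≡⟨ sym (+-assoc (# inn∩) (# k) _) ⟩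
    (# inn∩ + # k) + # (is u)                              ≡⟨ cong₂ _+_ (sym (#-balance {h = inn∩} {k} count)) (#-is u) ⟩
    (c₁ + c₂) + 1                                          ≡⟨ +-comm (c₁ + c₂) 1 ⟩
    suc (c₁ + c₂)                                          ∎) (<-irrefl refl)
    where
    I₁ = fill D' (z₁ !_) (I' false)
    J₁ = fill D' (z₁ !_) (J' false)
    I₂ = fill D' (z₂ !_) (I' true)
    J₂ = fill D' (z₂ !_) (J' true)
    K₁ = K G I₁ J₁
    K₂ = K G I₂ J₂
    -- At u the two pairs made opposite choices, so u is outside both intersections and inside both
    -- unions. The uncrossed pairs thus make no choice at u and fall under the hypothesis `h`.
    z∩ = put u false (λ v → z₁ ! v ∧ z₂ ! v)
    z∪ = put u true (λ v → z₁ ! v ∨ z₂ ! v)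
    K∩ = K G (fill D z∩ I) (fill D z∩ J)
    K∪ = K G (fill D z∪ I) (fill D z∪ J)
    inn₁ = λ v → I₁ v ∧ J₁ v
    inn₂ = λ v → I₂ v ∧ J₂ v
    inn∩ = λ v → fill D z∩ I v ∧ fill D z∩ J v
    inn∪ = λ v → fill D z∪ I v ∧ fill D z∪ J v
    k = λ v → inn∪ v ∧ not (is u v)
    c₁ = # inn₁
    c₂ = # inn₂
    lem₁ : ∀ a b → suc (suc (a + b)) ≡ suc a + suc b
    lem₁ = solve-∀
    lem₂ : ∀ w a b → (w + a) + (w + b) ≡ (w + w) + (b + a)
    lem₂ = solve-∀
    lem₃ : ∀ w a b → (w + w) + (a + b) ≡ (w + a) + (w + b)
    lem₃ = solve-∀
    meet : K₁ ⊓ K₂ ⊑ K∩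
    meet x (m₁ , m₂) = K-mono G {λ v → I₁ v ∧ I₂ v} {λ v → J₁ v ∧ J₂ v} {fill D z∩ I} {fill D z∩ J}
      (λ v → mp (taut 5 (λ s d p q i → (s ⇒ d) ⇒ ((if d ∧ not s then p else (if s then false else i)) ∧ (if d ∧ not s then q else (if s then true else i)))
                    ⇒ (if d then (if s then false else p ∧ q) else i)) refl (is u v) (D v) (z₁ ! v) (z₂ ! v) (I v)) (D∋u v))
      (λ v → mp (taut 5 (λ s d p q i → (s ⇒ d) ⇒ ((if d ∧ not s then p else (if s then true else i)) ∧ (if d ∧ not s then q else (if s then false else i)))
                    ⇒ (if d then (if s then false else p ∧ q) else i)) refl (is u v) (D v) (z₁ ! v) (z₂ ! v) (J v)) (D∋u v))
      x (K-∩ G {I₁} {J₁} {I₂} {J₂} {x} m₁ m₂)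
    up₁ : K₁ ⊑ K∪
    up₁ = K-mono G {I₁} {J₁} {fill D z∪ I} {fill D z∪ J}
      (λ v → mp (taut 5 (λ s d p q i → (s ⇒ d) ⇒ (if d ∧ not s then p else (if s then false else i))
                    ⇒ (if d then (if s then true else p ∨ q) else i)) refl (is u v) (D v) (z₁ ! v) (z₂ ! v) (I v)) (D∋u v))
      (λ v → mp (taut 5 (λ s d p q i → (s ⇒ d) ⇒ (if d ∧ not s then p else (if s then true else i))
                    ⇒ (if d then (if s then true else p ∨ q) else i)) refl (is u v) (D v) (z₁ ! v) (z₂ ! v) (J v)) (D∋u v))
    up₂ : K₂ ⊑ K∪
    up₂ = K-mono G {I₂} {J₂} {fill D z∪ I} {fill D z∪ J}
      (λ v → mp (taut 5 (λ s d p q i → (s ⇒ d) ⇒ (if d ∧ not s then q else (if s then true else i))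
                    ⇒ (if d then (if s then true else p ∨ q) else i)) refl (is u v) (D v) (z₁ ! v) (z₂ ! v) (I v)) (D∋u v))
      (λ v → mp (taut 5 (λ s d p q i → (s ⇒ d) ⇒ (if d ∧ not s then q else (if s then false else i))
                    ⇒ (if d then (if s then true else p ∨ q) else i)) refl (is u v) (D v) (z₁ ! v) (z₂ ! v) (J v)) (D∋u v))
    join : K₁ ⊔ K₂ ⊑ K∪
    join x (y , m₁ , m₂) = ⊕-cancelʳ-∈ K∪ {x} {y} (up₂ (x ⊕ y) m₂) (up₁ y m₁)
    count-u : ∀ v → b2n (k v) + b2n (is u v) ≡ b2n (inn∪ v)
    count-u v = ≡ᵇ-sound (mp (taut 6 (λ s d p q i j → (s ⇒ d) ⇒
      (b2n (((if d then (if s then true else p ∨ q) else i) ∧ (if d then (if s then true else p ∨ q) else j)) ∧ not s) + b2n s)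
      Data.Nat.≡ᵇ b2n ((if d then (if s then true else p ∨ q) else i) ∧ (if d then (if s then true else p ∨ q) else j)))
      refl (is u v) (D v) (z₁ ! v) (z₂ ! v) (I v) (J v)) (D∋u v))
    count : ∀ v → b2n (inn₁ v) + b2n (inn₂ v) ≡ b2n (inn∩ v) + b2n (k v)
    count v = ≡ᵇ-sound (mp (taut 6 (λ s d p q i j → (s ⇒ d) ⇒
      (b2n ((if d ∧ not s then p else (if s then false else i)) ∧ (if d ∧ not s then p else (if s then true else j))) +
       b2n ((if d ∧ not s then q else (if s then true else i)) ∧ (if d ∧ not s then q else (if s then false else j))))
      Data.Nat.≡ᵇ
      (b2n ((if d then (if s then false else p ∧ q) else i) ∧ (if d then (if s then false else p ∧ q) else j)) +
       b2n (((if d then (if s then true else p ∨ q) else i) ∧ (if d then (if s then true else p ∨ q) else j)) ∧ not s)))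
      refl (is u v) (D v) (z₁ ! v) (z₂ ! v) (I v) (J v)) (D∋u v))

-- With I = J = P and D the part of Q outside P, the fillings of P by all z are exactly the sets
-- between P and Q, so `linking` starts from `Linked`.
link : ∀ {n} (G : Adj n) w (P Q : Fin n → Bool) → P ≼ Q → Linked G w P Q → ∃ λ a → w + dim (Link G a P Q) ≤ # P
link {n} G w P Q P≼Q linked with linking G w (allFin n) D P P (λ v _ → ∈-allFin v) between
  where
  D : Fin n → Bool
  D v = Q v ∧ not (P v)
  between : ∀ z → Wide G w (fill D z P) (fill D z P)
  between z = wide-cong G {I = Z !_} {J = Z !_} Z! Z!
    (≤-trans (linked Z (λ v → subst (λ b → (P v ⇒ b) ≡ true) (sym (Z! v))
         (mp (taut 3 (λ p q z → (p ⇒ q) ⇒ p ⇒ (if q ∧ not p then z else p)) refl (P v) (Q v) (z v)) (P≼Q v)))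
      (λ v → subst (λ b → (b ⇒ Q v) ≡ true) (sym (Z! v))
         (mp (taut 3 (λ p q z → (p ⇒ q) ⇒ (if q ∧ not p then z else p) ⇒ q) refl (P v) (Q v) (z v)) (P≼Q v))))
      (≤-reflexive (#-cong (λ v → sym (∧-idem (Z ! v))))))
    where
    Z = tabulate (fill D z P)
    Z! : ∀ v → Z ! v ≡ fill D z P v
    Z! v = lookup∘tabulate _ v
... | a , wide = a , ≤-trans
  (wide-cong G {I' = link∈ a P Q} {J' = link∋ a P Q}
    (λ v → bool-≡ (taut 3 (λ p q a → not ((if q ∧ not p then a else p) xor (p ∨ (q ∧ a)))) refl (P v) (Q v) (a v)))
    (λ v → bool-≡ (taut 3 (λ p q a → not ((if q ∧ not p then not a else p) xor (p ∨ (q ∧ not a)))) refl (P v) (Q v) (a v)))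
    wide)
  (≤-reflexive (#-cong λ v → bool-≡ (taut 3 (λ p q a → not (((p ∨ (q ∧ a)) ∧ (p ∨ (q ∧ not a))) xor p)) refl (P v) (Q v) (a v))))

-- The signal space of a linked chain

K-meet : ∀ {n} (G : Adj n) I J I' J' {I'' J''} x → Mem (K G I J) x → Mem (K G I' J') x →
         (∀ v → (I v ∧ I' v ⇒ I'' v) ≡ true) → (∀ v → (J v ∧ J' v ⇒ J'' v) ≡ true) → Mem (K G I'' J'') x
K-meet G I J I' J' {I''} {J''} x m m' p q =
  K-mono G {λ v → I v ∧ I' v} {λ v → J v ∧ J' v} {I''} {J''} p q x (K-∩ G {I} {J} {I'} {J'} {x} m m')

⊕-cancelˡ-∈ : ∀ {n} (U : Sub n) {x y} → Mem U (x ⊕ y) → Mem U x → Mem U y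
⊕-cancelˡ-∈ U {x} {y} p q = ⊕-cancelʳ-∈ U {y} {x} (subst (Mem U) (⊕-comm x y) p) q

K′⊑Link : ∀ {n} (G : Adj n) a P Q → K′ G P ⊑ Link G a P Q
K′⊑Link G a P Q = K-mono G {P} {P} {link∈ a P Q} {link∋ a P Q}
  (λ v → taut 3 (λ p q a → p ⇒ (p ∨ (q ∧ a))) refl (P v) (Q v) (a v))
  (λ v → taut 3 (λ p q a → p ⇒ (p ∨ (q ∧ not a))) refl (P v) (Q v) (a v))

all : ∀ {n} → Fin n → Bool
all _ = true

dim-sum : ∀ {n} (U W : Sub n) → (∀ x → Mem U x → Mem W x → x ≡ 0v) → dim (U ⊔ W) ≡ dim U + dim W
dim-sum U W h = trans (cong (_+ dim (U ⊔ W)) (sym (dim-zero (U ⊓ W) (λ x (p , q) → h x p q))))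
  (trans (dim-⊔⊓ U W) (+-comm (dim W) (dim U)))

dim-sum-≤ : ∀ {n} (U W : Sub n) → dim (U ⊔ W) ≤ dim U + dim W
dim-sum-≤ U W = ≤-trans (m≤n+m _ (dim (U ⊓ W))) (≤-reflexive (trans (dim-⊔⊓ U W) (+-comm (dim W) (dim U))))

-- A chain A 0 ⊆ … ⊆ A l of sets of cut-rank w, with a choice a of coordinates
-- on A l ∖ A 0 that links A 0 to the complement of A l.
module Family {n} (G : Adj n) (G-sym : ∀ u v → G u v ≡ G v u) (l w : ℕ) (A : ℕ → Fin n → Bool)
              (mono : ∀ {i j} → i ≤ j → j ≤ l → A i ≼ A j)
              (narrow : ∀ {i} → i ≤ l → Narrow G w (A i))
              (a : Fin n → Bool) (linked : w + dim (Link G a (A 0) (A l)) ≤ # (A 0)) where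
  open ≤-Reasoning

  C : ℕ → Fin n → Bool
  C j = ∁ (A j)

  -- The linkage of the outermost pair passes to all inner pairs: imposing the constraints on A i
  -- outside A 0 costs one dimension per vertex and leads into the space for 0 and l.
  link-dim : ∀ {i j} → i ≤ j → j ≤ l → w + dim (Link G a (A i) (A j)) ≤ # (A i)
  link-dim {i} {j} i≤j j≤l = begin
    w + dim (Link G a (A i) (A j))                        ≤⟨ +-monoʳ-≤ w (codim G a Y _ (Link G a (A 0) (A l)) mem) ⟩
    w + (dim (Link G a (A 0) (A l)) + # Y)                ≡⟨ sym (+-assoc w _ _) ⟩
    w + dim (Link G a (A 0) (A l)) + # Y                  ≤⟨ +-monoˡ-≤ (# Y) linked ⟩
    # (A 0) + # Y                                         ≡⟨ #-⊎ {f = A 0} {Y} (λ v → ≡ᵇ-sound (mp (taut 2 (λ p q → (p ⇒ q) ⇒ (b2n p + b2n (q ∧ not p)) Data.Nat.≡ᵇ b2n q) refl (A 0 v) (A i v)) (mono z≤n (≤-trans i≤j j≤l) v))) ⟩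
    # (A i)                                               ∎
    where
    Y : Fin n → Bool
    Y v = A i v ∧ not (A 0 v)
    mem : ∀ x → Mem (Link G a (A i) (A j)) x → (∀ v → Y v ≡ true → coord G a x v ≡ false) → Mem (Link G a (A 0) (A l)) x
    mem x m c v with A 0 v | A i v | A j v | A l v | m v | c v | mono (≤-trans i≤j j≤l) ≤-refl v | mono j≤l ≤-refl v
    ... | true  | _     | _     | _     | _ | _ | _  | _ = (λ ()) , λ ()
    ... | false | false | false | _     | m' | _ | _ | _ = (λ _ → proj₁ m' refl) , λ _ → proj₂ m' refl
    ... | false | false | true  | true  | m' | _ | _ | _ = m'
    ... | false | true  | _     | true  | _ | c' | _ | _ with a v | c' refl
    ...   | true  | q = (λ ()) , λ _ → q
    ...   | false | q = (λ _ → q) , λ ()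

  -- Both spaces have dimension `# (A i)` minus w. Hence a vector that meets the constraints between
  -- A i and A j, and vanishes with its image outside A j, already vanishes with its image outside A
  -- i.
  link⊑ : ∀ {i j} → i ≤ j → j ≤ l → Link G a (A i) (A j) ⊑ K′ G (A i)
  link⊑ {i} {j} i≤j j≤l = dim-⊑-≡ (K′ G (A i)) (Link G a (A i) (A j))
    (K′⊑Link G a (A i) (A j))
    (+-cancelˡ-≤ w _ _ (≤-trans (link-dim i≤j j≤l) (narrow (≤-trans i≤j j≤l))))

  narrowᶜ : ∀ {j} → j ≤ l → Narrow G w (C j)
  narrowᶜ {j} j≤l = +-cancelˡ-≤ (dim (K′ G (A j))) _ _ (begin
    dim (K′ G (A j)) + # (C j)                ≡⟨ sym (duality G G-sym (A j) (A j)) ⟩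
    # (A j) + dim (K′ G (C j))                ≤⟨ +-monoˡ-≤ _ (narrow j≤l) ⟩
    (w + dim (K′ G (A j))) + dim (K′ G (C j)) ≡⟨ lem w _ _ ⟩
    dim (K′ G (A j)) + (w + dim (K′ G (C j))) ∎)
    where
    lem : ∀ a b c → (a + b) + c ≡ b + (a + c)
    lem = solve-∀

  -- The linkage seen from the other side. Complementing and interchanging the two sets of `Link`
  -- for A i and A j gives those for C j and C i with the same a, so `duality` applies.
  link-dimᶜ : ∀ {i j} → i ≤ j → j ≤ l → w + dim (Link G a (C j) (C i)) ≤ # (C j)
  link-dimᶜ {i} {j} i≤j j≤l = +-cancelʳ-≤ (# I) _ _ (begin
    (w + dim (Link G a (C j) (C i))) + # I       ≤⟨ +-monoˡ-≤ (# I) (+-monoʳ-≤ w (dim-mono (Link G a (C j) (C i)) (K G (∁ J) (∁ I))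
        (K-mono G {link∈ a (C j) (C i)} {link∋ a (C j) (C i)} {∁ J} {∁ I}
          (λ v → mp (taut 3 (λ p q a → (p ⇒ q) ⇒ (not q ∨ (not p ∧ a)) ⇒ not (p ∨ (q ∧ not a))) refl (A i v) (A j v) (a v)) (mono i≤j j≤l v))
          (λ v → mp (taut 3 (λ p q a → (p ⇒ q) ⇒ (not q ∨ (not p ∧ not a)) ⇒ not (p ∨ (q ∧ a))) refl (A i v) (A j v) (a v)) (mono i≤j j≤l v))))) ⟩
    (w + dim (K G (∁ J) (∁ I))) + # I            ≡⟨ lem₁ w _ _ ⟩
    w + (# I + dim (K G (∁ J) (∁ I)))            ≡⟨ cong (w +_) (duality G G-sym I J) ⟩
    w + (dim (K G I J) + # (∁ J))                ≡⟨ sym (+-assoc w _ _) ⟩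
    (w + dim (K G I J)) + # (∁ J)                ≤⟨ +-monoˡ-≤ (# (∁ J)) (link-dim i≤j j≤l) ⟩
    # (A i) + # (∁ J)                            ≡⟨ #-balance {f = A i} {∁ J} {C j} {I} (λ v → ≡ᵇ-sound (mp (taut 3 (λ p q a → (p ⇒ q) ⇒
        (b2n p + b2n (not (p ∨ (q ∧ not a)))) Data.Nat.≡ᵇ (b2n (not q) + b2n (p ∨ (q ∧ a)))) refl (A i v) (A j v) (a v)) (mono i≤j j≤l v))) ⟩
    # (C j) + # I                                ∎)
    where
    I = link∈ a (A i) (A j)
    J = link∋ a (A i) (A j)
    lem₁ : ∀ a b c → (a + b) + c ≡ a + (c + b)
    lem₁ = solve-∀

  link⊑ᶜ : ∀ {i j} → i ≤ j → j ≤ l → Link G a (C j) (C i) ⊑ K′ G (C j)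
  link⊑ᶜ {i} {j} i≤j j≤l = dim-⊑-≡ (K′ G (C j)) (Link G a (C j) (C i))
    (K′⊑Link G a (C j) (C i))
    (+-cancelˡ-≤ w _ _ (≤-trans (link-dimᶜ i≤j j≤l) (narrowᶜ j≤l)))

  disjoint : ∀ (P Q : Fin n → Bool) → (∀ v → (P v ⇒ not (Q v)) ≡ true) → ∀ x → Mem (K′ G P) x → Mem (K′ G Q) x → x ≡ 0v
  disjoint P Q h x p q = ext λ v → trans (zero-at v) (sym (!-0v v))
    where
    zero-at : ∀ v → x ! v ≡ false
    zero-at v with P v | Q v | h v | proj₁ (p v) | proj₁ (q v)
    ... | false | _     | _ | p' | _ = p' refl
    ... | true  | false | _ | _  | q' = q' refl

  sum : ℕ → ℕ → Sub n
  sum i j = K′ G (A i) ⊔ K′ G (C j)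

  glued : ℕ → ℕ → Fin n → Bool
  glued i j v = A i v ∨ C j v

  -- Only the constraints between A i and A j are imposed. Modulo `sum i j` there remain 2w
  -- dimensions: the space has dimension |A i| + |C j|, and the summands have dimensions |A i| - w
  -- and |C j| - w.
  Signals : ℕ → ℕ → Sub n
  Signals i j = Link G a (glued i j) all

  private
    left⊑ : ∀ i j → K′ G (A i) ⊑ Signals i j
    left⊑ i j = K-mono G {A i} {A i} {link∈ a (glued i j) all} {link∋ a (glued i j) all}
      (λ v → taut 3 (λ p q a → p ⇒ (p ∨ q) ∨ a) refl (A i v) (C j v) (a v))
      (λ v → taut 3 (λ p q a → p ⇒ (p ∨ q) ∨ not a) refl (A i v) (C j v) (a v))
    right⊑ : ∀ i j → K′ G (C j) ⊑ Signals i j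
    right⊑ i j = K-mono G {C j} {C j} {link∈ a (glued i j) all} {link∋ a (glued i j) all}
      (λ v → taut 3 (λ p q a → q ⇒ (p ∨ q) ∨ a) refl (A i v) (C j v) (a v))
      (λ v → taut 3 (λ p q a → q ⇒ (p ∨ q) ∨ not a) refl (A i v) (C j v) (a v))
    sum⊑ : ∀ i j → sum i j ⊑ Signals i j
    sum⊑ i j x (y , p , q) = ⊕-cancelʳ-∈ (Signals i j) {x} {y} (right⊑ i j (x ⊕ y) q) (left⊑ i j y p)
    Signals⊑ : ∀ {i j} → i ≤ j → j ≤ l → Signals 0 l ⊑ Signals i j
    Signals⊑ {i} {j} i≤j j≤l = K-mono G {link∈ a (glued 0 l) all} {link∋ a (glued 0 l) all} {link∈ a (glued i j) all} {link∋ a (glued i j) all}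
      (λ v → mp (mp (taut 5 (λ o i j l a → (o ⇒ i) ⇒ (j ⇒ l) ⇒ ((o ∨ not l) ∨ a) ⇒ ((i ∨ not j) ∨ a)) refl (A 0 v) (A i v) (A j v) (A l v) (a v))
                    (mono z≤n (≤-trans i≤j j≤l) v)) (mono j≤l ≤-refl v))
      (λ v → mp (mp (taut 5 (λ o i j l a → (o ⇒ i) ⇒ (j ⇒ l) ⇒ ((o ∨ not l) ∨ not a) ⇒ ((i ∨ not j) ∨ not a)) refl (A 0 v) (A i v) (A j v) (A l v) (a v))
                    (mono z≤n (≤-trans i≤j j≤l) v)) (mono j≤l ≤-refl v))
    room : dim (sum 0 l) + (w + w) ≤ dim (Signals 0 l)
    room = +-cancelʳ-≤ (# Y) _ _ (begin
      (dim (sum 0 l) + (w + w)) + # Y                            ≤⟨ +-monoˡ-≤ (# Y) (+-monoˡ-≤ (w + w) (dim-sum-≤ (K′ G (A 0)) (K′ G (C l)))) ⟩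
      ((dim (K′ G (A 0)) + dim (K′ G (C l))) + (w + w)) + # Y    ≡⟨ lem (dim (K′ G (A 0))) _ w _ ⟩
      ((w + dim (K′ G (A 0))) + (w + dim (K′ G (C l)))) + # Y    ≤⟨ +-monoˡ-≤ (# Y) (+-mono-≤
          (≤-trans (+-monoʳ-≤ w (dim-mono (K′ G (A 0)) (Link G a (A 0) (A l)) (K′⊑Link G a (A 0) (A l)))) linked)
          (≤-trans (+-monoʳ-≤ w (dim-mono (K′ G (C l)) (Link G a (C l) (C 0)) (K′⊑Link G a (C l) (C 0)))) (link-dimᶜ z≤n ≤-refl))) ⟩
      (# (A 0) + # (C l)) + # Y                                  ≡⟨ trans (cong (_+ # Y) (#-⊎ {f = A 0} {C l} {glued 0 l} (λ v → ≡ᵇ-sound (mp (taut 2 (λ p q → (p ⇒ q) ⇒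
                                                                      (b2n p + b2n (not q)) Data.Nat.≡ᵇ b2n (p ∨ not q)) refl (A 0 v) (A l v)) (mono z≤n ≤-refl v)))))
                                                                   (#-⊎ {f = glued 0 l} {Y} {all} (λ v → ≡ᵇ-sound (taut 2 (λ p q → (b2n (p ∨ not q) + b2n (q ∧ not p)) Data.Nat.≡ᵇ 1) refl (A 0 v) (A l v)))) ⟩
      # {n} all                                                  ≡⟨ trans (#-all {n}) (sym (dim-whole n)) ⟩
      dim (whole n)                                              ≤⟨ codim G a Y (whole n) (Signals 0 l) mem ⟩
      dim (Signals 0 l) + # Y                                    ∎)
      where
      Y : Fin n → Bool
      Y v = A l v ∧ not (A 0 v)
      lem : ∀ x y w z → ((x + y) + (w + w)) + z ≡ ((w + x) + (w + y)) + z
      lem = solve-∀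
      mem : ∀ x → Mem (whole n) x → (∀ v → Y v ≡ true → coord G a x v ≡ false) → Mem (Signals 0 l) x
      mem x _ c v with A 0 v | A l v | c v
      ... | true  | _     | _ = (λ ()) , λ ()
      ... | false | false | _ = (λ ()) , λ ()
      ... | false | true  | c' with a v | c' refl
      ...   | true  | q = (λ ()) , λ _ → q
      ...   | false | q = (λ _ → q) , λ ()

  abstract
    basis : Σ (Lin (w + w) n) λ q → (∀ c → Mem (Signals 0 l) (app q c)) × (∀ c → Mem (sum 0 l) (app q c) → c ≡ 0v)
    basis = complement (w + w) (sum 0 l) (Signals 0 l) (sum⊑ 0 l) room

  -- Coordinates for the space of signals modulo K′ (A i) + K′ (C j), for all i ≤ j at once.
  q : Lin (w + w) n
  q = proj₁ basis

  q∈ : ∀ {i j} → i ≤ j → j ≤ l → ∀ c → Mem (Signals i j) (app q c)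
  q∈ i≤j j≤l c = Signals⊑ i≤j j≤l (app q c) (proj₁ (proj₂ basis) c)

  -- Let a signal x be y + z with y on the side A i and z on the side C j. On A j the vector z and
  -- its image vanish, so y inherits the constraints that x satisfies there, and `link⊑` moves y
  -- into the space of A 0. Likewise z moves into that of C l, and the independence for 0 and l
  -- applies.
  q-indep : ∀ {i j} → i ≤ j → j ≤ l → ∀ c → Mem (sum i j) (app q c) → c ≡ 0v
  q-indep {i} {j} i≤j j≤l c (y , y∈ , z∈) = proj₂ (proj₂ basis) c (y , link⊑ z≤n ≤-refl y y∈link , link⊑ᶜ z≤n ≤-refl z z∈link)
    where
    x = app q c
    z = x ⊕ y
    E∈ = link∈ a (glued 0 l) all
    E∋ = link∋ a (glued 0 l) all
    x∈E : Mem (K G E∈ E∋) x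
    x∈E = proj₁ (proj₂ basis) c
    BI BJ BI' BJ' : Fin n → Bool
    BI  v = E∈ v ∨ C j v
    BJ  v = E∋ v ∨ C j v
    BI' v = E∈ v ∨ A i v
    BJ' v = E∋ v ∨ A i v
    ∨ˡ : ∀ (f g : Fin n → Bool) v → (f v ⇒ f v ∨ g v) ≡ true
    ∨ˡ f g v = taut 2 (λ p q → p ⇒ p ∨ q) refl (f v) (g v)
    ∨ʳ : ∀ (f g : Fin n → Bool) v → (g v ⇒ f v ∨ g v) ≡ true
    ∨ʳ f g v = taut 2 (λ p q → q ⇒ p ∨ q) refl (f v) (g v)
    y∈B : Mem (K G BI BJ) y
    y∈B = ⊕-cancelˡ-∈ (K G BI BJ) {x} {y} (K-mono G {C j} {C j} {BI} {BJ} (∨ʳ E∈ (C j)) (∨ʳ E∋ (C j)) z z∈)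
                                           (K-mono G {E∈} {E∋} {BI} {BJ} (∨ˡ E∈ (C j)) (∨ˡ E∋ (C j)) x x∈E)
    z∈B : Mem (K G BI' BJ') z
    z∈B = ⊕∈ (K G BI' BJ') {x} {y} (K-mono G {E∈} {E∋} {BI'} {BJ'} (∨ˡ E∈ (A i)) (∨ˡ E∋ (A i)) x x∈E)
                                    (K-mono G {A i} {A i} {BI'} {BJ'} (∨ʳ E∈ (A i)) (∨ʳ E∋ (A i)) y y∈)
    y∈link : Mem (Link G a (A 0) (A l)) y
    y∈link = K-meet G BI BJ (A i) (A i) {link∈ a (A 0) (A l)} {link∋ a (A 0) (A l)} y y∈B y∈
      (λ v → mp (mp (taut 5 (λ o i j l a → (i ⇒ j) ⇒ (j ⇒ l) ⇒ (((o ∨ not l) ∨ a) ∨ not j) ∧ i ⇒ o ∨ (l ∧ a)) refl (A 0 v) (A i v) (A j v) (A l v) (a v))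
         (mono i≤j j≤l v)) (mono j≤l ≤-refl v))
      (λ v → mp (mp (taut 5 (λ o i j l a → (i ⇒ j) ⇒ (j ⇒ l) ⇒ (((o ∨ not l) ∨ not a) ∨ not j) ∧ i ⇒ o ∨ (l ∧ not a)) refl (A 0 v) (A i v) (A j v) (A l v) (a v))
         (mono i≤j j≤l v)) (mono j≤l ≤-refl v))
    z∈link : Mem (Link G a (C l) (C 0)) z
    z∈link = K-meet G BI' BJ' (C j) (C j) {link∈ a (C l) (C 0)} {link∋ a (C l) (C 0)} z z∈B z∈
      (λ v → mp (mp (taut 5 (λ o i j l a → (o ⇒ i) ⇒ (i ⇒ j) ⇒ (((o ∨ not l) ∨ a) ∨ i) ∧ not j ⇒ not l ∨ (not o ∧ a)) refl (A 0 v) (A i v) (A j v) (A l v) (a v))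
         (mono z≤n (≤-trans i≤j j≤l) v)) (mono i≤j j≤l v))
      (λ v → mp (mp (taut 5 (λ o i j l a → (o ⇒ i) ⇒ (i ⇒ j) ⇒ (((o ∨ not l) ∨ not a) ∨ i) ∧ not j ⇒ not l ∨ (not o ∧ not a)) refl (A 0 v) (A i v) (A j v) (A l v) (a v))
         (mono z≤n (≤-trans i≤j j≤l) v)) (mono i≤j j≤l v))

  private
    shift : ∀ (U : Sub n) {x x'} c c' → Mem U (x ⊕ app q c) → Mem U (x' ⊕ app q c') → Mem U ((x ⊕ x') ⊕ app q (c ⊕ c'))
    shift U {x} {x'} c c' p p' = subst (Mem U)
      (trans (⊕-interchange x _ x' _) (cong ((x ⊕ x') ⊕_) (sym (lin q c c')))) (⊕∈ U p p')

    q0 : ∀ (U : Sub n) {x} → Mem U x → Mem U (x ⊕ app q 0v)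
    q0 U {x} p = subst (Mem U) (sym (trans (cong (x ⊕_) (lin-0 q)) (⊕-0ʳ x))) p

    q0⁻ : ∀ (U : Sub n) {x} → Mem U (x ⊕ app q 0v) → Mem U x
    q0⁻ U {x} p = subst (Mem U) (trans (cong (x ⊕_) (lin-0 q)) (⊕-0ʳ x)) p

  over : (M U : Sub n) → LinRel (w + w) n
  over M U .Rel c x  = Mem M x × Mem U (x ⊕ app q c)
  over M U .rdec c x = dec M x ×-dec dec U _
  over M U .0R = 0∈ M , q0 U (0∈ U)
  over M U .⊕R {c} {x} {c'} {x'} (m , p) (m' , p') = ⊕∈ M m m' , shift U {x} {x'} c c' p p'

  -- By counting: the sum together with 2w independent signals has dimension at least |A i| + |C j|.
  -- The space `Signals i j` is no larger by `duality`, whose dual term is zero: by `link⊑` its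
  -- vectors are supported in A i, yet they vanish on A i.
  decompose : ∀ {i j} → i ≤ j → j ≤ l → Signals i j ⊑ ran (over (whole n) (sum i j))
  decompose {i} {j} i≤j j≤l = dim-⊑-≡ (ran R) E ran⊑ (begin
    dim E                                                       ≤⟨ dimE ⟩
    # (A i) + # (C j)                                           ≤⟨ +-mono-≤ (narrow (≤-trans i≤j j≤l)) (narrowᶜ j≤l) ⟩
    (w + dim (K′ G (A i))) + (w + dim (K′ G (C j)))             ≡⟨ lem w _ _ ⟩
    (dim (K′ G (A i)) + dim (K′ G (C j))) + (w + w)             ≡⟨ cong₂ _+_ (sym (dim-sum (K′ G (A i)) (K′ G (C j)) (disjoint (A i) (C j) λ v →
                                                                     mp (taut 2 (λ p q → (p ⇒ q) ⇒ p ⇒ not (not q)) refl (A i v) (A j v)) (mono i≤j j≤l v))))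
                                                                   (sym (dim-whole (w + w))) ⟩
    dim (sum i j) + dim (whole (w + w))                         ≤⟨ +-mono-≤ (dim-mono (sum i j) (indet R) (λ x p → refl , q0 (sum i j) {x} p))
                                                                     (dim-mono (whole (w + w)) (dom R) (λ c _ → app q c , refl , subst (Mem (sum i j)) (sym (⊕-self (app q c))) (0∈ (sum i j)))) ⟩
    dim (indet R) + dim (dom R)                                 ≡⟨ dim-rel R ⟩
    dim (ker R) + dim (ran R)                                   ≡⟨ cong (_+ dim (ran R)) (dim-zero (ker R) (λ c (_ , p) → q-indep i≤j j≤l c (subst (Mem (sum i j)) (⊕-0ˡ (app q c)) p))) ⟩
    dim (ran R)                                                 ∎)
    where
    R = over (whole n) (sum i j)
    E = Signals i j
    I = link∈ a (glued i j) all
    J = link∋ a (glued i j) all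
    lem : ∀ w x y → (w + x) + (w + y) ≡ (x + y) + (w + w)
    lem = solve-∀
    ran⊑ : ran R ⊑ E
    ran⊑ x (c , _ , p) = ⊕-cancelʳ-∈ E {x} {app q c} (sum⊑ i j (x ⊕ app q c) p) (q∈ i≤j j≤l c)
    rigid : ∀ x → Mem (K G (∁ J) (∁ I)) x → x ≡ 0v
    rigid x m = ext λ v → trans (zero-at v) (sym (!-0v v))
      where
      x∈ : Mem (K′ G (A i)) x
      x∈ = link⊑ i≤j j≤l x (K-mono G {∁ J} {∁ I} {link∈ a (A i) (A j)} {link∋ a (A i) (A j)}
        (λ v → taut 3 (λ p q a → not ((p ∨ not q) ∨ not a) ⇒ (p ∨ (q ∧ a))) refl (A i v) (A j v) (a v))
        (λ v → taut 3 (λ p q a → not ((p ∨ not q) ∨ a) ⇒ (p ∨ (q ∧ not a))) refl (A i v) (A j v) (a v)) x m)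
      zero-at : ∀ v → x ! v ≡ false
      zero-at v with A i v | proj₁ (x∈ v) | proj₁ (m v)
      ... | true  | _ | z = z refl
      ... | false | z | _ = z refl
    dimE : dim E ≤ # (A i) + # (C j)
    dimE = +-cancelʳ-≤ (# (∁ J)) _ _ (begin
      dim E + # (∁ J)                            ≡⟨ sym (duality G G-sym I J) ⟩
      # I + dim (K G (∁ J) (∁ I))                ≡⟨ trans (cong (# I +_) (dim-zero (K G (∁ J) (∁ I)) rigid)) (+-identityʳ _) ⟩
      # I                                        ≡⟨ sym (#-⊎ {f = glued i j} {∁ J} {I} (λ v → ≡ᵇ-sound (taut 3 (λ p q a →
                                                      (b2n (p ∨ q) + b2n (not ((p ∨ q) ∨ not a))) Data.Nat.≡ᵇ b2n ((p ∨ q) ∨ a)) refl (A i v) (C j v) (a v)))) ⟩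
      # (glued i j) + # (∁ J)                    ≡⟨ cong (_+ # (∁ J)) (sym (#-⊎ {f = A i} {C j} {glued i j} (λ v → ≡ᵇ-sound (mp (taut 2 (λ p q → (p ⇒ q) ⇒
                                                      (b2n p + b2n (not q)) Data.Nat.≡ᵇ b2n (p ∨ not q)) refl (A i v) (A j v)) (mono i≤j j≤l v))))) ⟩
      # (A i) + # (C j) + # (∁ J)                ∎)

  -- The signals that can be completed to a vector on the side P vanishing on P ∖ S.
  Trace : (P S : Fin n → Bool) → Sub (w + w)
  Trace P S = dom R
    where
    within : Fin n → Bool
    within v = not (P v) ∨ S v
    R : LinRel (w + w) n
    R .Rel c y = Mem (K′ G P) y × Mem (K′ G within) (y ⊕ app q c)
    R .rdec c y = dec (K′ G P) y ×-dec dec (K′ G within) (y ⊕ app q c)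
    R .0R = 0∈ (K′ G P) , q0 (K′ G within) {0v} (0∈ (K′ G within))
    R .⊕R {c} {y} {c'} {y'} (m , p) (m' , p') = ⊕∈ (K′ G P) {y} {y'} m m' ,
      subst (λ z → Mem (K′ G within) z) (trans (⊕-interchange y _ y' _) (cong ((y ⊕ y') ⊕_) (sym (lin q c c')))) (⊕∈ (K′ G within) {y ⊕ app q c} {y' ⊕ app q c'} p p')

  rotate : ∀ {n} (x y z : V n) → (x ⊕ y) ⊕ z ≡ (x ⊕ z) ⊕ y
  rotate x y z = trans (⊕-assoc x y z) (trans (cong (x ⊕_) (⊕-comm y z)) (sym (⊕-assoc x z y)))

  private
    complete : ∀ x y z c → (x ⊕ app q c) ⊕ y ≡ z → x ⊕ z ≡ y ⊕ app q c
    complete x y z c refl = trans (cong (x ⊕_) (trans (⊕-assoc x (app q c) y) (cong (x ⊕_) (⊕-comm (app q c) y))))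
      (trans (sym (⊕-assoc x x _)) (trans (cong (_⊕ (y ⊕ app q c)) (⊕-self x)) (⊕-0ˡ _)))

  -- Write a vector x of the minor as y + q(c) + z with y from A i and z from C j. Then y completes
  -- c on the first side and z on the second, so c lies in both traces; if c = 0, then y and z are
  -- confined to S and T.
  minor-dim : ∀ {i j} → i ≤ j → j ≤ l → ∀ S T → S ≼ A i → T ≼ C j →
              dim (Link G a (λ v → S v ∨ T v) (λ v → A j v ∧ not (A i v))) ≤
              dim (K′ G S) + dim (K′ G T) + dim (Trace (A i) S ⊓ Trace (C j) T)
  minor-dim {i} {j} i≤j j≤l S T S≼ T≼ = begin
    dim M                                      ≤⟨ dim-mono M (ran R) M⊑ ⟩
    dim (ran R)                                ≤⟨ m≤n+m _ (dim (ker R)) ⟩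
    dim (ker R) + dim (ran R)                  ≡⟨ sym (dim-rel R) ⟩
    dim (indet R) + dim (dom R)                ≤⟨ +-mono-≤ (≤-trans (dim-mono (indet R) (K′ G S ⊔ K′ G T) indet⊑) (dim-sum-≤ (K′ G S) (K′ G T)))
                                                           (dim-mono (dom R) (Trace (A i) S ⊓ Trace (C j) T) dom⊑) ⟩
    dim (K′ G S) + dim (K′ G T) + dim (Trace (A i) S ⊓ Trace (C j) T) ∎
    where
    X D MI MJ BI BJ BI' BJ' inS inT : Fin n → Bool
    X v = S v ∨ T v
    D v = A j v ∧ not (A i v)
    MI = link∈ a X D
    MJ = link∋ a X D
    BI v  = MI v ∨ C j v
    BJ v  = MJ v ∨ C j v
    BI' v = MI v ∨ A i v
    BJ' v = MJ v ∨ A i v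
    inS v = not (A i v) ∨ S v
    inT v = not (C j v) ∨ T v
    M = Link G a X D
    R = over M (sum i j)
    hyps : ∀ v → ((A i v ⇒ A j v) ∧ (S v ⇒ A i v) ∧ (T v ⇒ not (A j v))) ≡ true
    hyps v = cong₂ _∧_ (mono i≤j j≤l v) (cong₂ _∧_ (S≼ v) (T≼ v))
    by : (f : Boolean 5 Bool) → everywhere 5 (λ p q s t a → (p ⇒ q) ∧ (s ⇒ p) ∧ (t ⇒ not q) ⇒ f p q s t a) ≡ true →
         ∀ v → f (A i v) (A j v) (S v) (T v) (a v) ≡ true
    by f h v = mp (taut 5 (λ p q s t a → (p ⇒ q) ∧ (s ⇒ p) ∧ (t ⇒ not q) ⇒ f p q s t a) h (A i v) (A j v) (S v) (T v) (a v)) (hyps v)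
    M⊑ : M ⊑ ran R
    M⊑ x m with decompose i≤j j≤l x (K-mono G {MI} {MJ} {link∈ a (glued i j) all} {link∋ a (glued i j) all}
      (by (λ p q s t a → (s ∨ t) ∨ ((q ∧ not p) ∧ a) ⇒ (p ∨ not q) ∨ a) refl)
      (by (λ p q s t a → (s ∨ t) ∨ ((q ∧ not p) ∧ not a) ⇒ (p ∨ not q) ∨ not a) refl) x m)
    ... | c , _ , p = c , m , p
    indet⊑ : indet R ⊑ K′ G S ⊔ K′ G T
    indet⊑ x (m , p) with q0⁻ (sum i j) {x} p
    ... | y , y∈ , z∈ = y ,
      K-meet G BI BJ (A i) (A i) {S} {S} y (⊕-cancelˡ-∈ (K G BI BJ) {x} {y}
          (K-mono G {C j} {C j} {BI} {BJ} (λ v → taut 2 (λ m c → c ⇒ m ∨ c) refl (MI v) (C j v)) (λ v → taut 2 (λ m c → c ⇒ m ∨ c) refl (MJ v) (C j v)) (x ⊕ y) z∈)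
          (K-mono G {MI} {MJ} {BI} {BJ} (λ v → taut 2 (λ m c → m ⇒ m ∨ c) refl (MI v) (C j v)) (λ v → taut 2 (λ m c → m ⇒ m ∨ c) refl (MJ v) (C j v)) x m)) y∈
        (by (λ p q s t a → (((s ∨ t) ∨ ((q ∧ not p) ∧ a)) ∨ not q) ∧ p ⇒ s) refl)
        (by (λ p q s t a → (((s ∨ t) ∨ ((q ∧ not p) ∧ not a)) ∨ not q) ∧ p ⇒ s) refl) ,
      K-meet G BI' BJ' (C j) (C j) {T} {T} (x ⊕ y) (⊕∈ (K G BI' BJ') {x} {y}
          (K-mono G {MI} {MJ} {BI'} {BJ'} (λ v → taut 2 (λ m c → m ⇒ m ∨ c) refl (MI v) (A i v)) (λ v → taut 2 (λ m c → m ⇒ m ∨ c) refl (MJ v) (A i v)) x m)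
          (K-mono G {A i} {A i} {BI'} {BJ'} (λ v → taut 2 (λ m c → c ⇒ m ∨ c) refl (MI v) (A i v)) (λ v → taut 2 (λ m c → c ⇒ m ∨ c) refl (MJ v) (A i v)) y y∈)) z∈
        (by (λ p q s t a → (((s ∨ t) ∨ ((q ∧ not p) ∧ a)) ∨ p) ∧ not q ⇒ t) refl)
        (by (λ p q s t a → (((s ∨ t) ∨ ((q ∧ not p) ∧ not a)) ∨ p) ∧ not q ⇒ t) refl)
    dom⊑ : dom R ⊑ Trace (A i) S ⊓ Trace (C j) T
    dom⊑ c (x , m , y , y∈ , z∈) =
      (y , y∈ , subst (Mem (K′ G inS)) (complete x y z c refl) (⊕∈ (K′ G inS) {x} {z}
        (K-mono G {MI} {MJ} {inS} {inS} (by (λ p q s t a → (s ∨ t) ∨ ((q ∧ not p) ∧ a) ⇒ not p ∨ s) refl)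
                                        (by (λ p q s t a → (s ∨ t) ∨ ((q ∧ not p) ∧ not a) ⇒ not p ∨ s) refl) x m)
        (K-mono G {C j} {C j} {inS} {inS} (by (λ p q s t a → not q ⇒ not p ∨ s) refl) (by (λ p q s t a → not q ⇒ not p ∨ s) refl) z z∈))) ,
      (z , z∈ , subst (Mem (K′ G inT)) (complete x z y c (⊕-cancel-mid (x ⊕ app q c) y)) (⊕∈ (K′ G inT) {x} {y}
        (K-mono G {MI} {MJ} {inT} {inT} (by (λ p q s t a → (s ∨ t) ∨ ((q ∧ not p) ∧ a) ⇒ not (not q) ∨ t) refl)
                                        (by (λ p q s t a → (s ∨ t) ∨ ((q ∧ not p) ∧ not a) ⇒ not (not q) ∨ t) refl) x m)
        (K-mono G {A i} {A i} {inT} {inT} (by (λ p q s t a → p ⇒ not (not q) ∨ t) refl) (by (λ p q s t a → p ⇒ not (not q) ∨ t) refl) y y∈)))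
      where
      z = (x ⊕ app q c) ⊕ y
      ⊕-cancel-mid : ∀ {m} (u y : V m) → u ⊕ (u ⊕ y) ≡ y
      ⊕-cancel-mid u y = trans (sym (⊕-assoc u u y)) (trans (cong (_⊕ y) (⊕-self u)) (⊕-0ˡ y))

  -- Converse to `minor-dim` when the halves partition the vertex set: completions y and z of a
  -- common signal c assemble to y + q(c) + z, which is confined to the union of S and T.
  whole-dim : ∀ {j} → j ≤ l → ∀ S T → S ≼ A j → T ≼ C j →
              dim (K′ G S) + dim (K′ G T) + dim (Trace (A j) S ⊓ Trace (C j) T) ≤ dim (K′ G (λ v → S v ∨ T v))
  whole-dim {j} j≤l S T S≼ T≼ = begin
    dim (K′ G S) + dim (K′ G T) + dim (Trace (A j) S ⊓ Trace (C j) T)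
      ≤⟨ +-mono-≤ (≤-trans (≤-reflexive (sym (dim-sum (K′ G S) (K′ G T) (disjoint S T (by (λ p s t → s ⇒ not t) refl)))))
                           (dim-mono (K′ G S ⊔ K′ G T) (indet R) ⊑indet))
                  (dim-mono (Trace (A j) S ⊓ Trace (C j) T) (dom R) ⊑dom) ⟩
    dim (indet R) + dim (dom R)  ≡⟨ dim-rel R ⟩
    dim (ker R) + dim (ran R)    ≡⟨ cong (_+ dim (ran R)) (dim-zero (ker R) (λ c (_ , p) → q-indep {j} {j} ≤-refl j≤l c (subst (Mem (sum j j)) (⊕-0ˡ (app q c)) p))) ⟩
    dim (ran R)                  ≤⟨ dim-mono (ran R) (K′ G X) (λ x (c , m , _) → m) ⟩
    dim (K′ G X)                 ∎
    where
    X inS inT : Fin n → Bool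
    X v = S v ∨ T v
    inS v = not (A j v) ∨ S v
    inT v = not (C j v) ∨ T v
    R = over (K′ G X) (sum j j)
    by : (f : Boolean 3 Bool) → everywhere 3 (λ p s t → (s ⇒ p) ∧ (t ⇒ not p) ⇒ f p s t) ≡ true →
         ∀ v → f (A j v) (S v) (T v) ≡ true
    by f h v = mp (taut 3 (λ p s t → (s ⇒ p) ∧ (t ⇒ not p) ⇒ f p s t) h (A j v) (S v) (T v)) (hyps v)
      where
      hyps : ∀ v → ((S v ⇒ A j v) ∧ (T v ⇒ not (A j v))) ≡ true
      hyps v = cong₂ _∧_ (S≼ v) (T≼ v)
    ⊑indet : K′ G S ⊔ K′ G T ⊑ indet R
    ⊑indet x (y , y∈ , z∈) = ⊕-cancelʳ-∈ (K′ G X) {x} {y}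
        (K-mono G {T} {T} {X} {X} (by (λ p s t → t ⇒ s ∨ t) refl) (by (λ p s t → t ⇒ s ∨ t) refl) (x ⊕ y) z∈)
        (K-mono G {S} {S} {X} {X} (by (λ p s t → s ⇒ s ∨ t) refl) (by (λ p s t → s ⇒ s ∨ t) refl) y y∈) ,
      q0 (sum j j) {x} (y , K-mono G {S} {S} {A j} {A j} S≼ S≼ y y∈ , K-mono G {T} {T} {C j} {C j} T≼ T≼ (x ⊕ y) z∈)
    ⊑dom : Trace (A j) S ⊓ Trace (C j) T ⊑ dom R
    ⊑dom c ((y , y∈ , py) , (z , z∈ , pz)) = x , x∈ , y , y∈ , subst (Mem (K′ G (C j))) (sym x⊕) z∈
      where
      x = (y ⊕ app q c) ⊕ z
      x⊕ : (x ⊕ app q c) ⊕ y ≡ z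
      x⊕ = trans (cong (_⊕ y) (trans (rotate (y ⊕ app q c) z (app q c)) (cong (_⊕ z) (⊕-cancel y (app q c)))))
        (trans (cong (_⊕ y) (⊕-comm y z)) (⊕-cancel z y))
      x∈ : Mem (K′ G X) x
      x∈ = K-meet G inS inS inT inT {X} {X} x
        (⊕∈ (K′ G inS) {y ⊕ app q c} {z} py (K-mono G {C j} {C j} {inS} {inS} (by (λ p s t → not p ⇒ not p ∨ s) refl) (by (λ p s t → not p ⇒ not p ∨ s) refl) z z∈))
        (subst (Mem (K′ G inT)) (trans (rotate z (app q c) y) (trans (cong (_⊕ app q c) (⊕-comm z y)) (rotate y z (app q c))))
          (⊕∈ (K′ G inT) {z ⊕ app q c} {y} pz (K-mono G {A j} {A j} {inT} {inT} (by (λ p s t → p ⇒ not (not p) ∨ t) refl) (by (λ p s t → p ⇒ not (not p) ∨ t) refl) y y∈)))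
        (by (λ p s t → (not p ∨ s) ∧ (not (not p) ∨ t) ⇒ s ∨ t) refl) (by (λ p s t → (not p ∨ s) ∧ (not (not p) ∨ t) ⇒ s ∨ t) refl)

  private
    inside : (P S : Fin n → Bool) → Fin n → Bool
    inside P S v = not (P v) ∨ S v

    traced : (P S : Fin n → Bool) → Sub (w + w) → LinRel (w + w) n
    traced P S Γ .Rel c x  = Mem Γ c × Rel (over (K′ G (inside P S)) (K′ G P)) c x
    traced P S Γ .rdec c x = dec Γ c ×-dec rdec (over (K′ G (inside P S)) (K′ G P)) c x
    traced P S Γ .0R = 0∈ Γ , 0R (over (K′ G (inside P S)) (K′ G P))
    traced P S Γ .⊕R {c} {x} {c'} {x'} (g , r) (g' , r') = ⊕∈ Γ g g' , ⊕R (over (K′ G (inside P S)) (K′ G P)) {c} {x} {c'} {x'} r r'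

    -- Gathers the two terms that depend on S into one space, that of the completed signals y + q(c)
    -- with c in Γ, so that `codim` can be applied to it.
    traced-dim : ∀ {i} → i ≤ l → ∀ S → S ≼ A i → ∀ Γ → dim (K′ G S) + dim (Trace (A i) S ⊓ Γ) ≡ dim (ran (traced (A i) S Γ))
    traced-dim {i} i≤l S S≼ Γ = trans (cong₂ _+_
        (dim-cong (K′ G S) (indet R) (λ x p → 0∈ Γ , K-mono G {S} {S} {inS} {inS} S≼inS S≼inS x p , q0 (K′ G (A i)) {x} (K-mono G {S} {S} {A i} {A i} S≼ S≼ x p))
          (λ x (_ , p , r) → K-meet G inS inS (A i) (A i) {S} {S} x p (q0⁻ (K′ G (A i)) {x} r) meet meet))
        (dim-cong (Trace (A i) S ⊓ Γ) (dom R)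
          (λ c ((y , y∈ , p) , g) → y ⊕ app q c , g , p , subst (Mem (K′ G (A i))) (sym (⊕-cancel y (app q c))) y∈)
          (λ c (x , g , p , r) → (x ⊕ app q c , r , subst (Mem (K′ G inS)) (sym (⊕-cancel x (app q c))) p) , g)))
      (trans (dim-rel R) (cong (_+ dim (ran R)) (dim-zero (ker R) λ c (_ , _ , r) → q-indep {i} {i} ≤-refl i≤l c
        (app q c , subst (Mem (K′ G (A i))) (⊕-0ˡ (app q c)) r , subst (Mem (K′ G (C i))) (sym (⊕-self (app q c))) (0∈ (K′ G (C i)))))))
      where
      R = traced (A i) S Γ
      inS = inside (A i) S
      S≼inS : S ≼ inS
      S≼inS v = taut 2 (λ p s → s ⇒ not p ∨ s) refl (A i v) (S v)
      meet : ∀ v → (inS v ∧ A i v ⇒ S v) ≡ true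
      meet v = taut 2 (λ p s → (not p ∨ s) ∧ p ⇒ s) refl (A i v) (S v)

  -- The constraints of a are imposed on S outside A i, at one dimension for each vertex removed
  -- from S. By `link⊑` the resulting vectors complete the same signals on the side A i.
  restrict-dim : ∀ {i j} → i ≤ j → j ≤ l → ∀ S → S ≼ A j → ∀ Γ →
                 let S° = λ v → S v ∧ A i v in
                 dim (K′ G S) + dim (Trace (A j) S ⊓ Γ) + # S° ≤ # S + (dim (K′ G S°) + dim (Trace (A i) S° ⊓ Γ))
  restrict-dim {i} {j} i≤j j≤l S S≼ Γ = begin
    dim (K′ G S) + dim (Trace (A j) S ⊓ Γ) + # S°                   ≡⟨ cong (_+ # S°) (traced-dim j≤l S S≼ Γ) ⟩
    dim (ran (traced (A j) S Γ)) + # S°                             ≤⟨ +-monoˡ-≤ (# S°) (codim G a Y (ran (traced (A j) S Γ)) (ran (traced (A i) S° Γ)) mem) ⟩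
    dim (ran (traced (A i) S° Γ)) + # Y + # S°                      ≡⟨ trans (+-assoc (dim (ran (traced (A i) S° Γ))) (# Y) (# S°)) (cong (dim (ran (traced (A i) S° Γ)) +_)
                                                                         (#-⊎ {f = Y} {S°} {S} (λ v → ≡ᵇ-sound (taut 2 (λ s p → (b2n (s ∧ not p) + b2n (s ∧ p)) Data.Nat.≡ᵇ b2n s) refl (S v) (A i v))))) ⟩
    dim (ran (traced (A i) S° Γ)) + # S                             ≡⟨ trans (+-comm _ (# S)) (cong (# S +_) (sym (traced-dim (≤-trans i≤j j≤l) S° S°≼ Γ))) ⟩
    # S + (dim (K′ G S°) + dim (Trace (A i) S° ⊓ Γ))                ∎
    where
    S° Y E∈ E∋ : Fin n → Bool
    S° v = S v ∧ A i v
    Y v = S v ∧ not (A i v)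
    E∈ = link∈ a (glued i j) all
    E∋ = link∋ a (glued i j) all
    S°≼ : S° ≼ A i
    S°≼ v = taut 2 (λ s p → s ∧ p ⇒ p) refl (S v) (A i v)
    mem : ∀ x → Mem (ran (traced (A j) S Γ)) x → (∀ v → Y v ≡ true → coord G a x v ≡ false) → Mem (ran (traced (A i) S° Γ)) x
    mem x (c , g , p , r) zeros = c , g ,
      K-mono G {inside (A j) S} {inside (A j) S} {inside (A i) S°} {inside (A i) S°} shrink shrink x p ,
      link⊑ i≤j j≤l (x ⊕ app q c) (K-meet G E∈ E∋ (A j) (A j) {link∈ a (A i) (A j)} {link∋ a (A i) (A j)} (x ⊕ app q c)
        (⊕∈ (K G E∈ E∋) {x} {app q c} x∈E (q∈ i≤j j≤l c)) r
        (λ v → taut 3 (λ p q a → ((p ∨ not q) ∨ a) ∧ q ⇒ p ∨ (q ∧ a)) refl (A i v) (A j v) (a v))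
        (λ v → taut 3 (λ p q a → ((p ∨ not q) ∨ not a) ∧ q ⇒ p ∨ (q ∧ not a)) refl (A i v) (A j v) (a v)))
      where
      shrink : inside (A j) S ≼ inside (A i) S°
      shrink v = mp (taut 3 (λ p q s → (p ⇒ q) ⇒ not q ∨ s ⇒ not p ∨ (s ∧ p)) refl (A i v) (A j v) (S v)) (mono i≤j j≤l v)
      x∈E : Mem (K G E∈ E∋) x
      x∈E v with A i v | A j v | S v | p v | zeros v
      ... | true  | _     | _     | _  | _ = (λ ()) , λ ()
      ... | false | false | _     | _  | _ = (λ ()) , λ ()
      ... | false | true  | false | p' | _ = (λ _ → proj₁ p' refl) , λ _ → proj₂ p' refl
      ... | false | true  | true  | _  | z with a v | z refl
      ...   | true  | e = (λ ()) , λ _ → e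
      ...   | false | e = (λ _ → e) , λ ()

-- Alignments of sequences

-- Lattice paths in xs × ys along which R holds; Sim allows diagonal steps, Align does not.
data Sim {A B : Set} (R : A → B → Set) : List A → List B → Set where
  nil   : Sim R [] []
  stepˡ : ∀ {x y xs ys} → R x y → Sim R xs (y ∷ ys) → Sim R (x ∷ xs) (y ∷ ys)
  stepʳ : ∀ {x y xs ys} → R x y → Sim R (x ∷ xs) ys → Sim R (x ∷ xs) (y ∷ ys)
  both  : ∀ {x y xs ys} → R x y → Sim R xs ys → Sim R (x ∷ xs) (y ∷ ys)

data Align {A B : Set} (R : A → B → Set) : List A → List B → Set where
  end   : ∀ {x y} → R x y → Align R (x ∷ []) (y ∷ [])
  left  : ∀ {x y xs ys} → R x y → Align R xs (y ∷ ys) → Align R (x ∷ xs) (y ∷ ys)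
  right : ∀ {x y xs ys} → R x y → Align R (x ∷ xs) ys → Align R (x ∷ xs) (y ∷ ys)

align-head : ∀ {A B : Set} {R : A → B → Set} {x y xs ys} → Align R (x ∷ xs) (y ∷ ys) → R x y
align-head (end r)     = r
align-head (left r _)  = r
align-head (right r _) = r

-- Both paths are run in parallel along ys. A diagonal step of `Sim` waits until `Align` leaves the
-- current y, so the composite moves on one side at a time.
sim-align : ∀ {A B C : Set} {R : A → B → Set} {S : B → C → Set} {xs ys zs} →
            Sim R xs ys → Align S ys zs → Align (λ x z → ∃ λ y → R x y × S y z) xs zs
sim-align nil ()
sim-align {zs = []} (stepˡ _ _) ()
sim-align {zs = []} (stepʳ _ _) ()
sim-align {zs = []} (both _ _) ()
sim-align {zs = z ∷ zs} (stepˡ r s) a = left (_ , r , align-head a) (sim-align s a)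
sim-align {zs = z ∷ zs} (stepʳ r s) (left _ a) = sim-align s a
sim-align {zs = z ∷ zs} (stepʳ r s) (right q a) = right (_ , r , q) (sim-align (stepʳ r s) a)
sim-align {zs = z ∷ zs} (both r nil) (end q) = end (_ , r , q)
sim-align {zs = z ∷ zs} (both r s) (left q a) = left (_ , r , q) (sim-align s a)
sim-align {zs = z ∷ zs} (both r s) (right q a) = right (_ , r , q) (sim-align (both r s) a)

align-map : ∀ {A B : Set} {R S : A → B → Set} {xs ys} → (∀ {x y} → R x y → S x y) → Align R xs ys → Align S xs ys
align-map f (end r)     = end (f r)
align-map f (left r a)  = left (f r) (align-map f a)
align-map f (right r a) = right (f r) (align-map f a)

align-all : ∀ {A B : Set} {R : A → B → Set} {P : A → Set} {xs ys} → (∀ {x y} → R x y → P x) → Align R xs ys → All P xs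
align-all f (end r)     = f r ∷ []
align-all f (left r a)  = f r ∷ align-all f a
align-all f (right r a) = align-all f a

sim-++ : ∀ {A B : Set} {R : A → B → Set} {xs ys xs' ys'} → Sim R xs ys → Sim R xs' ys' → Sim R (xs ++ xs') (ys ++ ys')
sim-++ nil         t = t
sim-++ (stepˡ r s) t = stepˡ r (sim-++ s t)
sim-++ (stepʳ r s) t = stepʳ r (sim-++ s t)
sim-++ (both r s)  t = both r (sim-++ s t)

sim-map : ∀ {A B A' B' : Set} {R : A → B → Set} {S : A' → B' → Set} (f : A → A') (g : B → B') →
          (∀ {x y} → R x y → S (f x) (g y)) → ∀ {xs ys} → Sim R xs ys → Sim S (map f xs) (map g ys)
sim-map f g h nil         = nil
sim-map f g h (stepˡ r s) = stepˡ (h r) (sim-map f g h s)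
sim-map f g h (stepʳ r s) = stepʳ (h r) (sim-map f g h s)
sim-map f g h (both r s)  = both (h r) (sim-map f g h s)

sim-mapˡ⁻ : ∀ {A B C : Set} {R : B → C → Set} (f : A → B) xs {ys} → Sim R (map f xs) ys → Sim (λ x y → R (f x) y) xs ys
sim-mapˡ⁻ f []       nil         = nil
sim-mapˡ⁻ f (x ∷ xs) (stepˡ r s) = stepˡ r (sim-mapˡ⁻ f xs s)
sim-mapˡ⁻ f (x ∷ xs) (stepʳ r s) = stepʳ r (sim-mapˡ⁻ f (x ∷ xs) s)
sim-mapˡ⁻ f (x ∷ xs) (both r s)  = both r (sim-mapˡ⁻ f xs s)

sim-mapʳ⁻ : ∀ {A B C : Set} {R : A → C → Set} (f : B → C) {xs} ys → Sim R xs (map f ys) → Sim (λ x y → R x (f y)) xs ys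
sim-mapʳ⁻ f []       nil         = nil
sim-mapʳ⁻ f (y ∷ ys) (stepˡ r s) = stepˡ r (sim-mapʳ⁻ f (y ∷ ys) s)
sim-mapʳ⁻ f (y ∷ ys) (stepʳ r s) = stepʳ r (sim-mapʳ⁻ f ys s)
sim-mapʳ⁻ f (y ∷ ys) (both r s)  = both r (sim-mapʳ⁻ f ys s)

sim-all : ∀ {A B : Set} {R : A → B → Set} {P : A → Set} {Q : B → Set} → (∀ {x y} → R x y → Q y → P x) →
          ∀ {xs ys} → Sim R xs ys → All Q ys → All P xs
sim-all f nil         _        = []
sim-all f (stepˡ r s) (q ∷ qs) = f r q ∷ sim-all f s (q ∷ qs)
sim-all f (stepʳ r s) (q ∷ qs) = sim-all f s qs
sim-all f (both r s)  (q ∷ qs) = f r q ∷ sim-all f s qs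

-- Compression of integer sequences and of words

Similar : ∀ {A : Set} → (A → A → Set) → List A → List A → Set
Similar R s t = Sim R s t × Sim R t s

similar-++ : ∀ {A : Set} {R : A → A → Set} {s t s' t'} → Similar R s t → Similar R s' t' → Similar R (s ++ s') (t ++ t')
similar-++ (p , q) (p' , q') = sim-++ p p' , sim-++ q q'

data Ends {A : Set} (r : A) : List A → Set where
  last : Ends r (r ∷ [])
  next : ∀ {x s} → Ends r s → Ends r (x ∷ s)

ends-++ : ∀ {A : Set} {r : A} p {s} → Ends r s → Ends r (p ++ s)
ends-++ []      e = e
ends-++ (x ∷ p) e = next (ends-++ p e)

minimum : ∀ x (s : List ℕ) → ∃ λ m → m ∈ˡ (x ∷ s) × All (m ≤_) (x ∷ s)
minimum x [] = x , here refl , ≤-refl ∷ []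
minimum x (y ∷ s) with minimum y s
... | m , m∈ , ms with ≤-total m x
...   | inj₁ m≤x = m , there m∈ , m≤x ∷ ms
...   | inj₂ x≤m = x , here refl , ≤-refl ∷ All.map (≤-trans x≤m) ms

flat : ∀ {r x s} → All (_≤ r) (x ∷ s) → Sim _≤_ (x ∷ s) (r ∷ [])
flat {s = []}    (p ∷ _)  = both p nil
flat {s = y ∷ s} (p ∷ ps) = stepˡ p (flat ps)

-- A sequence that starts and ends in its maximum only matters through its minimum.
hump : ∀ r s → Ends r (r ∷ s) → All (_≤ r) (r ∷ s) → ∃ λ m → Similar _≤_ (r ∷ s) (r ∷ m ∷ r ∷ [])
hump r s e ≤r with minimum r s
... | m , m∈ , m≤@(m≤r ∷ m≤s) = m , up m∈ ≤r , down s e m≤s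
  where
  up : ∀ {h} → m ∈ˡ h → All (_≤ r) h → Sim _≤_ h (r ∷ m ∷ r ∷ [])
  up {_ ∷ []}    (here refl) (p ∷ _)  = stepʳ p (stepʳ ≤-refl (both p nil))
  up {_ ∷ _ ∷ _} (here refl) (p ∷ ps) = stepʳ p (both ≤-refl (flat ps))
  up (there i) (p ∷ ps) = stepˡ p (up i ps)
  tail : ∀ {h} → Ends r h → All (m ≤_) h → Sim _≤_ (m ∷ r ∷ []) h
  tail last     _        = stepˡ m≤r (both ≤-refl nil)
  tail (next e) (p ∷ ps) = stepʳ p (tail e ps)
  down : ∀ s → Ends r (r ∷ s) → All (m ≤_) s → Sim _≤_ (r ∷ m ∷ r ∷ []) (r ∷ s)
  down []      e        _  = stepˡ ≤-refl (stepˡ m≤r (both ≤-refl nil))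
  down (x ∷ s) (next e) ps = both ≤-refl (tail e ps)

block-length : ℕ → ℕ
block-length zero    = 0
block-length (suc r) = block-length r + (3 + block-length r)

Hump : ℕ → List ℕ → Set
Hump r h = h ≡ [] ⊎ ∃ λ s → h ≡ r ∷ s × Ends r h × All (_≤ r) h

-- The hump h runs from the first to the last occurrence of r, and is empty if r does not occur.
split-max : ∀ r s → All (_≤ r) s → ∃ λ p → ∃₂ λ h v → s ≡ p ++ h ++ v × All (_< r) p × Hump r h × All (_< r) v
split-max r [] _ = [] , [] , [] , refl , [] , inj₁ refl , []
split-max r (x ∷ s) (x≤r ∷ s≤r) with split-max r s s≤r | x Data.Nat.≟ r
... | p , h , v , refl , p< , hump-h , v< | no x≢r = x ∷ p , h , v , refl , ≤∧≢⇒< x≤r x≢r ∷ p< , hump-h , v<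
... | p , .[] , v , refl , p< , inj₁ refl , v< | yes refl =
  [] , x ∷ [] , p ++ v , refl , [] , inj₂ ([] , refl , last , ≤-refl ∷ []) , All.++⁺ p< v<
... | p , h , v , refl , p< , inj₂ (s' , eq , e , h≤) , v< | yes refl =
  [] , x ∷ (p ++ h) , v , cong (x ∷_) (sym (++-assoc p h v)) , [] ,
  inj₂ (p ++ h , refl , next (ends-++ p e) , ≤-refl ∷ All.++⁺ (All.map <⇒≤ p<) h≤) , v<

-- The hump at the top value shrinks to three entries, and the two pieces beside it have smaller
-- bounds; this is the recursion of `block-length`.
block : ∀ r s → All (_< r) s → ∃ λ t → length t ≤ block-length r × Similar _≤_ s t
block zero [] _ = [] , z≤n , nil , nil
block zero (x ∷ s) (() ∷ _)
block (suc r) s s<r with split-max r s (All.map s≤s⁻¹ s<r)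
... | p , h , v , refl , p< , hump-h , v< with block r p p< | block r v v< | short h hump-h
  where
  short : ∀ h → Hump r h → ∃ λ t → length t ≤ 3 × Similar _≤_ h t
  short .[] (inj₁ refl) = [] , z≤n , nil , nil
  short h (inj₂ (s , refl , e , h≤)) with hump r s e h≤
  ... | m , sim = r ∷ m ∷ r ∷ [] , ≤-refl , sim
...   | t₁ , l₁ , sim₁ | t₂ , l₂ , sim₂ | t , l , sim = t₁ ++ t ++ t₂ ,
  ≤-trans (≤-reflexive (trans (length-++ t₁) (cong (length t₁ +_) (length-++ t)))) (+-mono-≤ l₁ (+-mono-≤ l l₂)) ,
  similar-++ sim₁ (similar-++ sim sim₂)

Letter : ℕ → Set
Letter N = Subset N × ℕ

_≤ᴸ_ : ∀ {N} → Letter N → Letter N → Set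
(c , x) ≤ᴸ (d , y) = c ≡ d × x ≤ y

-- Since the subsets increase along the word, the letters with subset c form an initial run, and all
-- later subsets are strictly larger.
peel : ∀ {N} (c : Subset N) (s : List (Letter N)) → All (λ a → c ⊆ proj₁ a) s → AllPairs (λ a b → proj₁ a ⊆ proj₁ b) s →
       ∃ λ (run : List ℕ) → ∃ λ rest → s ≡ map (c ,_) run ++ rest ×
       All (λ a → ∣ c ∣ < ∣ proj₁ a ∣) rest × AllPairs (λ a b → proj₁ a ⊆ proj₁ b) rest
peel c [] _ _ = [] , [] , refl , [] , []
peel c ((d , x) ∷ s) (c⊆d ∷ c⊆s) (d⊆s ∷ pairs) with ≡-dec Data.Bool._≟_ d c
... | yes refl with peel d s c⊆s pairs
...   | run , rest , refl , big , pairs' = x ∷ run , rest , refl , big , pairs'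
peel c ((d , x) ∷ s) (c⊆d ∷ c⊆s) (d⊆s ∷ pairs) | no d≢c =
  [] , (d , x) ∷ s , refl , p⊂q⇒∣p∣<∣q∣ (strict {d} c⊆d (λ p → p)) ∷ All.map (λ {a} (d⊆e : d ⊆ proj₁ a) → p⊂q⇒∣p∣<∣q∣ (strict {proj₁ a} (λ p → d⊆e (c⊆d p)) d⊆e)) d⊆s , d⊆s ∷ pairs
  where
  witness : ∃ λ v → v ∈ d × v ∉ c
  witness with any? (λ v → (v ∈? d) ×-dec ¬? (v ∈? c))
  ... | yes w = w
  ... | no ¬w = contradiction (⊆-antisym (λ {v} p → decidable-stable (v ∈? c) (λ q → ¬w (v , p , q))) c⊆d) d≢c
  strict : ∀ {e} → c ⊆ e → d ⊆ e → c ⊂ e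
  strict c⊆e d⊆e = c⊆e , proj₁ witness , d⊆e (proj₁ (proj₂ witness)) , proj₂ (proj₂ witness)

-- Here d bounds the number of sizes still open to the subsets, hence the number of runs; each run
-- is compressed by `block`.
normal-form : ∀ {N} κ d (s : List (Letter N)) → AllPairs (λ a b → proj₁ a ⊆ proj₁ b) s → All (λ a → proj₂ a < κ) s →
              All (λ a → N < ∣ proj₁ a ∣ + d) s → ∃ λ t → length t ≤ d * block-length κ × Similar _≤ᴸ_ s t
normal-form κ d [] _ _ _ = [] , z≤n , nil , nil
normal-form {N} κ zero ((c , x) ∷ s) _ _ (N< ∷ _) =
  contradiction (≤-trans N< (≤-trans (≤-reflexive (+-identityʳ _)) (∣p∣≤n c))) (<-irrefl refl)
normal-form {N} κ (suc d) s@((c , x) ∷ s') (c⊆ ∷ pairs) small (N< ∷ _)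
  with peel c s ((λ p → p) ∷ c⊆) (c⊆ ∷ pairs)
... | run , rest , eq , big , pairs'
  with block κ run (All.map⁻ (All.++⁻ˡ (map (c ,_) run) (subst (All _) eq small)))
     | normal-form κ d rest pairs' (All.++⁻ʳ (map (c ,_) run) (subst (All _) eq small))
         (All.map (λ {a} c<a → ≤-trans N< (≤-trans (≤-reflexive (+-suc ∣ c ∣ d)) (+-monoˡ-≤ d c<a))) big)
... | t₁ , l₁ , sim₁ | t₂ , l₂ , sim₂ =
  map (c ,_) t₁ ++ t₂ ,
  ≤-trans (≤-reflexive (trans (length-++ (map (c ,_) t₁)) (cong (_+ length t₂) (length-map (c ,_) t₁)))) (+-mono-≤ l₁ l₂) ,
  subst (λ z → Similar _≤ᴸ_ z (map (c ,_) t₁ ++ t₂)) (sym eq)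
    (similar-++ (sim-map (c ,_) (c ,_) (refl ,_) (proj₁ sim₁) , sim-map (c ,_) (c ,_) (refl ,_) (proj₂ sim₁)) sim₂)

-- Injective coding of bounded words

digit : Bool → Fin 2
digit true  = suc zero
digit false = zero

encode-subset : ∀ {N} → Subset N → Fin (2 ^ N)
encode-subset []      = zero
encode-subset (b ∷ s) = combine (digit b) (encode-subset s)

encode-subset-injective : ∀ {N} (s t : Subset N) → encode-subset s ≡ encode-subset t → s ≡ t
encode-subset-injective [] [] _ = refl
encode-subset-injective (b ∷ s) (c ∷ t) e with combine-injective (digit b) (encode-subset s) (digit c) (encode-subset t) e
... | p , q = cong₂ _∷_ (head b c p) (encode-subset-injective s t q)
  where
  head : ∀ b c → digit b ≡ digit c → b ≡ c
  head true  true  _ = refl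
  head false false _ = refl

encode-letter : ∀ {N κ} (a : Letter N) → proj₂ a < κ → Fin (2 ^ N * κ)
encode-letter (c , x) x<κ = combine (encode-subset c) (fromℕ< x<κ)

encode-letter-injective : ∀ {N κ} (a b : Letter N) (p : proj₂ a < κ) (q : proj₂ b < κ) → encode-letter a p ≡ encode-letter b q → a ≡ b
encode-letter-injective (c , x) (d , y) p q e with combine-injective (encode-subset c) (fromℕ< p) (encode-subset d) (fromℕ< q) e
... | e₁ , e₂ = cong₂ _,_ (encode-subset-injective c d e₁) (fromℕ<-injective x y p q e₂)

-- The additional symbol is a blank that pads shorter words to length L.
words : ℕ → ℕ → ℕ → ℕ
words N κ L = suc (2 ^ N * κ) ^ L

encode-word : ∀ {N κ} L (s : List (Letter N)) → All (λ a → proj₂ a < κ) s → length s ≤ L → Fin (words N κ L)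
encode-word zero    []      _        _  = zero
encode-word {N} {κ} (suc L) [] _ _ = combine (zero {2 ^ N * κ}) (encode-word {N} {κ} L [] [] z≤n)
encode-word (suc L) (a ∷ s) (p ∷ ps) le = combine (suc (encode-letter a p)) (encode-word L s ps (s≤s⁻¹ le))

encode-word-injective : ∀ {N κ} L (s t : List (Letter N)) (p : All (λ a → proj₂ a < κ) s) (q : All (λ a → proj₂ a < κ) t) l l' →
                        encode-word L s p l ≡ encode-word L t q l' → s ≡ t
encode-word-injective zero [] [] _ _ _ _ _ = refl
encode-word-injective (suc L) [] [] _ _ _ _ _ = refl
encode-word-injective {N} {κ} (suc L) [] (b ∷ t) p (q ∷ qs) l l' e =
  contradiction (proj₁ (combine-injective (zero {2 ^ N * κ}) (encode-word {N} {κ} L [] [] z≤n) (suc (encode-letter b q)) (encode-word L t qs (s≤s⁻¹ l')) e)) λ ()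
encode-word-injective {N} {κ} (suc L) (a ∷ s) [] (p ∷ ps) q l l' e =
  contradiction (proj₁ (combine-injective (suc (encode-letter a p)) (encode-word L s ps (s≤s⁻¹ l)) (zero {2 ^ N * κ}) (encode-word {N} {κ} L [] [] z≤n) e)) λ ()
encode-word-injective (suc L) (a ∷ s) (b ∷ t) (p ∷ ps) (q ∷ qs) l l' e
  with combine-injective (suc (encode-letter a p)) (encode-word L s ps (s≤s⁻¹ l)) (suc (encode-letter b q)) (encode-word L t qs (s≤s⁻¹ l')) e
... | e₁ , e₂ = cong₂ _∷_ (encode-letter-injective a b p q (suc-injective e₁)) (encode-word-injective L s t ps qs _ _ e₂)

-- Orderings from alignments

_∪_ : ∀ {n} → (Fin n → Bool) → Fin n → Fin n → Bool
(X ∪ x) v = is x v ∨ X v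

data Order {n} (G : Adj n) (k : ℕ) : (Fin n → Bool) → ℕ → Set where
  full  : ∀ {X} → (∀ v → X v ≡ true) → Order G k X 0
  place : ∀ {X r} x → X x ≡ false → Narrow G k (X ∪ x) → Order G k (X ∪ x) r → Order G k X (suc r)

narrow-cong : ∀ {n} (G : Adj n) {k X Y} → X ≗ᵇ Y → Narrow G k X → Narrow G k Y
narrow-cong G {k} {X} {Y} e h = ≤-trans (≤-reflexive (#-cong (λ v → sym (e v))))
  (≤-trans h (+-monoʳ-≤ k (dim-mono (K′ G X) (K′ G Y) (K-mono G (≗⇒≼ {f = X} e) (≗⇒≼ {f = X} e)))))

order-cong : ∀ {n} {G : Adj n} {k X Y r} → X ≗ᵇ Y → Order G k X r → Order G k Y r
order-cong e (full h) = full (λ v → trans (sym (e v)) (h v))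
order-cong {G = G} {X = X} {Y} e (place x Xx nar o) =
  place x (trans (sym (e x)) Xx) (narrow-cong G {X = X ∪ x} {Y ∪ x} e' nar) (order-cong e' o)
  where
  e' : (X ∪ x) ≗ᵇ (Y ∪ x)
  e' v = cong (is x v ∨_) (e v)

order-size : ∀ {n} {G : Adj n} {k X r} → Order G k X r → r + # X ≡ n
order-size {n} {X = X} (full h) = trans (#-cong h) (#-all {n})
order-size {n} {X = X} (place {r = r} x Xx _ o) = trans (sym (+-suc r (# X))) (trans (cong (r +_) (sym grown)) (order-size o))
  where
  grown : # (X ∪ x) ≡ suc (# X)
  grown = trans (sym (#-⊎ {f = is x} {X} {X ∪ x} disj)) (cong (_+ # X) (#-is x))
    where
    disj : ∀ v → b2n (is x v) + b2n (X v) ≡ b2n (is x v ∨ X v)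
    disj v with v ≟ x
    ... | yes refl rewrite Xx = refl
    ... | no _ = refl

module _ {n} {G : Adj n} {k : ℕ} where
  nth : ∀ {X r} → Order G k X r → Fin r → Fin n
  nth (place x _ _ o) zero    = x
  nth (place x _ _ o) (suc i) = nth o i

  nth-new : ∀ {X r} (o : Order G k X r) i → X (nth o i) ≡ false
  nth-new (place x Xx _ o) zero = Xx
  nth-new {X} (place x Xx _ o) (suc i) with is x (nth o i) | nth-new o i
  ... | false | e = e

  index : ∀ {X r} → Order G k X r → ∀ v → X v ≡ false → Fin r
  index (full h) v e = contradiction (trans (sym (h v)) e) λ ()
  index (place x _ _ o) v e with v ≟ x
  ... | yes _ = zero
  ... | no ne = suc (index o v (cong₂ _∨_ (is-≢ ne) e))

  nth-index : ∀ {X r} (o : Order G k X r) v e → nth o (index o v e) ≡ v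
  nth-index (full h) v e = contradiction (trans (sym (h v)) e) λ ()
  nth-index (place x _ _ o) v e with v ≟ x
  ... | yes refl = refl
  ... | no ne = nth-index o v (cong₂ _∨_ (is-≢ ne) e)

  index-nth : ∀ {X r} (o : Order G k X r) i e → index o (nth o i) e ≡ i
  index-nth (place x _ _ o) zero e with x ≟ x
  ... | yes _ = refl
  ... | no ne = contradiction refl ne
  index-nth (place x _ _ o) (suc i) e with nth o i ≟ x
  ... | yes p = contradiction (trans (sym (cong₂ _∨_ (trans (cong (is x) p) (is-refl x)) refl)) (nth-new o i)) λ ()
  ... | no ne = cong suc (index-nth o i _)

  segment : ∀ {X r} → Order G k X r → ℕ → Fin n → Bool
  segment {X} (full _)      t    = X
  segment {X} (place _ _ _ _) zero = X
  segment (place _ _ _ o) (suc t) = segment o t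

  segment-narrow : ∀ {X r} (o : Order G k X r) → Narrow G k X → ∀ t → Narrow G k (segment o t)
  segment-narrow (full _)          nar t       = nar
  segment-narrow (place _ _ _ _)   nar zero    = nar
  segment-narrow (place _ _ nar o) _   (suc t) = segment-narrow o nar t

  segment-⊇ : ∀ {X r} (o : Order G k X r) t v → X v ≡ true → segment o t v ≡ true
  segment-⊇ (full _)        t       v e = e
  segment-⊇ (place _ _ _ _) zero    v e = e
  segment-⊇ (place x _ _ o) (suc t) v e = segment-⊇ o t v (trans (cong (is x v ∨_) e) (∨-zeroʳ (is x v)))

  segment-index : ∀ {X r} (o : Order G k X r) t v (e : X v ≡ false) → segment o t v ≡ (toℕ (index o v e) <ᵇ t)
  segment-index (full h) t v e = contradiction (trans (sym (h v)) e) λ ()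
  segment-index (place x _ _ o) zero v e = e
  segment-index (place x _ _ o) (suc t) v e with v ≟ x
  ... | yes refl = segment-⊇ o t v (cong (_∨ _) (is-refl v))
  ... | no ne = segment-index o t v (cong₂ _∨_ (is-≢ ne) e)

  order⇒LRW : Order G k (λ _ → false) n → LRW≤ G k
  order⇒LRW o = π , λ i _ _ → ⇒cutRank G (prefix π i) k
    (narrow-cong G {X = segment o i} {prefix π i !_}
      (λ v → trans (segment-index o i v refl) (sym (lookup∘tabulate _ v)))
      (segment-narrow o (≤-trans (≤-reflexive (#-none {n})) z≤n) i))
    where
    π : Permutation′ n
    π = permutation (nth o) (λ v → index o v refl) (λ v → nth-index o v refl) (λ i → index-nth o i refl)

-- Consecutive sets may be equal, which keeps the notion stable under `cut`; `order-before` later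
-- skips the steps that add no vertex.
data Grow {n} (Q : Fin n → Bool) : List (Fin n → Bool) → Set where
  top : ∀ {X} → X ≗ᵇ Q → Grow Q (X ∷ [])
  add : ∀ {X Y s} x → (∀ v → v ≢ x → Y v ≡ X v) → X ≼ Y → Grow Q (Y ∷ s) → Grow Q (X ∷ Y ∷ s)

grow-≼ : ∀ {n} {Q : Fin n → Bool} {X s} → Grow Q (X ∷ s) → All (X ≼_) s × AllPairs _≼_ s
grow-≼ (top _) = [] , []
grow-≼ {X = X} (add {Y = Y} _ _ X≼Y g) with grow-≼ g
... | Y≼ , pairs = X≼Y ∷ All.map (λ {Z} → ≼-trans {f = X} {Y} {Z} X≼Y) Y≼ , Y≼ ∷ pairs

grow-⊆ : ∀ {n} {Q : Fin n → Bool} {s} → Grow Q s → All (_≼ Q) s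
grow-⊆ {Q = Q} (top {X} e) = ≗⇒≼ {f = X} e ∷ []
grow-⊆ {Q = Q} (add {X} {Y} _ _ X≼Y g) with grow-⊆ g
... | Y≼ ∷ rest = ≼-trans {f = X} {Y} {Q} X≼Y Y≼ ∷ Y≼ ∷ rest

cut : ∀ {n} → (Fin n → Bool) → (Fin n → Bool) → Fin n → Bool
cut P X v = X v ∧ P v

grow-cut : ∀ {n} {Q P : Fin n → Bool} {s} → P ≼ Q → Grow Q s → Grow P (map (cut P) s)
grow-cut {Q = Q} {P} P≼Q (top {X} e) = top λ v → trans (cong (_∧ P v) (e v)) (absorb (P≼Q v))
  where
  absorb : ∀ {p q} → (p ⇒ q) ≡ true → q ∧ p ≡ p
  absorb {true}  {true}  _ = refl
  absorb {false} {true}  _ = refl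
  absorb {false} {false} _ = refl
grow-cut {P = P} P≼Q (add {X} {Y} x e X≼Y g) =
  add x (λ v ne → cong (_∧ P v) (e v ne))
    (λ v → mp (taut 3 (λ p x y → (x ⇒ y) ⇒ x ∧ p ⇒ y ∧ p) refl (P v) (X v) (Y v)) (X≼Y v)) (grow-cut P≼Q g)

align-mapˡ : ∀ {A B C : Set} {R : A → B → Set} {S : C → B → Set} (f : A → C) → (∀ {x y} → R x y → S (f x) y) →
             ∀ {xs ys} → Align R xs ys → Align S (map f xs) ys
align-mapˡ f h (end r)     = end (h r)
align-mapˡ f h (left r a)  = left (h r) (align-mapˡ f h a)
align-mapˡ f h (right r a) = right (h r) (align-mapˡ f h a)

align-with : ∀ {A B : Set} {R : A → B → Set} {P : A → Set} {xs ys} → All P xs → Align R xs ys → Align (λ x y → P x × R x y) xs ys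
align-with (p ∷ _)  (end r)     = end (p , r)
align-with (p ∷ ps) (left r a)  = left (p , r) (align-with ps a)
align-with (p ∷ ps) (right r a) = right (p , r) (align-with (p ∷ ps) a)

join : ∀ {n} → (Fin n → Bool) → (Fin n → Bool) → Fin n → Bool
join S T v = S v ∨ T v

order-before : ∀ {n} {G : Adj n} {k W W'} x → (∀ v → v ≢ x → W' v ≡ W v) → W ≼ W' → Narrow G k W' →
               ∃ (Order G k W') → ∃ (Order G k W)
order-before {G = G} {W = W} {W'} x same W≼W' nar (r , o) with W x in e | W' x in e'
... | true  | true  = r , order-cong same' o
  where
  same' : W' ≗ᵇ W
  same' v with v ≟ x
  ... | yes refl = trans e' (sym e)
  ... | no ne = same v ne
... | false | false = r , order-cong same' o
  where
  same' : W' ≗ᵇ W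
  same' v with v ≟ x
  ... | yes refl = trans e' (sym e)
  ... | no ne = same v ne
... | true  | false = contradiction (trans (sym e') (mp {W x} (W≼W' x) e)) λ ()
... | false | true  = suc r , place x e (narrow-cong G {X = W'} {W ∪ x} same' nar) (order-cong same' o)
  where
  same' : W' ≗ᵇ (W ∪ x)
  same' v with v ≟ x
  ... | yes refl = e'
  ... | no ne = same v ne

align⇒order : ∀ {n} {G : Adj n} {k} {Q P : Fin n → Bool} → (∀ v → Q v ∨ P v ≡ true) → ∀ {S Ss T Ts} →
              Align (λ S T → Narrow G k (join S T)) (S ∷ Ss) (T ∷ Ts) → Grow Q (S ∷ Ss) → Grow P (T ∷ Ts) → ∃ (Order G k (join S T))
align⇒order cover (end _) (top e) (top e') = 0 , full λ v → trans (cong₂ _∨_ (e v) (e' v)) (cover v)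
align⇒order cover {T = T} (left _ a) (add {X} {Y} x same X≼Y g) h =
  order-before {W = join X T} {join Y T} x (λ v ne → cong (_∨ T v) (same v ne))
    (λ v → mp (taut 3 (λ x y t → (x ⇒ y) ⇒ x ∨ t ⇒ y ∨ t) refl (X v) (Y v) (T v)) (X≼Y v)) (align-head a) (align⇒order cover a g h)
align⇒order cover {S = S} (right _ a) g (add {X} {Y} x same X≼Y h) =
  order-before {W = join S X} {join S Y} x (λ v ne → cong (S v ∨_) (same v ne))
    (λ v → mp (taut 3 (λ x y s → (x ⇒ y) ⇒ s ∨ x ⇒ s ∨ y) refl (X v) (Y v) (S v)) (X≼Y v)) (align-head a) (align⇒order cover a g h)

layout-chain : ∀ {n} {G : Adj n} {D a k} (L : Layout G D a k) → Chain (suc (Layout.len L)) (Layout.X L)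
layout-chain L t (s≤s t<len) with Layout.grow L t t<len
... | x , out , in' , same = sub , x , out , in'
  where
  sub : Layout.X L t ≼ Layout.X L (suc t)
  sub v with v ≟ x
  ... | yes refl rewrite out = refl
  ... | no ne rewrite same v ne = ≼-refl {f = Layout.X L t} v

-- Every initial segment is split into its parts in P and Q. The vertex placed next lies in exactly
-- one of them, which decides the direction of the path.
layout-align : ∀ {n} {G : Adj n} {D a k} (L : Layout G D a k) (P Q : Fin n → Bool) →
               (∀ v → not (D v) ≡ P v ∨ Q v) → (∀ v → (P v ⇒ not (Q v)) ≡ true) → (F : (S T : Fin n → Bool) → Set) →
               (∀ S T → S ≼ P → T ≼ Q → # (join S T) ≤ k + dim (Link G a (join S T) D) → F S T) →
               ∃₂ λ S Ss → ∃₂ λ T Ts → (∀ v → S v ≡ false) × (∀ v → T v ≡ false) ×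
                 Align F (S ∷ Ss) (T ∷ Ts) × Grow P (S ∷ Ss) × Grow Q (T ∷ Ts)
layout-align {n} {G} {D} {a} {k} L P Q cover disj F make =
  cut P (X 0) , proj₁ res , cut Q (X 0) , proj₁ (proj₂ res) ,
  (λ v → cong (_∧ P v) (start v)) , (λ v → cong (_∧ Q v) (start v)) , proj₂ (proj₂ res)
  where
  open Layout L
  within : ∀ t → t ≤ len → X t ≼ ∁ D
  within t t≤len = ≼-trans {f = X t} {X len} {∁ D} (chain-mono (layout-chain L) t≤len ≤-refl) (≗⇒≼ {f = X len} finish)
  good : ∀ t → t ≤ len → ∀ {S T} → S ≗ᵇ cut P (X t) → T ≗ᵇ cut Q (X t) → F S T
  good t t≤len {S} {T} eS eT = make S T
    (λ v → trans (cong (λ s → s ⇒ P v) (eS v)) (taut 2 (λ x p → x ∧ p ⇒ p) refl (X t v) (P v)))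
    (λ v → trans (cong (λ s → s ⇒ Q v) (eT v)) (taut 2 (λ x p → x ∧ p ⇒ p) refl (X t v) (Q v)))
    (≤-trans (≤-reflexive (#-cong (λ v → sym (e v)))) (≤-trans (width t t≤len)
      (+-monoʳ-≤ k (dim-mono (Link G a (X t) D) (Link G a (join S T) D) (K-mono G {link∈ a (X t) D} {link∋ a (X t) D} {link∈ a (join S T) D} {link∋ a (join S T) D}
        (≗⇒≼ {f = link∈ a (X t) D} (λ v → cong (_∨ (D v ∧ a v)) (e v))) (≗⇒≼ {f = link∋ a (X t) D} (λ v → cong (_∨ (D v ∧ not (a v))) (e v))))))))
    where
    e : ∀ v → X t v ≡ join S T v
    e v = sym (trans (cong₂ _∨_ (eS v) (eT v)) (bool-≡ (mp (taut 3 (λ x p q → (x ⇒ p ∨ q) ⇒ not (((x ∧ p) ∨ (x ∧ q)) xor x)) refl (X t v) (P v) (Q v))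
      (trans (cong (X t v ⇒_) (sym (cover v))) (within t t≤len v)))))
  run : ∀ r t → r + t ≡ len → ∀ {S T} → S ≗ᵇ cut P (X t) → T ≗ᵇ cut Q (X t) →
        ∃₂ λ Ss Ts → Align F (S ∷ Ss) (T ∷ Ts) × Grow P (S ∷ Ss) × Grow Q (T ∷ Ts)
  run zero t refl eS eT = [] , [] , end (good t ≤-refl eS eT) ,
    top (λ v → trans (eS v) (trans (cong (_∧ P v) (trans (finish v) (cover v))) (bool-≡ (taut 2 (λ p q → not (((p ∨ q) ∧ p) xor p)) refl (P v) (Q v))))) ,
    top (λ v → trans (eT v) (trans (cong (_∧ Q v) (trans (finish v) (cover v))) (bool-≡ (taut 2 (λ p q → not (((p ∨ q) ∧ q) xor q)) refl (P v) (Q v)))))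
  run (suc r) t eq {S} {T} eS eT = cases (P x) refl
    where
    t<len : t < len
    t<len = ≤-trans (s≤s (m≤n+m t r)) (≤-reflexive eq)
    eq' : r + suc t ≡ len
    eq' = trans (+-suc r t) eq
    step-t = grow t t<len
    x = proj₁ step-t
    same : ∀ v → v ≢ x → X (suc t) v ≡ X t v
    same = proj₂ (proj₂ (proj₂ step-t))
    X≼ : X t ≼ X (suc t)
    X≼ = proj₁ (layout-chain L t (s≤s t<len))
    grows : ∀ (R : Fin n → Bool) {U} → U ≗ᵇ cut R (X t) → U ≼ cut R (X (suc t))
    grows R eU v = trans (cong (λ u → u ⇒ (X (suc t) v ∧ R v)) (eU v)) (mp (taut 3 (λ x y p → (x ⇒ y) ⇒ x ∧ p ⇒ y ∧ p) refl (X t v) (X (suc t) v) (R v)) (X≼ v))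
    differs : ∀ (R : Fin n → Bool) {U} → U ≗ᵇ cut R (X t) → ∀ v → v ≢ x → cut R (X (suc t)) v ≡ U v
    differs R eU v ne = trans (cong (_∧ R v) (same v ne)) (sym (eU v))
    stays : ∀ (R : Fin n → Bool) {U} → R x ≡ false → U ≗ᵇ cut R (X t) → U ≗ᵇ cut R (X (suc t))
    stays R Rx eU v with v ≟ x
    ... | yes refl = trans (eU v) (trans (cong (X t v ∧_) Rx) (trans (∧-zeroʳ _) (sym (trans (cong (X (suc t) v ∧_) Rx) (∧-zeroʳ _)))))
    ... | no ne = sym (differs R eU v ne)
    cases : ∀ b → P x ≡ b → ∃₂ λ Ss Ts → Align F (S ∷ Ss) (T ∷ Ts) × Grow P (S ∷ Ss) × Grow Q (T ∷ Ts)
    cases true Px with run r (suc t) eq' {cut P (X (suc t))} {T} (λ _ → refl) (stays Q Qx eT)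
      where
      Qx : Q x ≡ false
      Qx = ¬-not (λ Qx → contradiction (trans (sym (cong not Qx)) (mp {P x} (disj x) Px)) λ ())
    ... | Ss , Ts , al , g , h = cut P (X (suc t)) ∷ Ss , Ts , left (good t (<⇒≤ t<len) eS eT) al ,
                                 add x (differs P eS) (grows P eS) g , h
    cases false Px with run r (suc t) eq' {S} {cut Q (X (suc t))} (stays P Px eS) (λ _ → refl)
    ... | Ss , Ts , al , g , h = Ss , cut Q (X (suc t)) ∷ Ts , right (good t (<⇒≤ t<len) eS eT) al ,
                                 g , add x (differs Q eT) (grows Q eT) h
  res = run len 0 (+-identityʳ len) {cut P (X 0)} {cut Q (X 0)} (λ _ → refl) (λ _ → refl)

-- Coding of subspaces and the number of types

undigit : Fin 2 → Bool
undigit zero    = false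
undigit (suc _) = true

undigit-digit : ∀ b → undigit (digit b) ≡ b
undigit-digit true  = refl
undigit-digit false = refl

decode : ∀ {d} → Fin (2 ^ d) → V d
decode {zero}  _ = []
decode {suc d} i = undigit (proj₁ (remQuot {2} (2 ^ d) i)) ∷ decode (proj₂ (remQuot {2} (2 ^ d) i))

decode-encode : ∀ {d} (c : V d) → decode (encode-subset c) ≡ c
decode-encode [] = refl
decode-encode {suc d} (b ∷ c) = trans
  (cong (λ p → undigit (proj₁ p) ∷ decode (proj₂ p)) (remQuot-combine {2} {2 ^ d} (digit b) (encode-subset c)))
  (cong₂ _∷_ (undigit-digit b) (decode-encode c))

-- The characteristic vector of U: an element of a finite type that can be compared across different
-- i and that respects inclusion.
code : ∀ {d} → Sub d → Subset (2 ^ d)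
code U = tabulate (λ i → does (dec U (decode i)))

code-⊆ : ∀ {d} (U W : Sub d) → U ⊑ W → code U ⊆ code W
code-⊆ U W U⊑W {i} p = !⇒∈ (trans (lookup∘tabulate _ i) (dec-true (dec W (decode i)) (U⊑W _ member)))
  where
  member : Mem U (decode i)
  member with dec U (decode i) | trans (sym (lookup∘tabulate (λ i → does (dec U (decode i))) i)) (∈⇒! p)
  ... | yes m | _ = m

code-≡ : ∀ {d} (U W : Sub d) → code U ≡ code W → U ⊑ W
code-≡ U W e c m with dec W c in eq
... | yes m' = m'
... | no _ = contradiction (trans (sym (value U)) (trans (cong (_! encode-subset c) e) (value W)))
    (λ q → contradiction (trans (sym (dec-true (dec U c) m)) (trans q (cong does eq))) λ ())
  where
  value : ∀ X → code X ! encode-subset c ≡ does (dec X c)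
  value X = trans (lookup∘tabulate _ (encode-subset c)) (cong (λ z → does (dec X z)) (decode-encode c))

-- The number of types at the highest possible level w = k + 1.
total : ℕ → ℕ
total k = words (2 ^ (h + h)) (suc (k + (h + h))) (suc (2 ^ (h + h)) * block-length (suc (k + (h + h))))
  where h = suc k

block-length-mono : ∀ {r s} → r ≤ s → block-length r ≤ block-length s
block-length-mono z≤n     = z≤n
block-length-mono (s≤s h) = +-mono-≤ (block-length-mono h) (+-monoʳ-≤ 3 (block-length-mono h))

words-mono : ∀ {N N' κ κ' L L'} → N ≤ N' → κ ≤ κ' → L ≤ L' → words N κ L ≤ words N' κ' L'
words-mono {N} {N'} {κ} {κ'} {L} {L'} p q r = ≤-trans
  (^-monoˡ-≤ L (s≤s (*-mono-≤ (^-monoʳ-≤ 2 p) q))) (^-monoʳ-≤ (suc (2 ^ N' * κ')) r)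

words≤total : ∀ {k w} → w ≤ suc k →
  words (2 ^ (w + w)) (suc (k + (w + w))) (suc (2 ^ (w + w)) * block-length (suc (k + (w + w)))) ≤ total k
words≤total {k} {w} w≤ = words-mono (^-monoʳ-≤ 2 2w) κ≤ (*-mono-≤ (s≤s (^-monoʳ-≤ 2 2w)) (block-length-mono κ≤))
  where
  2w : w + w ≤ suc k + suc k
  2w = +-mono-≤ w≤ w≤
  κ≤ : suc (k + (w + w)) ≤ suc (k + (suc k + suc k))
  κ≤ = s≤s (+-monoʳ-≤ k 2w)

none : ∀ {n} → Fin n → Bool
none _ = false

-- With u back in G and outside all the sets, the one new condition is (Mx)_u = 0, so the width
-- grows by at most one. The n - 1 placements give n sets, the empty one included.
undelete : ∀ {n} (G : Adj n) {k} (u : Fin n) → Layout G (is u) none k →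
           Σ (ℕ → Fin n → Bool) λ X → Chain n X × (∀ t → t < n → Narrow G (suc k) (X t))
undelete {n} G {k} u L = X , subst (λ m → Chain m X) len+1 (layout-chain L) , λ t t<n →
    nar t (s≤s⁻¹ (≤-trans t<n (≤-reflexive (sym len+1))))
  where
  open Layout L
  open ≤-Reasoning
  len+1 : suc len ≡ n
  len+1 = trans (+-comm 1 len) (trans (cong (len +_) (sym (#-is u))) len+#D)
  nar : ∀ t → t ≤ len → Narrow G (suc k) (X t)
  nar t t≤ = begin
    # (X t)                                     ≤⟨ width t t≤ ⟩
    k + dim (Link G none (X t) (is u))          ≤⟨ +-monoʳ-≤ k (codim G all (is u) (Link G none (X t) (is u)) (K′ G (X t)) mem) ⟩
    k + (dim (K′ G (X t)) + # (is u))           ≡⟨ trans (cong (λ z → k + (dim (K′ G (X t)) + z)) (#-is u)) (lem k _) ⟩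
    suc k + dim (K′ G (X t))                    ∎
    where
    lem : ∀ a b → a + (b + 1) ≡ suc a + b
    lem = solve-∀
    mem : ∀ x → Mem (Link G none (X t) (is u)) x → (∀ v → is u v ≡ true → coord G all x v ≡ false) → Mem (K′ G (X t)) x
    mem x m c v with X t v | is u v | m v | c v
    ... | true  | _     | _  | _  = (λ ()) , λ ()
    ... | false | true  | m' | c' = (λ _ → proj₁ m' refl) , λ _ → c' refl
    ... | false | false | m' | _  = (λ _ → proj₁ m' refl) , λ _ → proj₂ m' refl

-- Plain deletion of u: with `none` the only constraint is x_u = 0, so `free` is immediate.
first-layout : ∀ {n} (G : Adj n) {k} → IsSimple G → ExcludedPivotMinorLRW k G → (u : Fin n) → Layout G (is u) none k
first-layout G simple excl u = minor-layout G simple excl (is u) none (u , is-refl u)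
  λ x m → ext λ v → trans (proj₁ (m v) (∧-zeroʳ (is u v))) (sym (!-0v v))

-- Exchanging the halves of two gluings

module Exchange {n} (G : Adj n) (simple : IsSimple G) {k : ℕ} (excl : ExcludedPivotMinorLRW k G)
                (l w : ℕ) (A : ℕ → Fin n → Bool) (chain : Chain (suc l) A)
                (narrow : ∀ t → t < suc l → Narrow G w (A t))
                (a : Fin n → Bool) (linked : w + dim (Link G a (A 0) (A l)) ≤ # (A 0)) where

  private
    mono : ∀ {i j} → i ≤ j → j ≤ l → A i ≼ A j
    mono i≤j j≤l = chain-mono chain i≤j (s≤s j≤l)

  open Family G (proj₁ simple) l w A mono (λ {i} i≤l → narrow i (s≤s i≤l)) a linked

  free : ∀ {i} → suc i ≤ l → ∀ x → Mem (Link G a (λ _ → false) (λ v → A (suc i) v ∧ not (A i v))) x → x ≡ 0v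
  free {i} i<l x m = ext λ v → trans (zero-at v) (sym (!-0v v))
    where
    D : Fin n → Bool
    D v = A (suc i) v ∧ not (A i v)
    x∈ : Mem (K′ G (A i)) x
    x∈ = link⊑ (n≤1+n i) i<l x (K-mono G {link∈ a (λ _ → false) D} {link∋ a (λ _ → false) D} {link∈ a (A i) (A (suc i))} {link∋ a (A i) (A (suc i))}
      (λ v → taut 3 (λ p q a → (q ∧ not p) ∧ a ⇒ p ∨ (q ∧ a)) refl (A i v) (A (suc i) v) (a v))
      (λ v → taut 3 (λ p q a → (q ∧ not p) ∧ not a ⇒ p ∨ (q ∧ not a)) refl (A i v) (A (suc i) v) (a v)) x m)
    zero-at : ∀ v → x ! v ≡ false
    zero-at v with A i v | proj₁ (x∈ v) | proj₁ (m v)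
    ... | false | z | _ = z refl
    ... | true  | _ | z = z (cong (_∧ a v) (∧-zeroʳ (A (suc i) v)))

  -- The inequality bounding the cut-rank of S ∪ T, when A i and C j are glued along their signals.
  Fits : ℕ → ℕ → (S T : Fin n → Bool) → Set
  Fits i j S T = # S + # T ≤ k + (dim (K′ G S) + dim (K′ G T) + dim (Trace (A i) S ⊓ Trace (C j) T))

  record Glued (i j : ℕ) : Set where
    field
      {S T}   : Fin n → Bool
      {Ss Ts} : List (Fin n → Bool)
      S∅      : ∀ v → S v ≡ false
      T∅      : ∀ v → T v ≡ false
      aligned : Align (Fits i j) (S ∷ Ss) (T ∷ Ts)
      growˡ   : Grow (A i) (S ∷ Ss)
      growʳ   : Grow (C j) (T ∷ Ts)

  glue : ∀ {i} → suc i ≤ l → Glued i (suc i)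
  glue {i} i<l = let S , Ss , T , Ts , S∅ , T∅ , al , g , h = traces in
    record { S∅ = S∅ ; T∅ = T∅ ; aligned = al ; growˡ = g ; growʳ = h }
    where
    D : Fin n → Bool
    D v = A (suc i) v ∧ not (A i v)
    nonempty : ∃ λ v → D v ≡ true
    nonempty with proj₂ (chain i (s≤s i<l))
    ... | v , out , in' = v , cong₂ (λ x y → x ∧ not y) in' out
    layout : Layout G D a k
    layout = minor-layout G simple excl D a nonempty (free i<l)
    sub : A i ≼ A (suc i)
    sub = mono (n≤1+n i) i<l
    disj : ∀ v → (A i v ⇒ not (C (suc i) v)) ≡ true
    disj v = mp (taut 2 (λ p q → (p ⇒ q) ⇒ p ⇒ not (not q)) refl (A i v) (A (suc i) v)) (sub v)
    traces = layout-align layout (A i) (C (suc i))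
      (λ v → bool-≡ (mp (taut 2 (λ p q → (p ⇒ q) ⇒ not (not (q ∧ not p) xor (p ∨ not q))) refl (A i v) (A (suc i) v)) (sub v)))
      disj (Fits i (suc i)) λ S T S≼ T≼ le → ≤-trans
        (≤-reflexive (#-⊎ {f = S} {T} {join S T} (λ v → ≡ᵇ-sound (mp (mp (mp (taut 4 (λ p q s t → (p ⇒ q) ⇒ (s ⇒ p) ⇒ (t ⇒ not q) ⇒
          (b2n s + b2n t) Data.Nat.≡ᵇ b2n (s ∨ t)) refl (A i v) (A (suc i) v) (S v) (T v)) (sub v)) (S≼ v)) (T≼ v)))))
        (≤-trans le (+-monoʳ-≤ k (minor-dim (n≤1+n i) i<l S T S≼ T≼)))

  glued⇒LRW : ∀ {j} → j ≤ l → Glued j j → LRW≤ G k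
  glued⇒LRW {j} j≤l gl = order⇒LRW (subst (Order G k _) r≡n (proj₂ final))
    where
    open Glued gl
    narrowed : Align (λ S T → Narrow G k (join S T)) (S ∷ Ss) (T ∷ Ts)
    narrowed = align-map (λ { {S} {T} (S≼ , T≼ , le) → ≤-trans (≤-reflexive (sym (#-⊎ {f = S} {T} {join S T}
        (λ v → ≡ᵇ-sound (mp (mp (taut 3 (λ p s t → (s ⇒ p) ⇒ (t ⇒ not p) ⇒ (b2n s + b2n t) Data.Nat.≡ᵇ b2n (s ∨ t)) refl (A j v) (S v) (T v)) (S≼ v)) (T≼ v))))))
        (≤-trans le (+-monoʳ-≤ k (whole-dim j≤l S T S≼ T≼))) })
      (align-both (grow-⊆ growˡ) (grow-⊆ growʳ) aligned)
      where
      align-both : ∀ {X Y : Set} {R : X → Y → Set} {P : X → Set} {Q : Y → Set} {xs ys} → All P xs → All Q ys → Align R xs ys →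
                   Align (λ x y → P x × Q y × R x y) xs ys
      align-both (p ∷ _)  (q ∷ _)  (end r)     = end (p , q , r)
      align-both (p ∷ ps) (q ∷ qs) (left r al)  = left (p , q , r) (align-both ps (q ∷ qs) al)
      align-both (p ∷ ps) (q ∷ qs) (right r al) = right (p , q , r) (align-both (p ∷ ps) qs al)
    ordered : ∃ (Order G k (join S T))
    ordered = align⇒order (λ v → bool-≡ (taut 1 (λ p → not ((p ∨ not p) xor true)) refl (A j v))) narrowed growˡ growʳ
    final : ∃ (Order G k (λ _ → false))
    final = proj₁ ordered , order-cong (λ v → cong₂ _∨_ (S∅ v) (T∅ v)) (proj₂ ordered)
    r≡n : proj₁ final ≡ n
    r≡n = trans (sym (+-identityʳ _)) (trans (cong (proj₁ final +_) (sym (#-none {n}))) (order-size (proj₂ final)))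

  restrict : ∀ {i j} → i ≤ j → j ≤ l → ∀ {m} → Glued j m → Glued i m
  restrict {i} {j} i≤j j≤l {m} gl = record
    { S∅ = λ v → cong (_∧ A i v) (S∅ v) ; T∅ = T∅
    ; aligned = align-mapˡ (cut (A i)) (λ { {S} {T} (S≼ , le) → smaller S T S≼ le }) (align-with (grow-⊆ growˡ) aligned)
    ; growˡ = grow-cut (mono i≤j j≤l) growˡ ; growʳ = growʳ }
    where
    open Glued gl
    open ≤-Reasoning
    smaller : ∀ S T → S ≼ A j → Fits j m S T → Fits i m (cut (A i) S) T
    smaller S T S≼ le = +-cancelˡ-≤ (kS + dS + # S) _ _ (begin
      (kS + dS + # S) + (# S° + # T)             ≡⟨ lem₁ (kS + dS) (# S) (# S°) (# T) ⟩
      (kS + dS + # S°) + (# S + # T)             ≤⟨ +-mono-≤ (restrict-dim i≤j j≤l S S≼ Γ) le ⟩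
      (# S + (kS° + dS°)) + (k + (kS + kT + dS)) ≡⟨ lem₂ (# S) kS° dS° k kS kT dS ⟩
      (kS + dS + # S) + (k + (kS° + kT + dS°))   ∎)
      where
      S° = cut (A i) S
      Γ = Trace (C m) T
      kS = dim (K′ G S)
      kS° = dim (K′ G S°)
      kT = dim (K′ G T)
      dS = dim (Trace (A j) S ⊓ Γ)
      dS° = dim (Trace (A i) S° ⊓ Γ)
      lem₁ : ∀ a b c d → (a + b) + (c + d) ≡ (a + c) + (b + d)
      lem₁ = solve-∀
      lem₂ : ∀ s k° d° k ks kt d → (s + (k° + d°)) + (k + (ks + kt + d)) ≡ (ks + d + s) + (k + (k° + kt + d°))
      lem₂ = solve-∀

  -- N is the number of signals. A left half can exceed cut-rank k only by what is regained through
  -- the common traces, which is at most 2w; hence κ.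
  N κ : ℕ
  N = 2 ^ (w + w)
  κ = suc (k + (w + w))

  letter : ℕ → (Fin n → Bool) → Letter N
  letter i S = code (Trace (A i) S) , # S ∸ dim (K′ G S)

  dim-K′ : ∀ S → dim (K′ G S) ≤ # S
  dim-K′ S = ≤-trans (dim-mono (K′ G S) (pow S) (λ x m v → proj₁ (m v))) (≤-reflexive (dim-pow S))

  trace-mono : ∀ i {S S'} → S ≼ S' → Trace (A i) S ⊑ Trace (A i) S'
  trace-mono i {S} {S'} S≼ c (y , y∈ , p) = y , y∈ ,
    K-mono G {λ v → not (A i v) ∨ S v} {λ v → not (A i v) ∨ S v} {λ v → not (A i v) ∨ S' v} {λ v → not (A i v) ∨ S' v} up up (y ⊕ app q c) p
    where
    up : ∀ v → (not (A i v) ∨ S v ⇒ not (A i v) ∨ S' v) ≡ true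
    up v = mp (taut 3 (λ p s t → (s ⇒ t) ⇒ not p ∨ s ⇒ not p ∨ t) refl (A i v) (S v) (S' v)) (S≼ v)

  small-letter : ∀ {i j S T} → Fits i j S T → proj₂ (letter i S) < κ
  small-letter {i} {j} {S} {T} le = s≤s (m≤n+o⇒m∸n≤o (# S) (dim (K′ G S)) (+-cancelʳ-≤ (# T) _ _ (begin
    # S + # T                                   ≤⟨ le ⟩
    k + (dim (K′ G S) + dim (K′ G T) + dim Λ)   ≤⟨ +-monoʳ-≤ k (+-mono-≤ (+-monoʳ-≤ (dim (K′ G S)) (dim-K′ T)) (dim≤n Λ)) ⟩
    k + (dim (K′ G S) + # T + (w + w))          ≡⟨ lem k (dim (K′ G S)) (# T) (w + w) ⟩
    dim (K′ G S) + (k + (w + w)) + # T          ∎)))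
    where
    open ≤-Reasoning
    Λ = Trace (A i) S ⊓ Trace (C j) T
    lem : ∀ k s t v → k + (s + t + v) ≡ s + (k + v) + t
    lem = solve-∀

  module _ {i j} (gl : Glued i j) where
    open Glued gl

    word : List (Letter N)
    word = map (letter i) (S ∷ Ss)

    word-small : All (λ b → proj₂ b < κ) word
    word-small = All.map⁺ (align-all (λ {S} {T} → small-letter {i} {j} {S} {T}) aligned)

    normalise : ∃ λ t → length t ≤ suc N * block-length κ × Similar _≤ᴸ_ word t
    -- The sizes 0, ..., N allow at most N + 1 distinct traces in an increasing sequence.
    normalise = normal-form κ (suc N) word
      (AllPairs.map⁺ (AllPairs-map (λ {X} {Y} X≼Y → code-⊆ (Trace (A i) X) (Trace (A i) Y) (trace-mono i X≼Y)) (let X≼ , rest = grow-≼ growˡ in X≼ ∷ rest)))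
      word-small (All.tabulate (λ {b} _ → m≤n+m (suc N) ∣ proj₁ b ∣))
      where
      AllPairs-map : ∀ {X : Set} {R R' : X → X → Set} {xs} → (∀ {x y} → R x y → R' x y) → AllPairs R xs → AllPairs R' xs
      AllPairs-map f []       = []
      AllPairs-map f (p ∷ ps) = All.map f p ∷ AllPairs-map f ps

    normal-small : All (λ b → proj₂ b < κ) (proj₁ normalise)
    normal-small = sim-all (λ { (_ , x≤y) y<κ → ≤-trans (s≤s x≤y) y<κ }) (proj₂ (proj₂ (proj₂ normalise))) word-small

    type : Fin (words N κ (suc N * block-length κ))
    type = encode-word (suc N * block-length κ) (proj₁ normalise) normal-small (proj₁ (proj₂ normalise))

  -- Equal types allow the right half of one gluing to be attached to the left half of the other.
  exchange : ∀ {i j m m'} (gl : Glued i m) (gl' : Glued j m') → type gl ≡ type gl' → Glued j m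
  exchange {i} {j} {m} {m'} gl gl' e = record
    { S∅ = Glued.S∅ gl' ; T∅ = Glued.T∅ gl ; growˡ = Glued.growˡ gl' ; growʳ = Glued.growʳ gl
    -- The left sequence of `gl'` runs below the common normal form, and this runs below the left
    -- sequence of `gl`. So each S met along the path has the trace of some S' aligned with T in
    -- `gl`, and no larger cut-rank.
    ; aligned = align-map (λ { {S} {T} (_ , up , S' , down , le) → transfer S S' T up down le })
        (sim-align (sim-mapˡ⁻ (letter j) _ (proj₁ (proj₂ (proj₂ (normalise gl')))))
          (sim-align (sim-mapʳ⁻ (letter i) _ (subst (λ t → Sim _≤ᴸ_ t (word gl)) same (proj₂ (proj₂ (proj₂ (normalise gl)))))) (Glued.aligned gl))) }
    where
    open ≤-Reasoning
    same : proj₁ (normalise gl) ≡ proj₁ (normalise gl')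
    same = encode-word-injective {N} {κ} (suc N * block-length κ) _ _ (normal-small gl) (normal-small gl') _ _ e
    transfer : ∀ S S' T {b} → letter j S ≤ᴸ b → b ≤ᴸ letter i S' → Fits i m S' T → Fits j m S T
    transfer S S' T (c , x≤) (c' , x≤') le = +-cancelʳ-≤ kS' _ _ (begin
      (# S + # T) + kS'                            ≡⟨ cong (λ z → (z + # T) + kS') (sym (m+[n∸m]≡n (dim-K′ S))) ⟩
      (kS + (# S ∸ kS) + # T) + kS'                ≤⟨ +-monoˡ-≤ kS' (+-monoˡ-≤ (# T) (+-monoʳ-≤ kS (≤-trans x≤ x≤'))) ⟩
      (kS + (# S' ∸ kS') + # T) + kS'              ≡⟨ lem₁ kS (# S' ∸ kS') (# T) kS' ⟩
      kS + ((kS' + (# S' ∸ kS')) + # T)            ≡⟨ cong (λ z → kS + (z + # T)) (m+[n∸m]≡n (dim-K′ S')) ⟩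
      kS + (# S' + # T)                            ≤⟨ +-monoʳ-≤ kS le ⟩
      kS + (k + (kS' + kT + dim (Trace (A i) S' ⊓ Γ))) ≤⟨ +-monoʳ-≤ kS (+-monoʳ-≤ k (+-monoʳ-≤ (kS' + kT) (dim-mono (Trace (A i) S' ⊓ Γ) (Trace (A j) S ⊓ Γ)
                                                        (λ d (p , g) → code-≡ (Trace (A i) S') (Trace (A j) S) (sym (trans c c')) d p , g)))) ⟩
      kS + (k + (kS' + kT + dim (Trace (A j) S ⊓ Γ)))  ≡⟨ lem₂ kS k kS' kT _ ⟩
      k + (kS + kT + dim (Trace (A j) S ⊓ Γ)) + kS'    ∎)
      where
      Γ = Trace (C m) T
      kS = dim (K′ G S)
      kS' = dim (K′ G S')
      kT = dim (K′ G T)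
      lem₁ : ∀ a b c d → (a + b + c) + d ≡ a + ((d + b) + c)
      lem₁ = solve-∀
      lem₂ : ∀ a b c d e → a + (b + (c + d + e)) ≡ b + (a + d + e) + c
      lem₂ = solve-∀

  too-long : words N κ (suc N * block-length κ) < l → LRW≤ G k
  too-long lt = repeat (pigeonhole lt (λ i → type (glue {toℕ i} (toℕ<n i))))
    where
    repeat : (∃₂ λ i j → toℕ i < toℕ j × type (glue {toℕ i} (toℕ<n i)) ≡ type (glue {toℕ j} (toℕ<n j))) → LRW≤ G k
    repeat (i , j , i<j , e) = glued⇒LRW (toℕ<n i)
      (restrict i<j (<⇒≤ (toℕ<n j)) (exchange (glue {toℕ i} (toℕ<n i)) (glue {toℕ j} (toℕ<n j)) e))

bounded : ∀ {n} (G : Adj (suc n)) {k} → IsSimple G → ExcludedPivotMinorLRW k G →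
          ¬ (chain-length (suc (total k)) (suc k) ≤ suc n)
bounded G {k} simple excl le =
  let X , chain , narrow = undelete G zero (first-layout G simple excl zero)
      -- The chain provides l = `suc (total k)` gluings, one more than there are types.
      w , w≤ , A , A-chain , A-narrow , linked = linked-subchain G (suc (total k)) (suc k) X
        (λ t t< → chain t (≤-trans t< le)) (λ t t< → narrow t (≤-trans t< le))
      a , linkage = link G w (A 0) (A (suc (total k))) (chain-mono A-chain z≤n ≤-refl) linked
  in proj₁ excl (Exchange.too-long G simple excl (suc (total k)) w A A-chain A-narrow a linkage (s≤s (words≤total w≤)))

-- Numerical estimates

chain-length-^ : ∀ l w → chain-length l w ≡ suc l ^ suc w
chain-length-^ l zero    = sym (*-identityʳ (suc l))
chain-length-^ l (suc w) = trans (cong (_* suc l) (chain-length-^ l w)) (*-comm (suc l ^ suc w) (suc l))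

block-length-≡ : ∀ r → 3 + block-length r ≡ 3 * 2 ^ r
block-length-≡ zero    = refl
block-length-≡ (suc r) = trans (lem₁ (block-length r)) (trans (cong (2 *_) (block-length-≡ r)) (lem₂ (2 ^ r)))
  where
  lem₁ : ∀ b → 3 + (b + (3 + b)) ≡ 2 * (3 + b)
  lem₁ = solve-∀
  lem₂ : ∀ x → 2 * (3 * x) ≡ 3 * (2 * x)
  lem₂ = solve-∀

n<2^n : ∀ n → suc n ≤ 2 ^ n
n<2^n zero    = ≤-refl
n<2^n (suc n) = begin
  suc (suc n)    ≤⟨ +-mono-≤ (m^n>0 2 n) (n<2^n n) ⟩
  2 ^ n + 2 ^ n  ≡⟨ cong (2 ^ n +_) (sym (+-identityʳ _)) ⟩
  2 ^ suc n      ∎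
  where open ≤-Reasoning

1+2^n≤2^[1+n] : ∀ n → suc (2 ^ n) ≤ 2 ^ suc n
1+2^n≤2^[1+n] n = ≤-trans (+-monoˡ-≤ (2 ^ n) (m^n>0 2 n)) (≤-reflexive (cong (2 ^ n +_) (sym (+-identityʳ _))))

double-exponent : ∀ a b → (2 ^ (2 ^ a)) ^ (2 ^ b) ≡ 2 ^ (2 ^ (a + b))
double-exponent a b = trans (^-*-assoc 2 (2 ^ a) (2 ^ b)) (cong (2 ^_) (sym (^-distribˡ-+-* 2 a b)))

-- With h = k + 1, the base of the power is at most 2^(2^(3h + 1)), while its exponent L is only
-- singly exponential, at most 2^(5h + 3). The upper exponents add up.
total-≤ : ∀ k → total k ≤ 2 ^ (2 ^ (8 * suc k + 4))
total-≤ k = begin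
  suc (2 ^ N * κ) ^ L                          ≤⟨ ^-monoˡ-≤ L base ⟩
  (2 ^ (2 ^ (1 + (h + h + h)))) ^ L            ≤⟨ ^-monoʳ-≤ (2 ^ (2 ^ (1 + (h + h + h)))) exponent ⟩
  (2 ^ (2 ^ (1 + (h + h + h)))) ^ (2 ^ (1 + (h + h) + (2 + (h + h + h)))) ≡⟨ double-exponent (1 + (h + h + h)) _ ⟩
  2 ^ (2 ^ (1 + (h + h + h) + (1 + (h + h) + (2 + (h + h + h)))))       ≡⟨ cong (λ z → 2 ^ (2 ^ z)) (lem h) ⟩
  2 ^ (2 ^ (8 * h + 4))                        ∎
  where
  open ≤-Reasoning
  h = suc k
  N = 2 ^ (h + h)
  κ = suc (k + (h + h))
  L = suc N * block-length κ
  instance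
    positive : Data.Nat.NonZero (2 ^ (2 ^ (1 + (h + h + h))))
    positive = m^n≢0 2 (2 ^ (1 + (h + h + h)))
  lem : ∀ h → 1 + (h + h + h) + (1 + (h + h) + (2 + (h + h + h))) ≡ 8 * h + 4
  lem = solve-∀
  κ≡ : κ ≡ h + h + h
  κ≡ = sym (+-assoc h h h)
  base : suc (2 ^ N * κ) ≤ 2 ^ (2 ^ (1 + (h + h + h)))
  base = begin
    suc (2 ^ N * κ)            ≤⟨ s≤s (*-monoʳ-≤ (2 ^ N) (≤-trans (n≤1+n κ) (n<2^n κ))) ⟩
    suc (2 ^ N * 2 ^ κ)        ≡⟨ cong suc (sym (^-distribˡ-+-* 2 N κ)) ⟩
    suc (2 ^ (N + κ))          ≤⟨ 1+2^n≤2^[1+n] (N + κ) ⟩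
    2 ^ suc (N + κ)            ≤⟨ ^-monoʳ-≤ 2 (begin
      suc (N + κ)                                ≡⟨ sym (+-suc N κ) ⟩
      2 ^ (h + h) + suc κ                        ≤⟨ +-mono-≤ (^-monoʳ-≤ 2 (m≤m+n (h + h) h)) (≤-trans (n<2^n κ) (≤-reflexive (cong (2 ^_) κ≡))) ⟩
      2 ^ (h + h + h) + 2 ^ (h + h + h)          ≡⟨ cong (2 ^ (h + h + h) +_) (sym (+-identityʳ _)) ⟩
      2 ^ (1 + (h + h + h))                      ∎) ⟩
    2 ^ (2 ^ (1 + (h + h + h))) ∎
  exponent : L ≤ 2 ^ (1 + (h + h) + (2 + (h + h + h)))
  exponent = begin
    suc N * block-length κ                                ≤⟨ *-mono-≤ (1+2^n≤2^[1+n] (h + h)) (begin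
      block-length κ                                        ≤⟨ m≤n+m _ 3 ⟩
      3 + block-length κ                                    ≡⟨ block-length-≡ κ ⟩
      3 * 2 ^ κ                                             ≤⟨ *-monoˡ-≤ (2 ^ κ) (n≤1+n 3) ⟩
      4 * 2 ^ κ                                             ≡⟨ sym (^-distribˡ-+-* 2 2 κ) ⟩
      2 ^ (2 + κ)                                           ≡⟨ cong (λ z → 2 ^ (2 + z)) κ≡ ⟩
      2 ^ (2 + (h + h + h))                                 ∎) ⟩
    2 ^ (1 + (h + h)) * 2 ^ (2 + (h + h + h))             ≡⟨ sym (^-distribˡ-+-* 2 (1 + (h + h)) _) ⟩
    2 ^ (1 + (h + h) + (2 + (h + h + h)))                 ∎

chain-length-≤ : ∀ k → chain-length (suc (total k)) (suc k) ≤ 2 ^ (2 ^ (14 * (k + 1) ^ 2))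
chain-length-≤ k = begin
  chain-length (suc (total k)) h                       ≡⟨ chain-length-^ (suc (total k)) h ⟩
  suc (suc (total k)) ^ suc h                          ≤⟨ ^-monoˡ-≤ (suc h) (begin
    suc (suc (total k))                                  ≤⟨ s≤s (s≤s (total-≤ k)) ⟩
    suc (suc (2 ^ m))                                    ≤⟨ s≤s (1+2^n≤2^[1+n] m) ⟩
    suc (2 ^ suc m)                                      ≤⟨ 1+2^n≤2^[1+n] (suc m) ⟩
    2 ^ (2 + m)                                          ≤⟨ ^-monoʳ-≤ 2 (begin
      2 + m                                                ≤⟨ +-monoˡ-≤ m (^-monoʳ-≤ 2 {1} (≤-trans (s≤s (z≤n {3})) (m≤n+m 4 (8 * h)))) ⟩
      m + m                                                ≡⟨ cong (m +_) (sym (+-identityʳ m)) ⟩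
      2 ^ (1 + (8 * h + 4))                                ∎) ⟩
    2 ^ (2 ^ (1 + (8 * h + 4)))                          ∎) ⟩
  (2 ^ (2 ^ (1 + (8 * h + 4)))) ^ suc h                ≤⟨ ^-monoʳ-≤ (2 ^ (2 ^ (1 + (8 * h + 4)))) (n<2^n h) ⟩
  (2 ^ (2 ^ (1 + (8 * h + 4)))) ^ (2 ^ h)              ≡⟨ double-exponent (1 + (8 * h + 4)) h ⟩
  2 ^ (2 ^ (1 + (8 * h + 4) + h))                      ≤⟨ ^-monoʳ-≤ 2 (^-monoʳ-≤ 2 (begin
    1 + (8 * h + 4) + h                                  ≡⟨ lem₁ k ⟩
    -- The exponent reached is linear in k; its value at k = 0 is the constant 14, and the square
    -- enters only with this comparison.
    9 * k + 14                                           ≤⟨ m≤m+n (9 * k + 14) _ ⟩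
    (9 * k + 14) + (19 * k + 14 * (k * k))               ≡⟨ lem₂ k ⟩
    14 * (k + 1) ^ 2                                     ∎)) ⟩
  2 ^ (2 ^ (14 * (k + 1) ^ 2))                         ∎
  where
  open ≤-Reasoning
  h = suc k
  m = 2 ^ (8 * h + 4)
  instance
    positive : Data.Nat.NonZero (2 ^ (2 ^ (1 + (8 * h + 4))))
    positive = m^n≢0 2 (2 ^ (1 + (8 * h + 4)))
  lem₁ : ∀ k → 1 + (8 * suc k + 4) + suc k ≡ 9 * k + 14
  lem₁ = solve-∀
  lem₂ : ∀ k → (9 * k + 14) + (19 * k + 14 * (k * k)) ≡ 14 * ((k + 1) * ((k + 1) * 1))
  lem₂ = solve-∀

theorem1p2 : Σ ℕ λ c → 1 ≤ c ×
    (∀ (k n : ℕ) (G : Adj n) → IsSimple G → ExcludedPivotMinorLRW k G →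
    n ≤ 2 ^ (2 ^ (c * ((k + 1) ^ 2))))
theorem1p2 = 14 , s≤s z≤n , λ where
  k zero    G simple excl → z≤n
  k (suc n) G simple excl → ≤-trans (≰⇒≥ (bounded G simple excl)) (chain-length-≤ k)
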